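{- Let $\varepsilon>0$ be fixed. For any directed graph $G=(V,E)$ on $n$ vertices with positive integer edge weights that are polynomial in $n$, and any set $P\subseteq V\times V$ of $p=|P|$ demand pairs, one can compute a $(1+\varepsilon)$-approximate distance preserver of $G$ with respect to $P$ with $\tilde O\big(n p^{1/3}+n^{2/3}p^{2/3}\big)$ edges.
   Context: For a directed weighted graph $G$, $\mathrm{dist}_G(u,v)$ denotes the weighted shortest-path distance from $u$ to $v$ ($\infty$ if $u$ cannot reach $v$). Given $G=(V,E)$ and a set of demand pairs $P\subseteq V\times V$, a $(1+\varepsilon)$-approximate distance preserver is a subgraph $G'\subseteq G$ such that $\mathrm{dist}_{G'}(u,v)\le(1+\varepsilon)\,\mathrm{dist}_G(u,v)$ for all $(u,v)\in P$. "Weights polynomial in $n$" means that all weights are at most $n^{c}$ for some fixed constant $c$. The notation $\tilde O(\cdot)$ hides factors polylogarithmic in $n$; the hidden constants may depend on the fixed quantities $\varepsilon$ and $c$. -}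

module Defs where

open import Data.Empty using (⊥)
open import Data.Fin using (Fin; combine)
open import Data.Fin.Subset using (Subset; _∈_; _⊆_)
open import Data.Integer using (+_)
open import Data.Nat as ℕ using (ℕ)
open import Data.Product using (∃; _×_)
open import Data.Rational using (ℚ; 0ℚ; 1ℚ; _+_; _*_; _≤_; _<_; _/_)
open import Data.Sum using (_⊎_)
open import Data.Unit using (⊤)
open import Function using (_⇔_)
open import Relation.Nullary using (¬_)
open import Relation.Nullary.Construct.Add.Supremum using (_⁺; [_]; ⊤⁺)
open import Relation.Binary.PropositionalEquality using (_≡_)

fromℕ : ℕ → ℚ
fromℕ m = + m / 1

-- Dedekind reals: Lower q means q < x, and Upper q means x < q.
record ℝ : Set₁ where
  field
    Lower Upper     : ℚ → Set
    lower-inhabited : ∃ Lower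
    upper-inhabited : ∃ Upper
    lower-rounded   : ∀ q → Lower q ⇔ (∃ λ r → q < r × Lower r)
    upper-rounded   : ∀ q → Upper q ⇔ (∃ λ r → r < q × Upper r)
    disjoint        : ∀ q → ¬ (Lower q × Upper q)
    located         : ∀ q r → q < r → Lower q ⊎ Upper r

Positive : ℝ → Set
Positive x = ℝ.Lower x 0ℚ

-- A set of ordered pairs of vertices is a subset of Fin (n * n), where
-- combine : Fin n → Fin n → Fin (n * n) is the bijection (u , v) ↦ n u + v.
-- Its size is then the library's cardinality of finite subsets.
PairSet : ℕ → Set
PairSet n = Subset (n ℕ.* n)

-- Only the weights of pairs that are edges are meaningful.
record WeightedDigraph (n : ℕ) : Set where
  field
    edges  : PairSet n
    weight : Fin n → Fin n → ℕ

  Edge : Fin n → Fin n → Set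
  Edge u v = combine u v ∈ edges

open WeightedDigraph public

module _ {n : ℕ} where

  PositiveWeights : WeightedDigraph n → Set
  PositiveWeights G = ∀ u v → Edge G u v → 1 ℕ.≤ weight G u v

  WeightsAtMost : WeightedDigraph n → ℕ → Set
  WeightsAtMost G b = ∀ u v → Edge G u v → weight G u v ℕ.≤ b

  data Walk (G : WeightedDigraph n) : Fin n → Fin n → Set where
    []  : ∀ {u} → Walk G u u
    _∷_ : ∀ {u v w} → Edge G u v → Walk G v w → Walk G u w

  length : ∀ {G u v} → Walk G u v → ℕ
  length []                        = 0
  length {G} (_∷_ {u = u} {v} _ p) = weight G u v ℕ.+ length p

  -- IsDist G u v d: the distance from u to v in G is d, with ⊤⁺ for ∞.
  data IsDist (G : WeightedDigraph n) (u v : Fin n) : ℕ ⁺ → Set where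
    finite   : (p : Walk G u v) → (∀ (q : Walk G u v) → length p ℕ.≤ length q) →
               IsDist G u v [ length p ]
    infinite : ¬ Walk G u v → IsDist G u v ⊤⁺

  IsSubgraph : WeightedDigraph n → WeightedDigraph n → Set
  IsSubgraph H G =
    edges H ⊆ edges G × (∀ u v → Edge H u v → weight H u v ≡ weight G u v)

-- d′ ≤[1+ ε ]* d means d′ ≤ (1 + ε) d.  For finite d and d′ this is the order
-- of the reals: d′ is below (1 + q) d for every rational q > ε.
_≤[1+_]*_ : ℕ ⁺ → ℝ → ℕ ⁺ → Set
_      ≤[1+ ε ]* ⊤⁺    = ⊤
⊤⁺     ≤[1+ ε ]* [ d ] = ⊥
[ d′ ] ≤[1+ ε ]* [ d ] =
  ∀ q → ℝ.Upper ε q → fromℕ d′ ≤ (1ℚ + q) * fromℕ d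

IsApproxPreserver : ∀ {n} → ℝ → WeightedDigraph n → PairSet n →
                    WeightedDigraph n → Set
IsApproxPreserver ε G P H =
  IsSubgraph H G ×
  (∀ u v → combine u v ∈ P → ∀ d → IsDist G u v d →
    ∃ λ d′ → IsDist H u v d′ × d′ ≤[1+ ε ]* d)

-- The real inequality m ≤ M (n p^{1/3} + n^{2/3} p^{2/3}).  The right-hand side
-- is the infimum of M (n r + s² r²) over the rational upper bounds r of p^{1/3}
-- and s of n^{1/3}, since it is continuous and monotone in both roots.
EdgeBound : (m M n p : ℕ) → Set
EdgeBound m M n p =
  ∀ (r s : ℚ) → fromℕ p ≤ r * r * r → fromℕ n ≤ s * s * s →
  fromℕ m ≤ fromℕ M * (fromℕ n * r + (s * s) * (r * r))

{-# OPTIONS --safe #-}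
-- A path of G is rerouted through virtual pairs (x , y), which are charged at the
-- distance from x to y and are preserved recursively.  It suffices to find, for p
-- demand pairs, at most p/2 virtual pairs such that every demand pair has a
-- (1 + 1/N)-short route with few real edges: after O(log n) rounds no pairs are
-- left, and the errors multiply to at most 1 + ε when N is of order log n / ε.
--
-- Distances are treated by scales ƛ = 2^j, with paths of length about Nƛ and an
-- additive error O(ƛ log n).  A hitting set S with s vertices meets every h
-- consecutive vertices of every shortest path, so that only the points of S on a
-- path count.  Greedily chosen disjoint chains (shortest-path segments of length
-- at most ƛ with at least m points of S) cover all but O(Nm) points of each path,
-- and moving forward along a chain is free and exact.  Chains are cut into pieces
-- whose points are at distance O(ƛ) from each other, such that a path of length ƛ
-- can return to a chain further back only within two adjacent pieces.  In a piece
-- of size about g² a sample of about g points, with all pairs between them virtual,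
-- leaves O(g) points on each path.
-- Finally, for each g, some s/(mg) pieces and sg/m² chains are sampled such that
-- every path with more than 3m points of rank g meets a sampled piece, then a
-- sampled chain, then a sampled piece.  Since the points of a piece are close, the
-- path can be replaced by a detour along the chain with an error of O(ƛ), using
-- one virtual pair between each sampled piece and chain for each rounded distance.
-- The number s²/m³ of these pairs is below p/2 when h is about n/p and m is about
-- p^{1/3} (for p ≤ n), or n^{2/3}/p^{1/3} (for p > n), up to logarithms.
module Submission where

open import Defs renaming (length to walkLength)
open import Data.Empty using (⊥; ⊥-elim)
open import Data.Fin using (Fin; combine; remQuot)
import Data.Fin.Properties as Finₚ
open import Data.Fin.Subset as Subset using (Subset; inside; outside; ∣_∣)
import Data.Fin.Subset.Properties as Subsetₚ
open import Data.Integer as ℤ using (ℤ)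
import Data.Integer.Properties as ℤₚ
open import Data.List using (List; []; _∷_; _++_; length; map; filter; concat; concatMap; upTo; allFin; lookup; head; take; cartesianProduct; cartesianProductWith)
open import Data.List.Membership.Propositional using (_∈_; _∉_; find; lose)
open import Data.List.Membership.Propositional.Properties hiding (finite)
open import Data.List.Properties using (length-++; filter-++; ++-assoc; length-filter; filter-accept; filter-reject; filter-all; length-upTo; concat-++; length-map; length-tabulate; length-take)
open import Data.List.Relation.Binary.Sublist.Propositional using ([]; _∷_; _∷ʳ_; ⊆-refl; ⊆-trans) renaming (_⊆_ to _⊑_; lookup to ⊑-lookup)
open import Data.List.Relation.Binary.Sublist.Propositional.Properties using (All-resp-⊆; filter-⊆; filter⁺; length-mono-≤) renaming (++⁺ to ⊑-++⁺; ++⁺ˡ to ⊑-++ˡ; ++⁺ʳ to ⊑-++ʳ)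
open import Data.List.Relation.Unary.All as All using (All; []; _∷_)
open import Data.List.Relation.Unary.AllPairs as AllPairs using (AllPairs; []; _∷_)
open import Data.List.Relation.Unary.Any as Any using (Any; here; there; any?)
open import Data.List.Relation.Unary.Any.Properties using (lookup-index)
open import Data.List.Relation.Unary.Unique.Propositional using (Unique)
import Data.List.Relation.Unary.Unique.Propositional.Properties as Uniqueₚ
open import Data.Maybe using (just)
open import Data.Nat
open import Data.Nat.DivMod using (_/_; _%_; m≡m%n+[m/n]*n; m%n<n; m/n*n≤m; m<n*o⇒m/o<n)
open import Data.Nat.ListAction using (sum)
open import Data.Nat.Logarithm using (⌊log₂_⌋; ⌊log₂⌋-mono-≤; ⌊log₂[2^n]⌋≡n)
open import Data.Nat.Properties
open import Data.Nat.Tactic.RingSolver using (solve-∀)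
open import Data.Product using (∃; ∃₂; Σ; _×_; _,_; proj₁; proj₂)
open import Data.Rational as ℚ using (ℚ; 0ℚ; 1ℚ; NonNegative)
import Data.Rational.Properties as ℚₚ
open import Data.Rational.Solver using (module +-*-Solver)
import Data.Rational.Unnormalised as ℚᵘ
import Data.Rational.Unnormalised.Properties as ℚᵘₚ
open import Data.Sum as Sum using (_⊎_; inj₁; inj₂; [_,_]′)
open import Data.Unit using (tt)
open import Data.Vec.Base using ([]; _∷_; here; there)
open import Function using (_∘_; id; case_of_; Equivalence)
open import Relation.Binary using (DecidableEquality)
open import Relation.Binary.PropositionalEquality hiding (J)
open import Relation.Nullary using (¬_; Dec; yes; no; contradiction; ¬?)
open import Relation.Nullary.Construct.Add.Supremum using ([_]; ⊤⁺)
open import Relation.Nullary.Decidable using (_×-dec_)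
open import Relation.Unary using (Decidable)

-- The obstacle is that a sample of chains is small only if no path spends many of its points on one
-- chain: the size of a greedy hitting set grows with the largest share that a single element has in
-- a path. This is why free jumps along chains and thinning inside pieces precede the sampling. They
-- leave O(g) points in pieces of size about g² on each chain, for every stretch of length ƛ of a
-- path, while there are at most s/g² such pieces, so that g cancels in the product of the two
-- sample sizes. All samples are deterministic. What would be a union bound over the paths becomes a
-- logarithmic factor in the size of a greedy hitting set; this is the role of `L`. Every operation
-- only removes points from the paths, so a later one cannot destroy what an earlier one has
-- achieved, and each acts on all paths at once. Only the detours lengthen a path, by 20ƛ for each
-- of the `J` ranks. A distance of at least 20JNƛ absorbs this in a factor 1 + 1/N. Pairs too close
-- for the lowest scale get a shortest path of real edges, which is short because weights are at
-- least 1.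

-- Sums and counts over lists.

∑ : {A : Set} → (A → ℕ) → List A → ℕ
∑ f xs = sum (map f xs)

count : {A : Set} {P : A → Set} → Decidable P → List A → ℕ
count P? xs = length (filter P? xs)

module _ {A : Set} where

  ∑-zero : (xs : List A) → ∑ (λ _ → 0) xs ≡ 0
  ∑-zero []       = refl
  ∑-zero (x ∷ xs) = ∑-zero xs

  ∑-+ : (f g : A → ℕ) (xs : List A) → ∑ (λ x → f x + g x) xs ≡ ∑ f xs + ∑ g xs
  ∑-+ f g []       = refl
  ∑-+ f g (x ∷ xs) rewrite ∑-+ f g xs = interchange (f x) (g x) (∑ f xs) (∑ g xs)
    where
    interchange : ∀ a b c d → a + b + (c + d) ≡ a + c + (b + d)
    interchange = solve-∀

  ∑-mono : {f g : A → ℕ} (xs : List A) → (∀ {x} → x ∈ xs → f x ≤ g x) → ∑ f xs ≤ ∑ g xs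
  ∑-mono []       _   = z≤n
  ∑-mono (x ∷ xs) f≤g = +-mono-≤ (f≤g (here refl)) (∑-mono xs (f≤g ∘ there))

  ∑-* : (k : ℕ) (f : A → ℕ) (xs : List A) → ∑ (λ x → k * f x) xs ≡ k * ∑ f xs
  ∑-* k f []       = sym (*-zeroʳ k)
  ∑-* k f (x ∷ xs) rewrite ∑-* k f xs = sym (*-distribˡ-+ k (f x) _)

  ∑-≤-length : {f : A → ℕ} {k : ℕ} (xs : List A) → (∀ {x} → x ∈ xs → f x ≤ k) →
               ∑ f xs ≤ length xs * k
  ∑-≤-length []       _   = z≤n
  ∑-≤-length (x ∷ xs) f≤k = +-mono-≤ (f≤k (here refl)) (∑-≤-length xs (f≤k ∘ there))

  ∑-≥-length : {f : A → ℕ} {k : ℕ} (xs : List A) → (∀ {x} → x ∈ xs → k ≤ f x) →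
               length xs * k ≤ ∑ f xs
  ∑-≥-length []       _   = z≤n
  ∑-≥-length (x ∷ xs) f≥k = +-mono-≤ (f≥k (here refl)) (∑-≥-length xs (f≥k ∘ there))

  ∑-++ : (f : A → ℕ) (xs ys : List A) → ∑ f (xs ++ ys) ≡ ∑ f xs + ∑ f ys
  ∑-++ f []       ys = refl
  ∑-++ f (x ∷ xs) ys rewrite ∑-++ f xs ys = sym (+-assoc (f x) _ _)

  term≤∑ : (f : A → ℕ) {xs : List A} {x : A} → x ∈ xs → f x ≤ ∑ f xs
  term≤∑ f (here refl) = m≤m+n _ _
  term≤∑ f {y ∷ _} (there x∈xs) = ≤-trans (term≤∑ f x∈xs) (m≤n+m _ (f y))

  ∑-max : (f : A → ℕ) (x : A) (xs : List A) →
          ∃ λ y → y ∈ x ∷ xs × ∑ f (x ∷ xs) ≤ length (x ∷ xs) * f y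
  ∑-max f x [] = x , here refl , ≤-refl
  ∑-max f x (x′ ∷ xs) with ∑-max f x′ xs
  ... | y , y∈ , le with f x ≤? f y
  ...   | yes x≤y = y , there y∈ , +-mono-≤ x≤y le
  ...   | no  x≰y = x , here refl ,
    +-monoʳ-≤ (f x) (≤-trans le (*-monoʳ-≤ (length (x′ ∷ xs)) (<⇒≤ (≰⇒> x≰y))))

∑-swap : {A B : Set} (f : A → B → ℕ) (xs : List A) (ys : List B) →
         ∑ (λ x → ∑ (f x) ys) xs ≡ ∑ (λ y → ∑ (λ x → f x y) xs) ys
∑-swap f []       ys = sym (∑-zero ys)
∑-swap f (x ∷ xs) ys rewrite ∑-swap f xs ys = sym (∑-+ (f x) (λ y → ∑ (λ x → f x y) xs) ys)

module _ {A : Set} {P : A → Set} (P? : Decidable P) where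

  count-∷⁺ : ∀ {x} xs → P x → count P? (x ∷ xs) ≡ suc (count P? xs)
  count-∷⁺ xs px = cong length (filter-accept P? px)

  count-∷⁻ : ∀ {x} xs → ¬ P x → count P? (x ∷ xs) ≡ count P? xs
  count-∷⁻ xs ¬px = cong length (filter-reject P? ¬px)

  count-++ : ∀ xs ys → count P? (xs ++ ys) ≡ count P? xs + count P? ys
  count-++ xs ys rewrite filter-++ P? xs ys = length-++ (filter P? xs)

  count>0⇒∃ : ∀ xs → 0 < count P? xs → ∃ λ x → x ∈ xs × P x
  count>0⇒∃ (x ∷ xs) lt with P? x
  ... | yes px = x , here refl , px
  ... | no  _  with count>0⇒∃ xs lt
  ...   | y , y∈ , py = y , there y∈ , py

  count-none : ∀ xs → (∀ {x} → x ∈ xs → ¬ P x) → count P? xs ≡ 0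
  count-none []       _    = refl
  count-none (x ∷ xs) none =
    trans (count-∷⁻ xs (none (here refl))) (count-none xs (none ∘ there))

  count-complement : ∀ xs → count P? xs + count (¬? ∘ P?) xs ≡ length xs
  count-complement [] = refl
  count-complement (x ∷ xs) with P? x
  ... | yes _ = cong suc (count-complement xs)
  ... | no  _ = trans (+-suc _ _) (cong suc (count-complement xs))

  prefix : ∀ X xs → X ≤ count P? xs →
           ∃₂ λ as bs → xs ≡ as ++ bs × count P? as ≡ X
  prefix zero    xs       _  = [] , xs , refl , refl
  prefix (suc X) (x ∷ xs) le with P? x in eq
  ... | yes px with prefix X xs (s≤s⁻¹ le)
  ...   | as , bs , refl , refl = x ∷ as , bs , refl , count-∷⁺ as px
  prefix (suc X) (x ∷ xs) le | no ¬px with prefix (suc X) xs le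
  ...   | as , bs , refl , ceq = x ∷ as , bs , refl , trans (count-∷⁻ as ¬px) ceq

module _ {A : Set} {P Q : A → Set} (P? : Decidable P) (Q? : Decidable Q) where

  count-mono : ∀ xs → (∀ {x} → x ∈ xs → P x → Q x) → count P? xs ≤ count Q? xs
  count-mono []       _   = z≤n
  count-mono (x ∷ xs) P⇒Q with P? x | Q? x
  ... | yes _  | yes _  = s≤s (count-mono xs (P⇒Q ∘ there))
  ... | yes px | no ¬qx = contradiction (P⇒Q (here refl) px) ¬qx
  ... | no  _  | yes _  = m≤n⇒m≤1+n (count-mono xs (P⇒Q ∘ there))
  ... | no  _  | no  _  = count-mono xs (P⇒Q ∘ there)

count-cover : {A E : Set} {P : A → Set} {R : E → A → Set}
  (P? : Decidable P) (R? : ∀ e → Decidable (R e)) (U : List E) (xs : List A) →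
  (∀ {x} → x ∈ xs → P x → Any (λ e → R e x) U) →
  count P? xs ≤ ∑ (λ e → count (R? e) xs) U
count-cover P? R? U [] _ = z≤n
count-cover {A} {R = R} P? R? U (x ∷ xs) cover with P? x
... | yes px = ≤-trans (s≤s (count-cover P? R? U xs (cover ∘ there)))
                       (strict U (cover (here refl) px))
  where
  weak : ∀ U → ∑ (λ e → count (R? e) xs) U ≤ ∑ (λ e → count (R? e) (x ∷ xs)) U
  weak U = ∑-mono U (λ {e} _ → ≤-trans (m≤n+m _ (count (R? e) (x ∷ [])))
                                        (≤-reflexive (sym (count-++ (R? e) (x ∷ []) xs))))
  strict : ∀ U → Any (λ e → R e x) U →
           suc (∑ (λ e → count (R? e) xs) U) ≤ ∑ (λ e → count (R? e) (x ∷ xs)) U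
  strict (e ∷ U) (here r) rewrite count-∷⁺ (R? e) xs r = s≤s (+-monoʳ-≤ _ (weak U))
  strict (e ∷ U) (there r) = ≤-trans (≤-reflexive (sym (+-suc _ _)))
    (+-mono-≤ (≤-trans (m≤n+m _ (count (R? e) (x ∷ [])))
                (≤-reflexive (sym (count-++ (R? e) (x ∷ []) xs)))) (strict U r))
... | no _ = ≤-trans (count-cover P? R? U xs (cover ∘ there))
    (∑-mono U (λ {e} _ → ≤-trans (m≤n+m _ (count (R? e) (x ∷ [])))
                                        (≤-reflexive (sym (count-++ (R? e) (x ∷ []) xs)))))

-- The middle is what a jump from the front to the back removes. The bound for front and back
-- together is 3X, although the construction gives 2X, so that a path ends with at most 3X points
-- whether it jumps or not.
record Thirds {A : Set} {P : A → Set} (P? : Decidable P) (X : ℕ) (xs : List A) : Set where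
  field
    front middle back : List A
    parts             : xs ≡ front ++ middle ++ back
    few-or-many       : count P? xs ≤ 3 * X ⊎
      (X ≤ count P? front × X ≤ count P? middle × X ≤ count P? back ×
       count P? front + count P? back ≤ 3 * X)

opaque

  thirds : {A : Set} {P : A → Set} (P? : Decidable P) (X : ℕ) (xs : List A) → Thirds P? X xs
  thirds P? X xs with count P? xs ≤? 3 * X
  ... | yes few = record { front = [] ; middle = [] ; back = xs ; parts = refl ; few-or-many = inj₁ few }
  ... | no ¬few with prefix P? X xs (≤-trans (m≤m+n X _) (<⇒≤ (≰⇒> ¬few)))
  ...   | front , rest , refl , front≡X with m≤n⇒∃[o]m+o≡n rest≥
    where
    rest≥ : 2 * X ≤ count P? rest
    rest≥ = +-cancelˡ-≤ X _ _ (≤-trans (<⇒≤ (≰⇒> ¬few)) (≤-reflexive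
      (trans (count-++ P? front rest) (cong (_+ count P? rest) front≡X))))
  ...     | o , 2X+o≡rest with prefix P? (X + o) rest (≤-trans (m≤n+m (X + o) X)
            (≤-reflexive (trans (rearrange X o) 2X+o≡rest)))
    where
    rearrange : ∀ X o → X + (X + o) ≡ 2 * X + o
    rearrange = solve-∀
  ...       | middle , back , refl , middle≡ = record
    { front = front ; middle = middle ; back = back ; parts = refl
    ; few-or-many = inj₂ (≤-reflexive (sym front≡X) , ≤-trans (m≤m+n X o) (≤-reflexive (sym middle≡)) ,
        ≤-reflexive (sym back≡X) , ≤-trans (≤-reflexive (cong₂ _+_ front≡X back≡X)) (+-monoʳ-≤ X (m≤m+n X (X + 0)))) }
    where
    rearrange : ∀ X o → (X + o) + X ≡ 2 * X + o
    rearrange = solve-∀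
    back≡X : count P? back ≡ X
    back≡X = +-cancelˡ-≡ (X + o) _ _ (trans (trans (cong (_+ count P? back) (sym middle≡))
      (sym (count-++ P? middle back))) (trans (sym 2X+o≡rest) (sym (rearrange X o))))

-- Greedy hitting sets for weighted incidences.

module Hitting {E F : Set} (U : List E) (w : F → E → ℕ) (μ X : ℕ) (1≤X : 1 ≤ X)
               (w≤μ : ∀ f {e} → e ∈ U → w f e ≤ μ) where

  Hit : E → F → Set
  Hit e f = 0 < w f e

  hit? : ∀ e → Decidable (Hit e)
  hit? e f = 0 <? w f e

  Heavy : List F → Set
  Heavy fs = ∀ {f} → f ∈ fs → X ≤ ∑ (w f) U

  weight≤hits : ∀ {e} → e ∈ U → ∀ fs → ∑ (λ f → w f e) fs ≤ μ * count (hit? e) fs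
  weight≤hits e∈ [] = z≤n
  weight≤hits {e} e∈ (f ∷ fs) with 0 <? w f e
  ... | yes p = ≤-trans (+-mono-≤ (w≤μ f e∈) (weight≤hits e∈ fs)) (≤-reflexive
    (trans (sym (*-suc μ _)) (cong (μ *_) (sym (count-∷⁺ (hit? e) fs p)))))
  ... | no ¬p = ≤-trans (+-mono-≤ (≮⇒≥ ¬p) (weight≤hits e∈ fs))
    (≤-reflexive (cong (μ *_) (sym (count-∷⁻ (hit? e) fs ¬p))))

  -- Averaging: some element of `U` carries at least a 1/|U| share of the total weight |fs|X, and
  -- since it weighs at most μ on each member, it must hit many of them.
  popular : ∀ f fs → Heavy (f ∷ fs) →
            ∃ λ e → e ∈ U × length (f ∷ fs) * X ≤ length U * (μ * count (hit? e) (f ∷ fs))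
  popular f fs heavy = go U refl
    where
    go : ∀ V → U ≡ V → ∃ λ e → e ∈ U × length (f ∷ fs) * X ≤ length U * (μ * count (hit? e) (f ∷ fs))
    go [] refl = contradiction (≤-trans 1≤X (heavy (here refl))) λ ()
    go (e₀ ∷ V) refl with ∑-max (λ e → ∑ (λ f → w f e) (f ∷ fs)) e₀ V
    ... | e , e∈ , le = e , e∈ , (begin
      length (f ∷ fs) * X                      ≤⟨ ∑-≥-length (f ∷ fs) heavy ⟩
      ∑ (λ f → ∑ (w f) U) (f ∷ fs)             ≡⟨ ∑-swap w (f ∷ fs) U ⟩
      ∑ (λ e → ∑ (λ f → w f e) (f ∷ fs)) U     ≤⟨ le ⟩
      length U * ∑ (λ f → w f e) (f ∷ fs)      ≤⟨ *-monoʳ-≤ (length U) (weight≤hits e∈ (f ∷ fs)) ⟩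
      length U * (μ * count (hit? e) (f ∷ fs)) ∎)
      where open ≤-Reasoning

  HitBy : List E → F → Set
  HitBy A f = ∃ λ e → e ∈ A × Hit e f

  -- While more than N/2 members remain, a popular element hits at least XN/(2|U|μ) of them. Hence
  -- 2|U|μ times the number of unhit members is a potential that drops by XN or more with each
  -- choice, which is the last inequality. `k` is fuel.
  greedy : ∀ k N fs → length fs ≤ k → Heavy fs →
           ∃₂ λ A rest →
             (∀ {e} → e ∈ A → e ∈ U) × (∀ {f} → f ∈ rest → f ∈ fs) ×
             2 * length rest ≤ N × (∀ {f} → f ∈ fs → f ∈ rest ⊎ HitBy A f) ×
             X * N * length A + 2 * length U * μ * length rest ≤ 2 * length U * μ * length fs
  greedy k N fs le heavy with 2 * length fs ≤? N
  ... | yes small = [] , fs , (λ ()) , id , small , inj₁ ,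
    ≤-reflexive (cong (_+ 2 * length U * μ * length fs) (*-zeroʳ (X * N)))
  greedy k N [] le heavy | no big = contradiction z≤n big
  greedy zero N (f ∷ fs) () heavy | no big
  greedy (suc k) N (f₀ ∷ fs₀) le heavy | no big with popular f₀ fs₀ heavy
  ... | e , e∈U , pop with greedy k N rest₁ shorter (heavy ∘ proj₁ ∘ ∈-filter⁻ (¬? ∘ hit? e))
    where
    fs = f₀ ∷ fs₀
    rest₁ = filter (¬? ∘ hit? e) fs
    c = count (hit? e) fs
    c>0 : 0 < c
    c>0 with c ≟ 0
    ... | no c≢0 = n≢0⇒n>0 c≢0
    ... | yes eq = contradiction (≤-trans (*-mono-≤ {1} {length fs} (s≤s z≤n) 1≤X)
      (≤-trans pop (≤-reflexive (trans (cong (λ z → length U * (μ * z)) eq)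
        (trans (cong (length U *_) (*-zeroʳ μ)) (*-zeroʳ (length U))))))) λ ()
    shorter : length rest₁ ≤ k
    shorter = s≤s⁻¹ (≤-trans (+-monoˡ-≤ (length rest₁) c>0)
                (≤-trans (≤-reflexive (count-complement (hit? e) fs)) le))
  ... | A , rest , A⊆U , rest⊆ , half , covers , bound =
    e ∷ A , rest , (λ { (here refl) → e∈U ; (there p) → A⊆U p }) ,
    proj₁ ∘ ∈-filter⁻ (¬? ∘ hit? e) ∘ rest⊆ , half , covers′ , bound′
    where
    fs = f₀ ∷ fs₀
    rest₁ = filter (¬? ∘ hit? e) fs
    c = count (hit? e) fs
    covers′ : ∀ {f} → f ∈ fs → f ∈ rest ⊎ HitBy (e ∷ A) f
    covers′ {f} f∈ with hit? e f
    ... | yes h = inj₂ (e , here refl , h)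
    ... | no ¬h with covers (∈-filter⁺ (¬? ∘ hit? e) f∈ ¬h)
    ...   | inj₁ r = inj₁ r
    ...   | inj₂ (e′ , e′∈ , h) = inj₂ (e′ , there e′∈ , h)
    u = length U
    bound′ : X * N * suc (length A) + 2 * u * μ * length rest ≤ 2 * u * μ * length fs
    bound′ = begin
      X * N * suc (length A) + 2 * u * μ * length rest
        ≡⟨ rearrange₁ X N (length A) _ ⟩
      X * N + (X * N * length A + 2 * u * μ * length rest)
        ≤⟨ +-mono-≤ (*-monoʳ-≤ X (<⇒≤ (≰⇒> big))) bound ⟩
      X * (2 * length fs) + 2 * u * μ * length rest₁
        ≡⟨ cong (_+ 2 * u * μ * length rest₁) (rearrange₂ X (length fs)) ⟩
      2 * (length fs * X) + 2 * u * μ * length rest₁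
        ≤⟨ +-monoˡ-≤ _ (*-monoʳ-≤ 2 pop) ⟩
      2 * (u * (μ * c)) + 2 * u * μ * length rest₁
        ≡⟨ rearrange₃ u μ c (length rest₁) ⟩
      2 * u * μ * (c + length rest₁)
        ≡⟨ cong (2 * u * μ *_) (count-complement (hit? e) fs) ⟩
      2 * u * μ * length fs ∎
      where
      open ≤-Reasoning
      rearrange₁ : ∀ X N a r → X * N * suc a + r ≡ X * N + (X * N * a + r)
      rearrange₁ = solve-∀
      rearrange₂ : ∀ X f → X * (2 * f) ≡ 2 * (f * X)
      rearrange₂ = solve-∀
      rearrange₃ : ∀ u μ c r → 2 * (u * (μ * c)) + 2 * u * μ * r ≡ 2 * u * μ * (c + r)
      rearrange₃ = solve-∀

  -- Running `greedy` with N = |fs| halves the family for at most 2|U|μ/X elements, and L halvings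
  -- exhaust fewer than 2^L members.
  hitting-set : ∀ L fs → length fs < 2 ^ L → Heavy fs →
                ∃ λ A → (∀ {e} → e ∈ A → e ∈ U) × X * length A ≤ 2 * length U * μ * L ×
                        (∀ {f} → f ∈ fs → HitBy A f)
  hitting-set L [] _ _ = [] , (λ ()) , ≤-trans (≤-reflexive (*-zeroʳ X)) z≤n , λ ()
  hitting-set zero (f ∷ fs) (s≤s ()) heavy
  hitting-set (suc L) fs@(f₀ ∷ fs₀) lt heavy with greedy (length fs) (length fs) fs ≤-refl heavy
  ... | A₁ , rest , A₁⊆U , rest⊆ , half , covers , bound
    with hitting-set L rest (*-cancelˡ-< 2 _ _ (≤-<-trans half lt)) (heavy ∘ rest⊆)
  ...   | A₂ , A₂⊆U , bound₂ , hits₂ =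
    A₁ ++ A₂ , (λ e∈ → [ A₁⊆U , A₂⊆U ]′ (∈-++⁻ A₁ e∈)) , bound′ , hits
    where
    N = length fs
    u = length U
    bound₁ : X * length A₁ ≤ 2 * u * μ
    bound₁ = *-cancelˡ-≤ N (begin
      N * (X * length A₁)     ≡⟨ rearrange N X (length A₁) ⟩
      X * N * length A₁       ≤⟨ m≤m+n _ _ ⟩
      X * N * length A₁ + 2 * u * μ * length rest ≤⟨ bound ⟩
      2 * u * μ * N           ≡⟨ *-comm _ N ⟩
      N * (2 * u * μ)         ∎)
      where
      open ≤-Reasoning
      rearrange : ∀ N X a → N * (X * a) ≡ X * N * a
      rearrange = solve-∀
    bound′ : X * length (A₁ ++ A₂) ≤ 2 * u * μ * suc L
    bound′ = begin
      X * length (A₁ ++ A₂)             ≡⟨ cong (X *_) (length-++ A₁) ⟩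
      X * (length A₁ + length A₂)       ≡⟨ *-distribˡ-+ X (length A₁) _ ⟩
      X * length A₁ + X * length A₂     ≤⟨ +-mono-≤ bound₁ bound₂ ⟩
      2 * u * μ + 2 * u * μ * L         ≡⟨ *-suc (2 * u * μ) L ⟨
      2 * u * μ * suc L                 ∎
      where open ≤-Reasoning
    hits : ∀ {f} → f ∈ fs → HitBy (A₁ ++ A₂) f
    hits f∈ with covers f∈
    ... | inj₂ (e , e∈ , h) = e , ∈-++⁺ˡ e∈ , h
    ... | inj₁ f∈rest with hits₂ f∈rest
    ...   | e , e∈ , h = e , ∈-++⁺ʳ A₁ e∈ , h

  hitting-heavy : ∀ L fs → length fs < 2 ^ L →
                  ∃ λ A → (∀ {e} → e ∈ A → e ∈ U) × X * length A ≤ 2 * length U * μ * L ×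
                          (∀ {f} → f ∈ fs → X ≤ ∑ (w f) U → HitBy A f)
  hitting-heavy L fs lt with hitting-set L (filter heavy? fs)
      (≤-<-trans (length-filter heavy? fs) lt) (proj₂ ∘ ∈-filter⁻ heavy? {xs = fs})
    where
    heavy? : Decidable (λ f → X ≤ ∑ (w f) U)
    heavy? f = X ≤? ∑ (w f) U
  ... | A , A⊆U , bound , hits = A , A⊆U , bound , λ f∈ heavy → hits (∈-filter⁺ _ f∈ heavy)

-- Sublists, distinct entries and the pooling of lists.

module _ {A : Set} where

  AllPairs-resp-⊑ : {R : A → A → Set} {xs ys : List A} → xs ⊑ ys → AllPairs R ys → AllPairs R xs
  AllPairs-resp-⊑ []         []       = []
  AllPairs-resp-⊑ (_ ∷ʳ s)   (_ ∷ ps) = AllPairs-resp-⊑ s ps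
  AllPairs-resp-⊑ (refl ∷ s) (p ∷ ps) = All-resp-⊆ s p ∷ AllPairs-resp-⊑ s ps

  AllPairs-across : {R : A → A → Set} (xs : List A) {ys : List A} {x y : A} →
                    AllPairs R (xs ++ ys) → x ∈ xs → y ∈ ys → R x y
  AllPairs-across (_ ∷ xs) (p ∷ ps) (here refl) y∈ = All.lookup p (∈-++⁺ʳ xs y∈)
  AllPairs-across (_ ∷ xs) (p ∷ ps) (there x∈)  y∈ = AllPairs-across xs ps x∈ y∈

  count-⊑ : {P : A → Set} (P? : Decidable P) {xs ys : List A} → xs ⊑ ys → count P? xs ≤ count P? ys
  count-⊑ P? s = length-mono-≤ (filter⁺ P? P? (λ { refl px → px }) s)

  Unique-length : {xs ys : List A} → Unique xs → (∀ {x} → x ∈ xs → x ∈ ys) → length xs ≤ length ys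
  Unique-length {[]}     _        _     = z≤n
  Unique-length {x ∷ xs} (x∉ ∷ u) xs⊆ys with ∈-∃++ (xs⊆ys (here refl))
  ... | as , bs , refl = ≤-trans (s≤s (Unique-length u xs⊆)) (≤-reflexive (sym (trans
      (length-++ as) (trans (+-suc _ _) (cong suc (sym (length-++ as)))))))
    where
    xs⊆ : ∀ {y} → y ∈ xs → y ∈ as ++ bs
    xs⊆ y∈ with ∈-++⁻ as (xs⊆ys (there y∈))
    ... | inj₁ p           = ∈-++⁺ˡ p
    ... | inj₂ (here refl) = contradiction refl (All.lookup x∉ y∈)
    ... | inj₂ (there p)   = ∈-++⁺ʳ as p

  length-concat : (xss : List (List A)) → length (concat xss) ≡ ∑ length xss
  length-concat []         = refl
  length-concat (xs ∷ xss) = trans (length-++ xs) (cong (length xs +_) (length-concat xss))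

gather : {E T : Set} (Ψ : E → List T → Set) →
         (∀ e {new new′} → (∀ {t} → t ∈ new → t ∈ new′) → Ψ e new → Ψ e new′) →
         (cost : E → ℕ) (es : List E) →
         (∀ {e} → e ∈ es → ∃ λ new → length new ≤ cost e × Ψ e new) →
         ∃ λ new → length new ≤ ∑ cost es × (∀ {e} → e ∈ es → Ψ e new)
gather Ψ mono cost []       _    = [] , z≤n , λ ()
gather Ψ mono cost (e ∷ es) make with make (here refl) | gather Ψ mono cost es (make ∘ there)
... | new , le , ψ | new′ , le′ , ψ′ =
  new ++ new′ , ≤-trans (≤-reflexive (length-++ new)) (+-mono-≤ le le′) ,
  λ { (here refl) → mono _ ∈-++⁺ˡ ψ ; (there e∈) → mono _ (∈-++⁺ʳ new) (ψ′ e∈) }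

-- Greedy disjoint chains.

module Cover {V : Set} (_≟V_ : DecidableEquality V) (S : List V) (cands : List (List V))
             (cand-unique : ∀ {c} → c ∈ cands → Unique c)
             (cand⊆S : ∀ {c} → c ∈ cands → ∀ {x} → x ∈ c → x ∈ S)
             (t : ℕ) (1≤t : 1 ≤ t) where

  open import Data.List.Membership.DecPropositional _≟V_ using (_∈?_)

  covered? : ∀ qs → Decidable (λ x → x ∈ concat qs)
  covered? qs x = x ∈? concat qs

  -- A chain is a sublist of a candidate, not an interval of it: points taken by earlier chains are
  -- left out, which makes chains disjoint. Closeness and exactness of distances pass to sublists,
  -- so nothing is lost.
  record Chains : Set where
    field
      chains       : List (List V)
      disjoint     : Unique (concat chains)
      within       : ∀ {x} → x ∈ concat chains → x ∈ S
      from-cand    : ∀ {q} → q ∈ chains → ∃ λ c → c ∈ cands × q ⊑ c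
      long         : ∀ {q} → q ∈ chains → t ≤ length q

  open Chains public

  Saturated : Chains → Set
  Saturated C = ∀ {c} → c ∈ cands → count (¬? ∘ covered? (chains C)) c < t

  extend : (C : Chains) {c : List V} → c ∈ cands → t ≤ count (¬? ∘ covered? (chains C)) c →
           ∃ λ C′ → suc (length (concat (chains C))) ≤ length (concat (chains C′))
  extend C {c} c∈ big = record
    { chains = q ∷ chains C
    ; disjoint = Uniqueₚ.++⁺ (Uniqueₚ.filter⁺ (¬? ∘ covered? (chains C)) (cand-unique c∈)) (disjoint C)
                   (λ { (x∈q , x∈qs) → proj₂ (∈-filter⁻ (¬? ∘ covered? (chains C)) {xs = c} x∈q) x∈qs })
    ; within = λ x∈ → [ cand⊆S c∈ ∘ proj₁ ∘ ∈-filter⁻ (¬? ∘ covered? (chains C)) {xs = c} , within C ]′ (∈-++⁻ q x∈)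
    ; from-cand = λ { (here refl) → c , c∈ , filter-⊆ (¬? ∘ covered? (chains C)) c ; (there q∈) → from-cand C q∈ }
    ; long = λ { (here refl) → big ; (there q∈) → long C q∈ }
    } , ≤-trans (+-monoˡ-≤ _ (≤-trans 1≤t big)) (≤-reflexive (sym (length-++ q)))
    where q = filter (¬? ∘ covered? (chains C)) c

  -- The fuel `k` bounds the number of points of `S` not yet covered, and every extension covers a
  -- new one. Without fuel all of `S` is covered, and disjointness leaves no room for another chain.
  saturate : ∀ k (C : Chains) → length S ≤ length (concat (chains C)) + k → Σ Chains Saturated
  saturate k C le with any? (λ c → t ≤? count (¬? ∘ covered? (chains C)) c) cands
  ... | no none = C , λ c∈ → ≰⇒> (λ big → none (Any.map (λ { refl → big }) c∈))
  ... | yes some with find some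
  ...   | c , c∈ , big with extend C c∈ big | k
  ...     | C′ , grow | suc k′ = saturate k′ C′ (≤-trans le
    (≤-trans (≤-reflexive (+-suc _ k′)) (+-monoˡ-≤ k′ grow)))
  ...     | C′ , grow | zero = contradiction
    (≤-trans grow (≤-trans (Unique-length (disjoint C′) (within C′)) (≤-trans le (≤-reflexive (+-identityʳ _)))))
    (<-irrefl refl)

  cover : Σ Chains Saturated
  cover = saturate (length S) (record { chains = [] ; disjoint = [] ; within = λ () ; from-cand = λ () ; long = λ () }) ≤-refl

  chain-count : (C : Chains) → length (chains C) * t ≤ length S
  chain-count C = ≤-trans (∑-≥-length (chains C) (long C))
    (≤-trans (≤-reflexive (sym (length-concat (chains C)))) (Unique-length (disjoint C) (within C)))

-- Cutting chains into pieces of small diameter.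

module Cutting {V : Set} (d : V → V → ℕ) (d-refl : ∀ x → d x x ≡ 0)
               (triangle : ∀ x y z → d x z ≤ d x y + d y z) (ƛ : ℕ) where

  -- Each piece consists of a point x and the points up to the last one from
  -- which x is within distance 2ƛ.
  data Cut : List V → Set where
    []    : Cut []
    piece : ∀ x {pre post} → All (λ y → d y x ≤ 3 * ƛ) pre → All (λ y → 2 * ƛ < d y x) post →
            Cut post → Cut (x ∷ pre ++ post)

  Forward : V → V → Set
  Forward x y = d x y ≤ ƛ

  -- Every point before the last point `l` with d l x ≤ 2ƛ reaches `l` within ƛ, because the list is
  -- forward. This is the origin of 3ƛ, and the gap between 2ƛ and 3ƛ costs only a constant.
  split-last : ∀ x zs → AllPairs Forward zs →
               All (λ y → 2 * ƛ < d y x) zs ⊎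
               ∃₂ λ pre post → zs ≡ pre ++ post × All (λ y → d y x ≤ 3 * ƛ) pre ×
                 All (λ y → 2 * ƛ < d y x) post × ∃ λ l → l ∈ zs × d l x ≤ 2 * ƛ
  split-last x [] [] = inj₁ []
  split-last x (z ∷ zs) (fz ∷ fzs) with split-last x zs fzs
  ... | inj₂ (pre , post , refl , near , far , l , l∈ , le) =
    inj₂ (z ∷ pre , post , refl ,
      ≤-trans (triangle z l x) (+-mono-≤ (All.lookup fz l∈) le) ∷ near , far , l , there l∈ , le)
  ... | inj₁ far with d z x ≤? 2 * ƛ
  ...   | yes le = inj₂ (z ∷ [] , zs , refl , ≤-trans le (m≤n+m _ ƛ) ∷ [] , far , z , here refl , le)
  ...   | no ¬le = inj₁ (≰⇒> ¬le ∷ far)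

  cut : ∀ k xs → length xs ≤ k → AllPairs Forward xs → Cut xs
  cut k [] _ _ = []
  cut zero (x ∷ xs) () _
  cut (suc k) (x ∷ xs) (s≤s le) (_ ∷ fs) with split-last x xs fs
  ... | inj₁ far = piece x [] far (cut k xs le fs)
  ... | inj₂ (pre , post , refl , near , far , _) =
    piece x near far (cut k post (≤-trans (m≤n+m _ (length pre))
      (≤-trans (≤-reflexive (sym (length-++ pre))) le)) (AllPairs-resp-⊑ (⊑-++ˡ pre ⊆-refl) fs))

  pieces : ∀ {xs} → Cut xs → List (List V)
  pieces []                  = []
  pieces (piece x {pre} _ _ c) = (x ∷ pre) ∷ pieces c

  concat-pieces : ∀ {xs} (c : Cut xs) → concat (pieces c) ≡ xs
  concat-pieces []                  = refl
  concat-pieces (piece x {pre} _ _ c) = cong (λ ys → x ∷ pre ++ ys) (concat-pieces c)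

  pieces-nonempty : ∀ {xs} (c : Cut xs) {C} → C ∈ pieces c → 1 ≤ length C
  pieces-nonempty (piece _ _ _ c) (here refl) = s≤s z≤n
  pieces-nonempty (piece _ _ _ c) (there C∈)  = pieces-nonempty c C∈

  -- Two points of a piece are joined through its first point: at most 3ƛ back to it and at most ƛ
  -- forward from it.
  diameter : ∀ {xs} (c : Cut xs) → AllPairs Forward xs →
             ∀ {C} → C ∈ pieces c → ∀ {x y} → x ∈ C → y ∈ C → d x y ≤ 4 * ƛ
  diameter (piece x {pre} near _ c) (fx ∷ _) (here refl) {y} {z} y∈ z∈ =
    ≤-trans (triangle y x z) (≤-trans (+-mono-≤ (back y∈) (forth z∈)) (≤-reflexive (+-comm (3 * ƛ) ƛ)))
    where
    back : ∀ {y} → y ∈ x ∷ pre → d y x ≤ 3 * ƛ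
    back (here refl) rewrite d-refl x = z≤n
    back (there y∈) = All.lookup near y∈
    forth : ∀ {z} → z ∈ x ∷ pre → d x z ≤ ƛ
    forth (here refl) rewrite d-refl x = z≤n
    forth (there z∈) = All.lookup fx (∈-++⁺ˡ z∈)
  diameter (piece x {pre} _ _ c) fs (there C∈) =
    diameter c (AllPairs-resp-⊑ (⊑-++ˡ (x ∷ pre) ⊆-refl) fs) C∈

  Located : {xs : List V} (Ahead : V → V → Set) → Cut xs → V → Set
  Located {xs} Ahead c a = ∃₂ λ C₁ C₂ → C₁ ∈ pieces c × C₂ ∈ pieces c ×
    (∀ {y} → y ∈ xs → Ahead a y ⊎ ƛ < d a y ⊎ y ∈ C₁ ⊎ y ∈ C₂)

  -- If a whole piece, with first point x′, lies between y and a, then a is farther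
  -- than 2ƛ from x′, while y is within ƛ of x′.
  two-pieces : ∀ {xs} {Ahead : V → V → Set} (c : Cut xs) → AllPairs Forward xs → AllPairs Ahead xs →
               ∀ {a} → a ∈ xs → Located Ahead c a
  two-pieces {Ahead = Ahead} (piece x {pre} {post} near far c) fs as {a} a∈ with ∈-++⁻ (x ∷ pre) a∈
  ... | inj₁ a∈C = x ∷ pre , x ∷ pre , here refl , here refl , locate
    where
    locate : ∀ {y} → y ∈ x ∷ pre ++ post → _
    locate y∈ with ∈-++⁻ (x ∷ pre) y∈
    ... | inj₁ p = inj₂ (inj₂ (inj₁ p))
    ... | inj₂ p = inj₁ (AllPairs-across (x ∷ pre) as a∈C p)
  ... | inj₂ a∈post = behind c far fs as a∈post (two-pieces c (drop-piece fs) (drop-piece as) a∈post)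
    where
    drop-piece : ∀ {R : V → V → Set} {post} → AllPairs R (x ∷ pre ++ post) → AllPairs R post
    drop-piece = AllPairs-resp-⊑ (⊑-++ˡ (x ∷ pre) ⊆-refl)
    behind : ∀ {post} (c : Cut post) (far : All (λ y → 2 * ƛ < d y x) post) →
             AllPairs Forward (x ∷ pre ++ post) → AllPairs Ahead (x ∷ pre ++ post) →
             a ∈ post → Located Ahead c a → Located Ahead (piece x near far c) a
    behind (piece x′ {pre′} {post′} _ far′ c′) far fs as a∈post (C₁ , C₂ , C₁∈ , C₂∈ , locate′)
      with ∈-++⁻ (x′ ∷ pre′) a∈post
    ... | inj₁ a∈C′ = x′ ∷ pre′ , x ∷ pre , there (here refl) , here refl , locate
      where
      locate : ∀ {y} → y ∈ x ∷ pre ++ (x′ ∷ pre′ ++ post′) → _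
      locate y∈ with ∈-++⁻ (x ∷ pre) y∈
      ... | inj₁ p = inj₂ (inj₂ (inj₂ p))
      ... | inj₂ p with ∈-++⁻ (x′ ∷ pre′) p
      ...   | inj₁ q = inj₂ (inj₂ (inj₁ q))
      ...   | inj₂ q = inj₁ (AllPairs-across (x′ ∷ pre′) (drop-piece as) a∈C′ q)
    ... | inj₂ a∈post′ = C₁ , C₂ , there C₁∈ , there C₂∈ , locate
      where
      locate : ∀ {y} → y ∈ x ∷ pre ++ (x′ ∷ pre′ ++ post′) → _
      locate {y} y∈ with ∈-++⁻ (x ∷ pre) y∈
      ... | inj₂ p = locate′ p
      ... | inj₁ p = inj₂ (inj₁ (+-cancelʳ-< (d y x′) _ _ (begin-strict
        ƛ + d y x′     ≤⟨ +-monoʳ-≤ ƛ (AllPairs-across (x ∷ pre) fs p (here refl)) ⟩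
        ƛ + ƛ          ≡⟨ cong (ƛ +_) (+-identityʳ ƛ) ⟨
        2 * ƛ          <⟨ All.lookup far′ a∈post′ ⟩
        d a x′         ≤⟨ triangle a y x′ ⟩
        d a y + d y x′ ∎)))
        where open ≤-Reasoning

-- Trails with free virtual pairs, and tasks on families of trails.

module Trails {V : Set} (d : V → V → ℕ) (d-refl : ∀ x → d x x ≡ 0)
              (triangle : ∀ x y z → d x z ≤ d x y + d y z)
              (Step : V → V → ℕ → Set) (d≤step : ∀ {x y k} → Step x y k → d x y ≤ k) where

  -- The list index collects the starting points of the steps; the virtual
  -- pairs are free, so its length is the cost of the trail.
  data Trail (vt : List (V × V)) : V → List V → V → ℕ → Set where
    []   : ∀ {x} → Trail vt x [] x 0
    step : ∀ {x y z zs k ℓ} → Step x y k → Trail vt y zs z ℓ → Trail vt x (x ∷ zs) z (k + ℓ)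
    virt : ∀ {x y z zs ℓ} → (x , y) ∈ vt → Trail vt y zs z ℓ → Trail vt x zs z (d x y + ℓ)

  Free : List (V × V) → V → V → ℕ → Set
  Free vt x y ℓ = Trail vt x [] y ℓ

  pair : ∀ {vt x y} → (x , y) ∈ vt → Free vt x y (d x y)
  pair xy∈ = subst (Free _ _ _) (+-identityʳ _) (virt xy∈ [])

  infixr 5 _▷_
  _▷_ : ∀ {vt x y z as bs k ℓ} → Trail vt x as y k → Trail vt y bs z ℓ → Trail vt x (as ++ bs) z (k + ℓ)
  []                    ▷ q = q
  step {k = k} s p      ▷ q = subst (Trail _ _ _ _) (sym (+-assoc k _ _)) (step s (p ▷ q))
  virt {x} {y} xy∈ p    ▷ q = subst (Trail _ _ _ _) (sym (+-assoc (d x y) _ _)) (virt xy∈ (p ▷ q))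

  weaken : ∀ {vt vt′ x zs y ℓ} → (∀ {t} → t ∈ vt → t ∈ vt′) → Trail vt x zs y ℓ → Trail vt′ x zs y ℓ
  weaken i []         = []
  weaken i (step s p) = step s (weaken i p)
  weaken i (virt v p) = virt (i v) (weaken i p)

  d≤trail : ∀ {vt x zs y ℓ} → Trail vt x zs y ℓ → d x y ≤ ℓ
  d≤trail {x = x} []               = ≤-reflexive (d-refl x)
  d≤trail (step {x} {y} {z} s p)   = ≤-trans (triangle x y z) (+-mono-≤ (d≤step s) (d≤trail p))
  d≤trail (virt {x} {y} {z} _ p)   = ≤-trans (triangle x y z) (+-monoʳ-≤ (d x y) (d≤trail p))

  split : ∀ {vt x y ℓ} as {a bs} → Trail vt x (as ++ a ∷ bs) y ℓ →
          ∃₂ λ ℓ₁ ℓ₂ → ℓ₁ + ℓ₂ ≡ ℓ × Trail vt x as a ℓ₁ × Trail vt a (a ∷ bs) y ℓ₂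
  split []       (step s p) = 0 , _ , refl , [] , step s p
  split (_ ∷ as) (step {k = k} s p) with split as p
  ... | ℓ₁ , ℓ₂ , refl , p₁ , p₂ = k + ℓ₁ , ℓ₂ , +-assoc k ℓ₁ ℓ₂ , step s p₁ , p₂
  split as       (virt {x} {y} v p) with split as p
  ... | ℓ₁ , ℓ₂ , refl , p₁ , p₂ = d x y + ℓ₁ , ℓ₂ , +-assoc (d x y) ℓ₁ ℓ₂ , virt v p₁ , p₂

  -- The inserted part is free, so `a` and `bs` leave the index, while `b` stays as the start of the
  -- next real step. The shortcut may depend on the length `k` of the part that it replaces, and
  -- hence on what that part visits.
  jump : ∀ {vt vt′ x y ℓ e} as {a} bs {b cs} → (∀ {t} → t ∈ vt → t ∈ vt′) →
         Trail vt x (as ++ (a ∷ bs) ++ b ∷ cs) y ℓ →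
         (∀ {k} → k ≤ ℓ → Trail vt a (a ∷ bs) b k → ∃ λ k′ → Free vt′ a b k′ × k′ ≤ k + e) →
         ∃ λ ℓ′ → Trail vt′ x (as ++ b ∷ cs) y ℓ′ × ℓ′ ≤ ℓ + e
  jump {e = e} as {a} bs i p shortcut with split as p
  ... | ℓ₁ , _ , refl , p₁ , q with split (a ∷ bs) q
  ...   | k , ℓ₃ , refl , p₂ , p₃ with shortcut (≤-trans (m≤m+n k ℓ₃) (m≤n+m _ ℓ₁)) p₂
  ...     | k′ , f , le = _ , weaken i p₁ ▷ (f ▷ weaken i p₃) , (begin
    ℓ₁ + (k′ + ℓ₃)      ≤⟨ +-monoʳ-≤ ℓ₁ (+-monoˡ-≤ ℓ₃ le) ⟩
    ℓ₁ + (k + e + ℓ₃)   ≡⟨ rearrange ℓ₁ k e ℓ₃ ⟩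
    ℓ₁ + (k + ℓ₃) + e   ∎)
    where
    open ≤-Reasoning
    rearrange : ∀ a b c d → a + (b + c + d) ≡ a + (b + d) + c
    rearrange = solve-∀

  module Family {F : Set} (fs : List F) (complete : ∀ f → f ∈ fs)
                (src tgt : F → V) (base : F → ℕ) where

    Points : Set
    Points = F → List V

    infix 4 _⊑*_
    _⊑*_ : Points → Points → Set
    zs′ ⊑* zs = ∀ f → zs′ f ⊑ zs f

    Live : List (V × V) → ℕ → Points → Set
    Live vt E zs = ∀ f → ∃ λ ℓ → Trail vt (src f) (zs f) (tgt f) ℓ × ℓ ≤ base f + E

    -- Points only shrink, so a property `Φ` that passes to smaller point lists persists once a task
    -- has achieved it. The factor `κ` keeps bounds with denominators in ℕ. `M` caps the accumulated
    -- error, since a task may rely on trails of bounded length.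
    module Perform {T : Set} (Φ : T → Points → Set)
                   (Φ-mono : ∀ τ {zs zs′} → zs′ ⊑* zs → Φ τ zs → Φ τ zs′)
                   (κ : ℕ) (cost : T → ℕ) (e M : ℕ) (vt₀ : List (V × V)) (zs₀ : Points) where

      Task : T → Set
      Task τ = ∀ vt E zs → (∀ {t} → t ∈ vt₀ → t ∈ vt) → E + e ≤ M → zs ⊑* zs₀ → Live vt E zs →
        ∃₂ λ new zs′ → zs′ ⊑* zs × κ * length new ≤ cost τ × Live (new ++ vt) (E + e) zs′ × Φ τ zs′

      perform : ∀ τs → (∀ {τ} → τ ∈ τs → Task τ) →
                ∀ vt E zs → (∀ {t} → t ∈ vt₀ → t ∈ vt) → E + length τs * e ≤ M → zs ⊑* zs₀ → Live vt E zs →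
                ∃₂ λ new zs′ → zs′ ⊑* zs × κ * length new ≤ ∑ cost τs ×
                  Live (new ++ vt) (E + length τs * e) zs′ × (∀ {τ} → τ ∈ τs → Φ τ zs′)
      perform [] _ vt E zs _ _ _ live = [] , zs , (λ _ → ⊆-refl) , ≤-trans (≤-reflexive (*-zeroʳ κ)) z≤n ,
        subst (λ E → Live vt E zs) (sym (+-identityʳ E)) live , λ ()
      perform (τ ∷ τs) tasks vt E zs vt₀⊆ E≤ zs⊑ live
        with tasks (here refl) vt E zs vt₀⊆ (≤-trans (+-monoʳ-≤ E (m≤m+n e _)) E≤) zs⊑ live
      ... | new , zs₁ , zs₁⊑ , cost₁ , live₁ , φ₁
        with perform τs (tasks ∘ there) (new ++ vt) (E + e) zs₁ (∈-++⁺ʳ new ∘ vt₀⊆)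
               (≤-trans (≤-reflexive (+-assoc E e _)) E≤) (λ f → ⊆-trans (zs₁⊑ f) (zs⊑ f)) live₁
      ...   | new′ , zs₂ , zs₂⊑ , cost₂ , live₂ , φ₂ =
        new′ ++ new , zs₂ , (λ f → ⊆-trans (zs₂⊑ f) (zs₁⊑ f)) , (begin
          κ * length (new′ ++ new)             ≡⟨ cong (κ *_) (length-++ new′) ⟩
          κ * (length new′ + length new)       ≡⟨ *-distribˡ-+ κ (length new′) _ ⟩
          κ * length new′ + κ * length new     ≤⟨ +-mono-≤ cost₂ cost₁ ⟩
          ∑ cost τs + cost τ                   ≡⟨ +-comm _ (cost τ) ⟩
          cost τ + ∑ cost τs                   ∎) ,
        subst₂ (λ vt E → Live vt E zs₂) (sym (++-assoc new′ new vt)) (+-assoc E e _) live₂ ,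
        λ { (here refl) → Φ-mono τ zs₂⊑ φ₁ ; (there τ∈) → φ₂ τ∈ }
        where open ≤-Reasoning

-- Splitting lists, and logarithms to base 4.

module _ {A : Set} where

  split-first : {P : A → Set} (P? : Decidable P) (xs : List A) →
    (∀ {x} → x ∈ xs → ¬ P x) ⊎
    ∃₂ λ as a → ∃ λ bs → xs ≡ as ++ a ∷ bs × P a × (∀ {x} → x ∈ as → ¬ P x)
  split-first P? [] = inj₁ λ ()
  split-first P? (x ∷ xs) with P? x
  ... | yes px = inj₂ ([] , x , xs , refl , px , λ ())
  ... | no ¬px with split-first P? xs
  ...   | inj₁ none = inj₁ λ { (here refl) → ¬px ; (there x∈) → none x∈ }
  ...   | inj₂ (as , a , bs , refl , pa , none) =
    inj₂ (x ∷ as , a , bs , refl , pa , λ { (here refl) → ¬px ; (there x∈) → none x∈ })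

  split-last : {P Q : A → Set} (xs : List A) → (∀ {x} → x ∈ xs → P x ⊎ Q x) →
    (∀ {x} → x ∈ xs → Q x) ⊎
    ∃₂ λ as a → ∃ λ bs → xs ≡ as ++ a ∷ bs × P a × (∀ {x} → x ∈ bs → Q x)
  split-last [] _ = inj₁ λ ()
  split-last (x ∷ xs) choose with split-last xs (choose ∘ there)
  ... | inj₂ (as , a , bs , refl , pa , qs) = inj₂ (x ∷ as , a , bs , refl , pa , qs)
  ... | inj₁ qs with choose (here refl)
  ...   | inj₁ px = inj₂ ([] , x , xs , refl , px , qs)
  ...   | inj₂ qx = inj₁ λ { (here refl) → qx ; (there x∈) → qs x∈ }

-- For k ≥ 1 the number g = 2 ^ `log₄` k is a rough square root: g² ≤ k < 4g². Pieces are classified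
-- by this g.
log₄ : ℕ → ℕ
log₄ zero    = 0
log₄ (suc k) with 4 ^ suc (log₄ k) ≤? suc k
... | yes _ = suc (log₄ k)
... | no  _ = log₄ k

<4^log₄ : ∀ k → k < 4 ^ suc (log₄ k)
<4^log₄ zero    = s≤s z≤n
<4^log₄ (suc k) with 4 ^ suc (log₄ k) ≤? suc k
... | no  k< = ≰⇒> k<
... | yes _  = ≤-<-trans (<4^log₄ k) (^-monoʳ-< 4 (s≤s (s≤s z≤n)) (n<1+n (suc (log₄ k))))

4^log₄≤ : ∀ k → 1 ≤ k → 4 ^ log₄ k ≤ k
4^log₄≤ (suc k) _ with 4 ^ suc (log₄ k) ≤? suc k
... | yes le = le
4^log₄≤ (suc zero)    _ | no _ = s≤s z≤n
4^log₄≤ (suc (suc k)) _ | no _ = m≤n⇒m≤1+n (4^log₄≤ (suc k) (s≤s z≤n))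

4^≡2^*2^ : ∀ j → 4 ^ j ≡ 2 ^ j * 2 ^ j
4^≡2^*2^ zero    = refl
4^≡2^*2^ (suc j) = trans (cong (4 *_) (4^≡2^*2^ j)) (rearrange (2 ^ j))
  where
  rearrange : ∀ a → 4 * (a * a) ≡ 2 * a * (2 * a)
  rearrange = solve-∀

2^log₄≤ : ∀ k → k ≤ 4 * 2 ^ log₄ k * 2 ^ log₄ k
2^log₄≤ k = begin
  k                                ≤⟨ <⇒≤ (<4^log₄ k) ⟩
  4 * 4 ^ log₄ k                   ≡⟨ cong (4 *_) (4^≡2^*2^ (log₄ k)) ⟩
  4 * (2 ^ log₄ k * 2 ^ log₄ k)    ≡⟨ *-assoc 4 (2 ^ log₄ k) _ ⟨
  4 * 2 ^ log₄ k * 2 ^ log₄ k      ∎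
  where open ≤-Reasoning

length-cartesianProduct : {A B : Set} (xs : List A) (ys : List B) →
                          length (cartesianProduct xs ys) ≡ length xs * length ys
length-cartesianProduct []       ys = refl
length-cartesianProduct (x ∷ xs) ys = trans (length-++ (map (x ,_) ys))
  (cong₂ _+_ (length-map (x ,_) ys) (length-cartesianProduct xs ys))

-- Shortcutting trails.

module Jumps {V : Set} (d : V → V → ℕ) (d-refl : ∀ x → d x x ≡ 0)
             (triangle : ∀ x y z → d x z ≤ d x y + d y z)
             (Step : V → V → ℕ → Set) (d≤step : ∀ {x y k} → Step x y k → d x y ≤ k) where

  open Trails d d-refl triangle Step d≤step

  via : ∀ {vt x y z zs k} → Trail vt x zs y k → z ∈ zs → d x z + d z y ≤ k
  via p z∈ with ∈-∃++ z∈
  ... | as , bs , refl with split as p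
  ...   | _ , _ , refl , p₁ , p₂ = +-mono-≤ (d≤trail p₁) (d≤trail p₂)

  -- The jump leads from the first point `a` in `P` to the last one that `a` reaches freely at its
  -- exact distance, so the trail does not get longer. The points of `P` after it are confined to
  -- `C₁` and `C₂`, since `close` excludes those farther than ƛ. If there is no such target, `a`
  -- itself serves as `b`.
  skip-ahead : ∀ {vt x y zs ℓ ƛ} {P : V → Set} (P? : Decidable P) (pcs : List (List V)) →
    (∀ {a} → P a → ∃₂ λ C₁ C₂ → C₁ ∈ pcs × C₂ ∈ pcs ×
       (∀ {z} → P z → Free vt a z (d a z) ⊎ ƛ < d a z ⊎ z ∈ C₁ ⊎ z ∈ C₂)) →
    AllPairs (λ a z → P a → P z → d a z ≤ ƛ) zs → Trail vt x zs y ℓ →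
    ∃₂ λ zs′ ℓ′ → zs′ ⊑ zs × Trail vt x zs′ y ℓ′ × ℓ′ ≤ ℓ ×
      ((∀ {z} → z ∈ zs′ → ¬ P z) ⊎
       (∃ λ b → ∃₂ λ C₁ C₂ → C₁ ∈ pcs × C₂ ∈ pcs ×
          (∀ {z} → z ∈ zs′ → P z → z ≡ b ⊎ z ∈ C₁ ⊎ z ∈ C₂)))
  skip-ahead {vt} {zs = zs} {ƛ = ƛ} {P} P? pcs locate close p with split-first P? zs
  ... | inj₁ none = zs , _ , ⊆-refl , p , ≤-refl , inj₁ none
  ... | inj₂ (as , a , bs , refl , Pa , none) with locate Pa
  ...   | C₁ , C₂ , C₁∈ , C₂∈ , located with split-last {P = λ z → P z × Free vt a z (d a z)}
                                                        {Q = λ z → P z → z ∈ C₁ ⊎ z ∈ C₂} bs choose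
    where
    choose : ∀ {z} → z ∈ bs → (P z × Free vt a z (d a z)) ⊎ (P z → z ∈ C₁ ⊎ z ∈ C₂)
    choose {z} z∈ with P? z
    ... | no ¬Pz = inj₂ (λ Pz → contradiction Pz ¬Pz)
    ... | yes Pz with located Pz
    ...   | inj₁ free       = inj₁ (Pz , free)
    ...   | inj₂ (inj₁ far) = contradiction
      (AllPairs-across (as ++ a ∷ []) (subst (AllPairs _) (sym (++-assoc as (a ∷ []) bs)) close)
        (∈-++⁺ʳ as (here refl)) z∈ Pa Pz) (<⇒≱ far)
    ...   | inj₂ (inj₂ z∈C) = inj₂ (λ _ → z∈C)
  ...     | inj₁ rest = as ++ a ∷ bs , _ , ⊆-refl , p , ≤-refl , inj₂ (a , C₁ , C₂ , C₁∈ , C₂∈ , left)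
    where
    left : ∀ {z} → z ∈ as ++ a ∷ bs → P z → z ≡ a ⊎ z ∈ C₁ ⊎ z ∈ C₂
    left z∈ Pz with ∈-++⁻ as z∈
    ... | inj₁ z∈as          = contradiction Pz (none z∈as)
    ... | inj₂ (here refl)   = inj₁ refl
    ... | inj₂ (there z∈bs)  = inj₂ (rest z∈bs Pz)
  ...     | inj₂ (cs , b , ds , refl , (Pb , free) , rest)
    with jump {e = 0} as cs id p (λ _ q → _ , free , ≤-trans (d≤trail q) (m≤m+n _ 0))
  ...       | ℓ′ , p′ , ℓ′≤ = as ++ b ∷ ds , ℓ′ , ⊑-++⁺ (⊆-refl {x = as}) (a ∷ʳ ⊑-++ˡ cs ⊆-refl) ,
    p′ , ≤-trans ℓ′≤ (≤-reflexive (+-identityʳ _)) , inj₂ (b , C₁ , C₂ , C₁∈ , C₂∈ , left)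
    where
    left : ∀ {z} → z ∈ as ++ b ∷ ds → P z → z ≡ b ⊎ z ∈ C₁ ⊎ z ∈ C₂
    left z∈ Pz with ∈-++⁻ as z∈
    ... | inj₁ z∈as          = contradiction Pz (none z∈as)
    ... | inj₂ (here refl)   = inj₁ refl
    ... | inj₂ (there z∈ds)  = inj₂ (rest z∈ds Pz)

  -- The trail visits every middle point z between `a` and `b`, so d a z + d z b is at most the
  -- length of the replaced part. This is what makes a detour through z affordable.
  jump-thirds : ∀ {vt vt′ s t ℓ e zs X a b} {P : V → Set} {P? : Decidable P} (th : Thirds P? X zs) →
    (∀ {v} → v ∈ vt → v ∈ vt′) → Trail vt s zs t ℓ → a ∈ Thirds.front th → b ∈ Thirds.back th →
    (∀ {k} → k ≤ ℓ → d a b ≤ k → (∀ {z} → z ∈ Thirds.middle th → d a z + d z b ≤ k) →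
       ∃ λ k′ → Free vt′ a b k′ × k′ ≤ k + e) →
    ∃₂ λ zs′ ℓ′ → zs′ ⊑ zs × Trail vt′ s zs′ t ℓ′ × ℓ′ ≤ ℓ + e ×
      count P? zs′ ≤ count P? (Thirds.front th) + count P? (Thirds.back th)
  jump-thirds {vt = vt} {s = s} {t} {ℓ} {a = a} {b} {P? = P?} th i p a∈ b∈ shortcut
    with Thirds.front th | Thirds.middle th | Thirds.back th | Thirds.parts th | ∈-∃++ a∈ | ∈-∃++ b∈
  ... | _ | middle | _ | refl | a₁ , a₂ , refl | b₁ , b₂ , refl
    with jump a₁ (a₂ ++ middle ++ b₁) i (subst (λ zs → Trail vt s zs t ℓ) (reassoc a₁ a₂ middle b₁) p)
           (λ k≤ q → shortcut k≤ (d≤trail q) (λ z∈ → via q (there (∈-++⁺ʳ a₂ (∈-++⁺ˡ z∈)))))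
    where
    reassoc : ∀ (a₁ : List V) {a} (a₂ ms b₁ : List V) {bs} →
              (a₁ ++ a ∷ a₂) ++ ms ++ b₁ ++ bs ≡ a₁ ++ (a ∷ (a₂ ++ ms ++ b₁)) ++ bs
    reassoc a₁ {a} a₂ ms b₁ {bs} = trans (++-assoc a₁ (a ∷ a₂) _) (cong (λ zs → a₁ ++ a ∷ zs)
      (sym (trans (++-assoc a₂ (ms ++ b₁) bs) (cong (a₂ ++_) (++-assoc ms b₁ bs)))))
  ...   | ℓ′ , p′ , ℓ′≤ = a₁ ++ b ∷ b₂ , ℓ′ , ⊑-++⁺ a₁⊑ (⊑-++ˡ middle b∷b₂⊑) ,
    p′ , ℓ′≤ , ≤-trans (≤-reflexive (count-++ P? a₁ (b ∷ b₂)))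
      (+-mono-≤ (count-⊑ P? a₁⊑) (count-⊑ P? b∷b₂⊑))
    where
    a₁⊑ : a₁ ⊑ a₁ ++ a ∷ a₂
    a₁⊑ = ⊑-++ʳ (a ∷ a₂) (⊆-refl {x = a₁})
    b∷b₂⊑ : b ∷ b₂ ⊑ b₁ ++ b ∷ b₂
    b∷b₂⊑ = ⊑-++ˡ b₁ (⊆-refl {x = b ∷ b₂})

-- Counting by cases, end points of chains, geodesic lists and cost estimates.

module _ {A : Set} where

  count-⊎ : {P Q R : A → Set} (P? : Decidable P) (Q? : Decidable Q) (R? : Decidable R) (xs : List A) →
            (∀ {x} → x ∈ xs → P x → Q x ⊎ R x) → count P? xs ≤ count Q? xs + count R? xs
  count-⊎ P? Q? R? []       _   = z≤n
  count-⊎ P? Q? R? (x ∷ xs) P⇒ with count-⊎ P? Q? R? xs (P⇒ ∘ there)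
  ... | ih with P? x
  ...   | no _ = ≤-trans ih (+-mono-≤ (count-⊑ Q? (x ∷ʳ ⊆-refl)) (count-⊑ R? (x ∷ʳ ⊆-refl)))
  ...   | yes px with P⇒ (here refl) px
  ...     | inj₁ qx = ≤-trans (s≤s ih) (≤-trans (≤-reflexive (cong (_+ count R? xs) (sym (count-∷⁺ Q? xs qx))))
                        (+-monoʳ-≤ _ (count-⊑ R? (x ∷ʳ ⊆-refl))))
  ...     | inj₂ rx = ≤-trans (s≤s ih) (≤-trans (≤-reflexive (trans (sym (+-suc _ _))
                        (cong (count Q? xs +_) (sym (count-∷⁺ R? xs rx))))) (+-monoˡ-≤ _ (count-⊑ Q? (x ∷ʳ ⊆-refl))))

  count-filter : {P Q : A → Set} (P? : Decidable P) (Q? : Decidable Q) (xs : List A) →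
                 count (λ x → P? x ×-dec Q? x) xs ≤ count P? (filter Q? xs)
  count-filter P? Q? [] = z≤n
  count-filter P? Q? (x ∷ xs) with Q? x | P? x in eq
  ... | no _  | no _  = count-filter P? Q? xs
  ... | no _  | yes _ = count-filter P? Q? xs
  ... | yes _ | no _  rewrite eq = count-filter P? Q? xs
  ... | yes _ | yes _ rewrite eq = s≤s (count-filter P? Q? xs)

  AllPairs-filter : {P : A → Set} {R : A → A → Set} (P? : Decidable P) (xs : List A) →
                    AllPairs (λ x y → P x → P y → R x y) xs → AllPairs R (filter P? xs)
  AllPairs-filter P? []       []       = []
  AllPairs-filter P? (x ∷ xs) (r ∷ rs) with P? x
  ... | no _   = AllPairs-filter P? xs rs
  ... | yes px = All.tabulate (λ y∈ → let y∈xs , py = ∈-filter⁻ P? {xs = xs} y∈ in All.lookup r y∈xs px py)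
                   ∷ AllPairs-filter P? xs rs

  Unique-concat : (xss : List (List A)) → Unique (concat xss) →
                  ∀ {xs ys x} → xs ∈ xss → ys ∈ xss → x ∈ xs → x ∈ ys → xs ≡ ys
  Unique-concat (zs ∷ xss) u (here refl) (here refl) _   _   = refl
  Unique-concat (zs ∷ xss) u (here refl) (there q)   x∈p x∈q =
    contradiction refl (AllPairs-across zs u x∈p (∈-concat⁺′ x∈q q))
  Unique-concat (zs ∷ xss) u (there p)   (here refl) x∈p x∈q =
    contradiction refl (AllPairs-across zs u x∈q (∈-concat⁺′ x∈p p))
  Unique-concat (zs ∷ xss) u (there p)   (there q)   x∈p x∈q =
    Unique-concat xss (AllPairs-resp-⊑ (⊑-++ˡ zs ⊆-refl) u) p q x∈p x∈q

  lift-list : {B : Set} (g : B → A) (xs : List A) → (∀ {x} → x ∈ xs → ∃ λ b → g b ≡ x) →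
              ∃ λ bs → map g bs ≡ xs
  lift-list g []       _    = [] , refl
  lift-list g (x ∷ xs) lift with lift (here refl) | lift-list g xs (lift ∘ there)
  ... | b , refl | bs , refl = b ∷ bs , refl

  -- The list `l` encodes an optional point, the first one of `q` in `P`. All other points of `q` in
  -- `P` come later, so one point of access suffices for all of them.
  entry : {R : A → A → Set} {P : A → Set} (P? : Decidable P) (q : List A) → AllPairs R q →
          ∃ λ l → length l ≤ 1 × (∀ {y} → y ∈ l → P y) ×
            (∀ {z} → z ∈ q → P z → ∃ λ y → y ∈ l × (y ≡ z ⊎ R y z))
  entry P? [] _ = [] , z≤n , (λ ()) , λ ()
  entry P? (x ∷ q) (rx ∷ rs) with P? x
  ... | yes px = x ∷ [] , s≤s z≤n , (λ { (here refl) → px }) ,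
    λ { (here refl) _ → x , here refl , inj₁ refl ; (there z∈) _ → x , here refl , inj₂ (All.lookup rx z∈) }
  ... | no ¬px with entry P? q rs
  ...   | l , l≤1 , lP , enter = l , l≤1 , lP ,
    λ { (here refl) px → contradiction px ¬px ; (there z∈) pz → enter z∈ pz }

  exit : {R : A → A → Set} {P : A → Set} (P? : Decidable P) (q : List A) → AllPairs R q →
         ∃ λ l → length l ≤ 1 × (∀ {y} → y ∈ l → P y × y ∈ q) ×
           (∀ {z} → z ∈ q → P z → ∃ λ y → y ∈ l × (y ≡ z ⊎ R z y))
  exit P? [] _ = [] , z≤n , (λ ()) , λ ()
  exit P? (x ∷ q) (rx ∷ rs) with exit P? q rs
  ... | y ∷ l , l≤1 , lP , leave = y ∷ l , l≤1 , (λ y∈ → proj₁ (lP y∈) , there (proj₂ (lP y∈))) ,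
    λ { (here refl) _ → y , here refl , inj₂ (All.lookup rx (proj₂ (lP (here refl))))
      ; (there z∈) pz → leave z∈ pz }
  ... | [] , l≤1 , lP , leave with P? x
  ...   | yes px = x ∷ [] , s≤s z≤n , (λ { (here refl) → px , here refl }) ,
    λ { (here refl) _ → x , here refl , inj₁ refl ; (there z∈) pz → contradiction (proj₁ (proj₂ (leave z∈ pz))) λ () }
  ...   | no ¬px = [] , z≤n , (λ ()) ,
    λ { (here refl) px → contradiction px ¬px ; (there z∈) pz → leave z∈ pz }

Unique-count : {A : Set} (_≟_ : DecidableEquality A) {xs : List A} (e : A) → Unique xs → count (e ≟_) xs ≤ 1
Unique-count _≟_ {[]}     e _        = z≤n
Unique-count _≟_ {x ∷ xs} e (x∉ ∷ u) with e ≟ x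
... | yes refl = s≤s (≤-reflexive (count-none (e ≟_) xs (λ e∈ → All.lookup x∉ e∈)))
... | no _     = Unique-count _≟_ e u

round-up : ∀ M v u → v ≤ M * u → ∃ λ i → i ≤ M × v ≤ i * u × i * u ≤ v + u
round-up zero    v u le = 0 , z≤n , le , z≤n
round-up (suc M) v u le with v ≤? M * u
... | yes v≤ with round-up M v u v≤
...   | i , i≤ , v≤iu , iu≤ = i , m≤n⇒m≤1+n i≤ , v≤iu , iu≤
round-up (suc M) v u le | no v≰ = suc M , ≤-refl , le ,
  ≤-trans (+-monoʳ-≤ u (<⇒≤ (≰⇒> v≰))) (≤-reflexive (+-comm u v))

-- Exactness is required of all ordered triples, not just of consecutive points, so that it is
-- inherited by sublists.
data Geodesic {V : Set} (d : V → V → ℕ) : List V → Set where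
  []  : Geodesic d []
  _∷_ : ∀ {x xs} → AllPairs (λ y z → d x y + d y z ≤ d x z) xs → Geodesic d xs → Geodesic d (x ∷ xs)

Geodesic-resp-⊑ : {V : Set} {d : V → V → ℕ} {xs ys : List V} → xs ⊑ ys → Geodesic d ys → Geodesic d xs
Geodesic-resp-⊑ []         []       = []
Geodesic-resp-⊑ (_ ∷ʳ s)   (_ ∷ g)  = Geodesic-resp-⊑ s g
Geodesic-resp-⊑ (refl ∷ s) (ps ∷ g) = AllPairs-resp-⊑ s ps ∷ Geodesic-resp-⊑ s g

opaque

  -- The weight of `e` on `f` is the number of points of `xs f` that are related to `e`. Since every
  -- point in `P` is related to some `e`, a list with X of them is heavy.
  hit-lists : {V E F : Set} (fs : List F) (complete : ∀ f → f ∈ fs) (L : ℕ) → length fs < 2 ^ L →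
    (U : List E) {R : E → V → Set} (R? : ∀ e → Decidable (R e)) (xs : F → List V)
    {P : F → V → Set} (P? : ∀ f → Decidable (P f)) (μ X : ℕ) → 1 ≤ X →
    (∀ f {e} → e ∈ U → count (R? e) (xs f) ≤ μ) →
    (∀ f {x} → x ∈ xs f → P f x → Any (λ e → R e x) U) →
    ∃ λ A → (∀ {e} → e ∈ A → e ∈ U) × X * length A ≤ 2 * length U * μ * L ×
      (∀ f → X ≤ count (P? f) (xs f) → ∃₂ λ e x → e ∈ A × x ∈ xs f × R e x)
  hit-lists fs complete L few U R? xs P? μ X 1≤X bounded covered
    with Hitting.hitting-heavy U (λ f e → count (R? e) (xs f)) μ X 1≤X bounded L fs few
  ... | A , A⊆U , bound , hits = A , A⊆U , bound , λ f X≤ →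
    let e , e∈ , lt = hits (complete f) (≤-trans X≤ (count-cover (P? f) R? U (xs f) (covered f)))
        x , x∈ , r = count>0⇒∃ (R? e) (xs f) lt
    in e , x , e∈ , x∈ , r

module _ {A : Set} {P : A → Set} {P? : Decidable P} {X : ℕ} {xs : List A} (th : Thirds P? X xs) where
  open Thirds th

  front⊑ : front ⊑ xs
  front⊑ = subst (front ⊑_) (sym parts) (⊑-++ʳ (middle ++ back) ⊆-refl)

  middle⊑ : middle ⊑ xs
  middle⊑ = subst (middle ⊑_) (sym parts) (⊑-++ˡ front (⊑-++ʳ back ⊆-refl))

  back⊑ : back ⊑ xs
  back⊑ = subst (back ⊑_) (sym parts) (⊑-++ˡ front (⊑-++ˡ middle ⊆-refl))

∑-⊑ : {A : Set} (f : A → ℕ) {xs ys : List A} → xs ⊑ ys → ∑ f xs ≤ ∑ f ys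
∑-⊑ f []             = z≤n
∑-⊑ f (y ∷ʳ xs⊑)     = ≤-trans (∑-⊑ f xs⊑) (m≤n+m _ (f y))
∑-⊑ f (refl ∷ xs⊑)   = +-monoʳ-≤ _ (∑-⊑ f xs⊑)

∑-cartesianProduct : {A B : Set} (f : A → ℕ) (xs : List A) (ys : List B) →
                     ∑ (f ∘ proj₁) (cartesianProduct xs ys) ≡ ∑ f xs * length ys
∑-cartesianProduct f []       ys = refl
∑-cartesianProduct f (x ∷ xs) ys = trans (∑-++ (f ∘ proj₁) (map (x ,_) ys) (cartesianProduct xs ys))
  (trans (cong₂ _+_ (row ys) (∑-cartesianProduct f xs ys)) (sym (*-distribʳ-+ (length ys) (f x) (∑ f xs))))
  where
  row : ∀ ys → ∑ (f ∘ proj₁) (map (x ,_) ys) ≡ f x * length ys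
  row []       = sym (*-zeroʳ (f x))
  row (_ ∷ ys) = trans (cong (f x +_) (row ys)) (sym (*-suc (f x) (length ys)))

-- The samples of pieces contribute a factor 1/g and the sample of chains a factor g, so g can be
-- cancelled. The constant is 336 = 2 · 12 · 14: two pairs per gate, 12 = 2 · (2 · 3) for two
-- samples of pieces, and 14 = 2 · 7 for the chains.
gate-cost : ∀ m g a₁ a₂ b u v I L s D → 1 ≤ g →
  m * a₁ ≤ 2 * u * (I * (3 * g)) * L → m * a₂ ≤ 2 * u * (I * (3 * g)) * L → u * (g * g) ≤ s →
  m * b ≤ 2 * v * (I * (7 * g)) * L → v * m ≤ s →
  m * m * m * ((a₁ + a₂) * b * D * 2) ≤ D * (336 * (I * L * s) * (I * L * s))
gate-cost m g a₁ a₂ b u v I L s D 1≤g ha₁ ha₂ hu hb hv = *-cancelˡ-≤ g {{>-nonZero 1≤g}} (begin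
  g * (m * m * m * ((a₁ + a₂) * b * D * 2))
    ≡⟨ rearrange₁ g m a₁ a₂ b D ⟩
  2 * D * ((m * a₁ + m * a₂) * g * (m * b * m))
    ≤⟨ *-monoʳ-≤ (2 * D) (*-mono-≤ front middle) ⟩
  2 * D * (12 * (I * L * s) * (14 * (I * L * s) * g))
    ≡⟨ rearrange₂ g (I * L * s) D ⟩
  g * (D * (336 * (I * L * s) * (I * L * s))) ∎)
  where
  open ≤-Reasoning
  rearrange₁ : ∀ g m a₁ a₂ b D → g * (m * m * m * ((a₁ + a₂) * b * D * 2)) ≡
               2 * D * ((m * a₁ + m * a₂) * g * (m * b * m))
  rearrange₁ = solve-∀
  rearrange₂ : ∀ g x D → 2 * D * (12 * x * (14 * x * g)) ≡ g * (D * (336 * x * x))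
  rearrange₂ = solve-∀
  rearrange₃ : ∀ u I g L → (2 * u * (I * (3 * g)) * L + 2 * u * (I * (3 * g)) * L) * g ≡ 12 * (I * L * (u * (g * g)))
  rearrange₃ = solve-∀
  rearrange₄ : ∀ v I g L m → 2 * v * (I * (7 * g)) * L * m ≡ 14 * (I * L * (v * m)) * g
  rearrange₄ = solve-∀
  front : (m * a₁ + m * a₂) * g ≤ 12 * (I * L * s)
  front = ≤-trans (*-monoˡ-≤ g (+-mono-≤ ha₁ ha₂))
    (≤-trans (≤-reflexive (rearrange₃ u I g L)) (*-monoʳ-≤ 12 (*-monoʳ-≤ (I * L) hu)))
  middle : m * b * m ≤ 14 * (I * L * s) * g
  middle = ≤-trans (*-monoˡ-≤ m hb)
    (≤-trans (≤-reflexive (rearrange₄ v I g L m)) (*-monoˡ-≤ g (*-monoʳ-≤ 14 (*-monoʳ-≤ (I * L) hv))))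

opaque

  -- This is m³ times the number of virtual pairs allowed at one scale. The term linear in s pays
  -- for links, stars and the samples inside pieces, and the quadratic one for the gates of J ranks.
  budget : (m I J L s : ℕ) → ℕ
  budget m I J L s = m * m * m * ((3 + I * (16 * L * L)) * s) +
                     J * ((5 + I + 20 * J) * (336 * (I * L * s) * (I * L * s)))

  budget≡ : ∀ m I J L s → budget m I J L s ≡ m * m * m * ((3 + I * (16 * L * L)) * s) +
                                             J * ((5 + I + 20 * J) * (336 * (I * L * s) * (I * L * s)))
  budget≡ m I J L s = refl

-- Hop reduction at one scale.

module Scale {V : Set} (_≟V_ : DecidableEquality V) (d : V → V → ℕ) (d-refl : ∀ x → d x x ≡ 0)
             (triangle : ∀ x y z → d x z ≤ d x y + d y z)
             (Step : V → V → ℕ → Set) (d≤step : ∀ {x y k} → Step x y k → d x y ≤ k)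
             {F : Set} (fs : List F) (complete : ∀ f → f ∈ fs)
             (src tgt : F → V) (base : F → ℕ) (zs₀ : F → List V) (S : List V)
             (zs₀⊆S : ∀ f {x} → x ∈ zs₀ f → x ∈ S) (unique₀ : ∀ f → Unique (zs₀ f))
             (ƛ I : ℕ) (label : F → V → ℕ) (label< : ∀ f {x} → x ∈ zs₀ f → label f x < I)
             (close : ∀ f → AllPairs (λ x y → label f x ≡ label f y → d x y ≤ ƛ) (zs₀ f))
             (geodesic : ∀ f → Geodesic d (zs₀ f)) (base≤ : ∀ f → base f ≤ I * ƛ)
             (L : ℕ) (few : length fs < 2 ^ L) (J : ℕ) (S<4^J : length S < 4 ^ J)
             (m : ℕ) (1≤m : 1 ≤ m) where

  open import Data.List.Membership.DecPropositional _≟V_ using (_∈?_)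
  open Trails d d-refl triangle Step d≤step
  open Jumps d d-refl triangle Step d≤step
  open Family fs complete src tgt base
  open Cutting d d-refl triangle ƛ

  -- A class plays the role of a segment of length at most ƛ: each of its points reaches the later
  -- ones within ƛ.
  class : F → ℕ → List V
  class f i = filter (λ x → label f x ≟ i) (zs₀ f)

  cands : List (List V)
  cands = cartesianProductWith class fs (upTo I)

  class-of : ∀ {c} → c ∈ cands → ∃₂ λ f i → c ≡ class f i
  class-of c∈ with ∈-cartesianProductWith⁻ class fs (upTo I) c∈
  ... | f , i , _ , _ , eq = f , i , eq

  class⊑ : ∀ f i → class f i ⊑ zs₀ f
  class⊑ f i = filter-⊆ (λ x → label f x ≟ i) (zs₀ f)

  class-forward : ∀ f i → AllPairs Forward (class f i)
  class-forward f i = AllPairs-filter (λ x → label f x ≟ i) (zs₀ f)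
    (AllPairs.map (λ { cl refl eq → cl (sym eq) }) (close f))

  cand-unique : ∀ {c} → c ∈ cands → Unique c
  cand-unique c∈ with class-of c∈
  ... | f , i , refl = Uniqueₚ.filter⁺ (λ x → label f x ≟ i) (unique₀ f)

  cand⊆S : ∀ {c} → c ∈ cands → ∀ {x} → x ∈ c → x ∈ S
  cand⊆S c∈ x∈ with class-of c∈
  ... | f , i , refl = zs₀⊆S f (⊑-lookup (class⊑ f i) x∈)

  open Cover _≟V_ S cands cand-unique cand⊆S m 1≤m

  opaque
    saturation : Σ Chains Saturated
    saturation = cover

  K : Chains
  K = proj₁ saturation

  saturated : Saturated K
  saturated = proj₂ saturation

  Chain : Set
  Chain = ∃ λ q → AllPairs Forward q × Geodesic d q

  points : Chain → List V
  points = proj₁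

  opaque
    lifted : Σ (List Chain) λ cs → map points cs ≡ chains K
    lifted = lift-list points (chains K) λ q∈ → case from-cand K q∈ of λ { (c , c∈ , q⊑c) →
      case class-of c∈ of λ { (f , i , refl) →
        (_ , AllPairs-resp-⊑ q⊑c (class-forward f i) , Geodesic-resp-⊑ (⊆-trans q⊑c (class⊑ f i)) (geodesic f)) , refl } }

  cs : List Chain
  cs = proj₁ lifted

  cut-of : (c : Chain) → Cut (proj₁ c)
  cut-of (q , fwd , _) = cut (length q) q ≤-refl fwd

  pieces-of : Chain → List (List V)
  pieces-of c = pieces (cut-of c)

  Π : List (List V)
  Π = concatMap pieces-of cs

  concat-Π : concat Π ≡ concat (chains K)
  concat-Π = trans (go cs) (cong concat (proj₂ lifted))
    where
    go : ∀ cs → concat (concatMap pieces-of cs) ≡ concat (map points cs)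
    go []       = refl
    go (c ∷ cs) = trans (sym (concat-++ (pieces-of c) (concatMap pieces-of cs)))
                    (cong₂ _++_ (concat-pieces (cut-of c)) (go cs))

  Π-disjoint : Unique (concat Π)
  Π-disjoint = subst Unique (sym concat-Π) (disjoint K)

  s : ℕ
  s = length S

  Σ-pieces : ∑ length Π ≤ s
  Σ-pieces = ≤-trans (≤-reflexive (trans (sym (length-concat Π)) (cong length concat-Π)))
    (Unique-length (disjoint K) (within K))

  Σ-chains : ∑ (λ c → length (points c)) cs ≤ s
  Σ-chains = ≤-trans (≤-reflexive (trans (go cs) (trans (cong (∑ length) (proj₂ lifted)) (sym (length-concat (chains K))))))
    (Unique-length (disjoint K) (within K))
    where
    go : ∀ cs → ∑ (λ c → length (points c)) cs ≡ ∑ length (map points cs)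
    go []       = refl
    go (c ∷ cs) = cong (length (proj₁ c) +_) (go cs)

  chains-few : length cs * m ≤ s
  chains-few = ≤-trans (≤-reflexive (cong (_* m) (trans (sym (length-map points cs)) (cong length (proj₂ lifted)))))
    (chain-count K)

  piece-in : ∀ {c C} → c ∈ cs → C ∈ pieces-of c → C ∈ Π
  piece-in {c} c∈ C∈ = ∈-concat⁺′ C∈ (∈-map⁺ pieces-of c∈)

  piece-of : ∀ {C} → C ∈ Π → ∃ λ c → c ∈ cs × C ∈ pieces-of c
  piece-of C∈ with ∈-concat⁻′ (map pieces-of cs) C∈
  ... | _ , C∈ps , ps∈ with ∈-map⁻ pieces-of ps∈
  ...   | c , c∈ , refl = c , c∈ , C∈ps

  nonempty : ∀ {C} → C ∈ Π → 1 ≤ length C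
  nonempty C∈ with piece-of C∈
  ... | c , _ , C∈c = pieces-nonempty (cut-of c) C∈c

  -- Free movement along chains and through the heads of pieces.

  Linked : Chain → List (V × V) → Set
  Linked (q , _) vt = AllPairs (λ x y → Free vt x y (d x y)) q

  links : List V → List (V × V)
  links (x ∷ y ∷ q) = (x , y) ∷ links (y ∷ q)
  links _           = []

  links-length : ∀ q → length (links q) ≤ length q
  links-length []          = z≤n
  links-length (x ∷ [])    = z≤n
  links-length (x ∷ y ∷ q) = s≤s (links-length (y ∷ q))

  -- On a geodesic list the lengths of consecutive links add up to the exact distance, so linearly
  -- many pairs serve all quadratically many forward moves.
  links-linked : ∀ {vt} q → Geodesic d q → (∀ {v} → v ∈ links q → v ∈ vt) → AllPairs (λ x y → Free vt x y (d x y)) q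
  links-linked []          _             _  = []
  links-linked (x ∷ [])    _             _  = [] ∷ []
  links-linked {vt} (x ∷ y ∷ q) (px ∷ g) i with links-linked (y ∷ q) g (i ∘ there)
  ... | fy ∷ f = (xy ∷ All.tabulate far) ∷ fy ∷ f
    where
    xy : Free vt x y (d x y)
    xy = pair (i (here refl))
    far : ∀ {z} → z ∈ q → Free vt x z (d x z)
    far {z} z∈ = subst (Free vt x z) (≤-antisym (All.lookup (py px) z∈) (triangle x y z)) (xy ▷ All.lookup fy z∈)
      where
      py : AllPairs (λ y z → d x y + d y z ≤ d x z) (y ∷ q) → All (λ z → d x y + d y z ≤ d x z) q
      py (p ∷ _) = p

  -- The head represents its piece. Gates are built for heads only, and the star takes any other
  -- point to the head or back at a cost of at most 4ƛ.
  Starred : List V → List (V × V) → Set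
  Starred C vt = ∀ {r} → head C ≡ just r → ∀ {x} → x ∈ C → (x , r) ∈ vt × (r , x) ∈ vt

  Linked-mono : ∀ c {vt vt′} → (∀ {v} → v ∈ vt → v ∈ vt′) → Linked c vt → Linked c vt′
  Linked-mono c i = AllPairs.map (weaken i)

  opaque
    links-all : Σ (List (V × V)) λ vt → length vt ≤ ∑ (λ c → length (points c)) cs × (∀ {c} → c ∈ cs → Linked c vt)
    links-all = gather Linked Linked-mono (λ c → length (points c)) cs
      λ { {q , _ , g} _ → links q , links-length q , links-linked q g id }

    stars-all : Σ (List (V × V)) λ vt → length vt ≤ ∑ (λ C → 2 * length C) Π × (∀ {C} → C ∈ Π → Starred C vt)
    stars-all = gather Starred (λ C i st r x∈ → i (proj₁ (st r x∈)) , i (proj₂ (st r x∈)))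
      (λ C → 2 * length C) Π (λ {C} _ → star C)
      where
      star : ∀ C → ∃ λ vt → length vt ≤ 2 * length C × Starred C vt
      star [] = [] , z≤n , λ _ ()
      star C@(r ∷ _) = map (_, r) C ++ map (r ,_) C ,
        ≤-reflexive (trans (length-++ (map (_, r) C)) (cong₂ _+_ (length-map _ C) (trans (length-map _ C) (sym (+-identityʳ _))))) ,
        λ { refl x∈ → ∈-++⁺ˡ (∈-map⁺ (_, r) x∈) , ∈-++⁺ʳ (map (_, r) C) (∈-map⁺ (r ,_) x∈) }

  vt₀ : List (V × V)
  vt₀ = proj₁ links-all ++ proj₁ stars-all

  vt₀-length : length vt₀ ≤ 3 * s
  vt₀-length = begin
    length vt₀                           ≡⟨ length-++ (proj₁ links-all) ⟩
    length (proj₁ links-all) + length (proj₁ stars-all)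
      ≤⟨ +-mono-≤ (≤-trans (proj₁ (proj₂ links-all)) Σ-chains) (proj₁ (proj₂ stars-all)) ⟩
    s + ∑ (λ C → 2 * length C) Π         ≡⟨ cong (s +_) (∑-* 2 length Π) ⟩
    s + 2 * ∑ length Π                   ≤⟨ +-monoʳ-≤ s (*-monoʳ-≤ 2 Σ-pieces) ⟩
    3 * s                                ∎
    where open ≤-Reasoning

  linked : ∀ {c} → c ∈ cs → Linked c vt₀
  linked {c} c∈ = Linked-mono c ∈-++⁺ˡ (proj₂ (proj₂ links-all) c∈)

  starred : ∀ {C} → C ∈ Π → Starred C vt₀
  starred C∈ r x∈ with proj₂ (proj₂ stars-all) C∈ r x∈
  ... | xr , rx = ∈-++⁺ʳ (proj₁ links-all) xr , ∈-++⁺ʳ (proj₁ links-all) rx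

  rank : List V → ℕ
  rank C = log₄ (length C)

  -- Jumping along a chain from the first point a of a path to the last one ahead of
  -- a leaves points that a reaches within distance ƛ, but that are not ahead of it.
  OnChain : Chain × ℕ → F → V → Set
  OnChain (c , i) f x = x ∈ proj₁ c × label f x ≡ i

  Confined : Chain × ℕ → Points → Set
  Confined ci zs = ∀ f → (∀ {z} → z ∈ zs f → ¬ OnChain ci f z) ⊎
    (∃ λ b → ∃₂ λ C₁ C₂ → C₁ ∈ pieces-of (proj₁ ci) × C₂ ∈ pieces-of (proj₁ ci) ×
      (∀ {z} → z ∈ zs f → OnChain ci f z → z ≡ b ⊎ z ∈ C₁ ⊎ z ∈ C₂))

  Confined-mono : ∀ ci {zs zs′} → zs′ ⊑* zs → Confined ci zs → Confined ci zs′
  Confined-mono ci zs′⊑ conf f with conf f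
  ... | inj₁ none = inj₁ (none ∘ ⊑-lookup (zs′⊑ f))
  ... | inj₂ (b , C₁ , C₂ , C₁∈ , C₂∈ , loc) = inj₂ (b , C₁ , C₂ , C₁∈ , C₂∈ , loc ∘ ⊑-lookup (zs′⊑ f))

  -- The zeros record that a jump along a chain uses only links of `vt₀` and is exact: it adds
  -- neither pairs nor length.
  module Confine = Perform Confined Confined-mono 1 (λ _ → 0) 0 0 vt₀ zs₀

  confine : ∀ {ci} → ci ∈ cartesianProduct cs (upTo I) → Confine.Task ci
  confine {c , i} ci∈ vt E zs vt₀⊆ _ zs⊑ live =
    [] , (λ f → proj₁ (skip f)) , (λ f → proj₁ (proj₂ (proj₂ (skip f)))) , z≤n ,
    (λ f → let _ , ℓ′ , _ , p , ℓ′≤ , _ = skip f in ℓ′ , p ,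
       ≤-trans ℓ′≤ (≤-trans (proj₂ (proj₂ (live f))) (≤-reflexive (cong (base f +_) (sym (+-identityʳ E)))))) ,
    λ f → proj₂ (proj₂ (proj₂ (proj₂ (proj₂ (skip f)))))
    where
    c∈ : c ∈ cs
    c∈ = proj₁ (∈-cartesianProduct⁻ cs (upTo I) ci∈)
    skip : ∀ f → _
    skip f = skip-ahead {ƛ = ƛ} (λ x → (x ∈? proj₁ c) ×-dec (label f x ≟ i)) (pieces-of c)
      (λ { (a∈ , _) → case two-pieces (cut-of c) (proj₁ (proj₂ c)) (AllPairs.map (weaken vt₀⊆) (linked c∈)) a∈ of
           λ { (C₁ , C₂ , C₁∈ , C₂∈ , loc) → C₁ , C₂ , C₁∈ , C₂∈ , λ { (z∈ , _) → loc z∈ } } })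
      (AllPairs-resp-⊑ (zs⊑ f) (AllPairs.map (λ { cl (_ , refl) (_ , eq) → cl (sym eq) }) (close f)))
      (proj₁ (proj₂ (live f)))

  -- The first and the last 2^j points of a path on a piece of size about 4^j hit two
  -- samples of about 2^j points, all pairs between which are made virtual.
  InPiece? : ∀ (Ci : List V × ℕ) f → Decidable (λ x → x ∈ proj₁ Ci × label f x ≡ proj₂ Ci)
  InPiece? (C , i) f x = (x ∈? C) ×-dec (label f x ≟ i)

  Thinned : List V × ℕ → Points → Set
  Thinned Ci zs = ∀ f → count (InPiece? Ci f) (zs f) ≤ 3 * 2 ^ rank (proj₁ Ci)

  Thinned-mono : ∀ Ci {zs zs′} → zs′ ⊑* zs → Thinned Ci zs → Thinned Ci zs′
  Thinned-mono Ci zs′⊑ th f = ≤-trans (count-⊑ (InPiece? Ci f) (zs′⊑ f)) (th f)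

  module Thin = Perform Thinned Thinned-mono 1 (λ Ci → length (proj₁ Ci) * (16 * L * L)) 0 0 vt₀ zs₀

  thin : ∀ {Ci} → Ci ∈ cartesianProduct Π (upTo I) → Thin.Task Ci
  thin {C , i} _ vt E zs vt₀⊆ _ zs⊑ live = new , (λ f → proj₁ (result f)) ,
    (λ f → proj₁ (proj₂ (proj₂ (result f)))) , cost ,
    (λ f → let _ , ℓ′ , _ , p , ℓ′≤ , _ = result f in ℓ′ , p , ℓ′≤) ,
    (λ f → proj₂ (proj₂ (proj₂ (proj₂ (proj₂ (result f))))))
    where
    g = 2 ^ rank C
    1≤g : 1 ≤ g
    1≤g = m^n>0 2 (rank C)
    th : ∀ f → Thirds (InPiece? (C , i) f) g (zs f)
    th f = thirds (InPiece? (C , i) f) g (zs f)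

    module Hit (part : ∀ f → List V) (part⊑ : ∀ f → part f ⊑ zs f) where
      hit : Σ (List V) λ A → (∀ {e} → e ∈ A → e ∈ C) × g * length A ≤ 2 * length C * 1 * L ×
            (∀ f → g ≤ count (InPiece? (C , i) f) (part f) → ∃₂ λ e x → e ∈ A × x ∈ part f × e ≡ x)
      hit = hit-lists fs complete L few C _≟V_ part (InPiece? (C , i)) 1 g 1≤g
        (λ f {e} _ → Unique-count _≟V_ e (AllPairs-resp-⊑ (⊆-trans (part⊑ f) (zs⊑ f)) (unique₀ f)))
        (λ f x∈ (x∈C , _) → Any.map sym x∈C)

    module Front = Hit (λ f → Thirds.front (th f)) (λ f → front⊑ (th f))
    module Back = Hit (λ f → Thirds.back (th f)) (λ f → back⊑ (th f))

    A₁ A₂ : List V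
    A₁ = proj₁ Front.hit
    A₂ = proj₁ Back.hit

    new : List (V × V)
    new = cartesianProduct A₁ A₂

    -- As |C| ≤ 4g², the first sample has at most 8gL points. The second one satisfies g|A₂| ≤
    -- 2|C|L, which gives the product 16|C|L².
    cost : 1 * length new ≤ length C * (16 * L * L)
    cost = begin
      1 * length new              ≡⟨ trans (*-identityˡ _) (length-cartesianProduct A₁ A₂) ⟩
      length A₁ * length A₂       ≤⟨ *-monoˡ-≤ (length A₂) A₁≤ ⟩
      8 * g * L * length A₂       ≡⟨ rearrange₁ g L (length A₂) ⟩
      8 * L * (g * length A₂)     ≤⟨ *-monoʳ-≤ (8 * L) (proj₁ (proj₂ (proj₂ Back.hit))) ⟩
      8 * L * (2 * length C * 1 * L) ≡⟨ rearrange₂ (length C) L ⟩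
      length C * (16 * L * L)     ∎
      where
      open ≤-Reasoning
      rearrange₁ : ∀ g L a → 8 * g * L * a ≡ 8 * L * (g * a)
      rearrange₁ = solve-∀
      rearrange₂ : ∀ c L → 8 * L * (2 * c * 1 * L) ≡ c * (16 * L * L)
      rearrange₂ = solve-∀
      rearrange₃ : ∀ g L → 2 * (4 * g * g) * 1 * L ≡ g * (8 * g * L)
      rearrange₃ = solve-∀
      A₁≤ : length A₁ ≤ 8 * g * L
      A₁≤ = *-cancelˡ-≤ g {{>-nonZero 1≤g}} (≤-trans (proj₁ (proj₂ (proj₂ Front.hit)))
        (≤-trans (*-monoˡ-≤ L (*-monoˡ-≤ 1 (*-monoʳ-≤ 2 (2^log₄≤ (length C))))) (≤-reflexive (rearrange₃ g L))))

    result : ∀ f → ∃₂ λ zs′ ℓ′ → zs′ ⊑ zs f × Trail (new ++ vt) (src f) zs′ (tgt f) ℓ′ ×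
             ℓ′ ≤ base f + (E + 0) × count (InPiece? (C , i) f) zs′ ≤ 3 * g
    result f with Thirds.few-or-many (th f) | live f
    ... | inj₁ few′ | ℓ , p , ℓ≤ = zs f , ℓ , ⊆-refl , weaken (∈-++⁺ʳ new) p ,
      ≤-trans ℓ≤ (+-monoʳ-≤ (base f) (m≤m+n E 0)) , few′
    ... | inj₂ (front≥ , _ , back≥ , both≤) | ℓ , p , ℓ≤
      with proj₂ (proj₂ (proj₂ Front.hit)) f front≥ | proj₂ (proj₂ (proj₂ Back.hit)) f back≥
    ...   | a , _ , a∈A₁ , a∈front , refl | b , _ , b∈A₂ , b∈back , refl
      with jump-thirds {e = 0} (th f) (∈-++⁺ʳ new) p a∈front b∈back
             (λ _ dab≤ _ → _ , pair (∈-++⁺ˡ (∈-cartesianProduct⁺ a∈A₁ b∈A₂)) , ≤-trans dab≤ (m≤m+n _ 0))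
    ...     | zs′ , ℓ′ , zs′⊑ , p′ , ℓ′≤ , count≤ = zs′ , ℓ′ , zs′⊑ , p′ ,
      ≤-trans ℓ′≤ (≤-trans (+-monoˡ-≤ 0 ℓ≤) (≤-reflexive (+-assoc (base f) E 0))) , ≤-trans count≤ both≤

  -- Points of a given rank.

  Π[_] : ℕ → List (List V)
  Π[ j ] = filter (λ C → rank C ≟ j) Π

  InRank : ℕ → V → Set
  InRank j x = Any (x ∈_) Π[ j ]

  inRank? : ∀ j → Decidable (InRank j)
  inRank? j x = any? (x ∈?_) Π[ j ]

  ∈Π[]⁻ : ∀ {j C} → C ∈ Π[ j ] → C ∈ Π × rank C ≡ j
  ∈Π[]⁻ {j} = ∈-filter⁻ (λ C → rank C ≟ j)

  Π[]-few : ∀ j → length Π[ j ] * (2 ^ j * 2 ^ j) ≤ s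
  Π[]-few j = begin
    length Π[ j ] * (2 ^ j * 2 ^ j) ≡⟨ cong (length Π[ j ] *_) (4^≡2^*2^ j) ⟨
    length Π[ j ] * 4 ^ j           ≤⟨ ∑-≥-length Π[ j ] large ⟩
    ∑ length Π[ j ]                 ≤⟨ ∑-⊑ length (filter-⊆ (λ C → rank C ≟ j) Π) ⟩
    ∑ length Π                      ≤⟨ Σ-pieces ⟩
    s                               ∎
    where
    open ≤-Reasoning
    large : ∀ {C} → C ∈ Π[ j ] → 4 ^ j ≤ length C
    large C∈ with ∈Π[]⁻ C∈
    ... | C∈Π , refl = 4^log₄≤ _ (nonempty C∈Π)

  count-by-label : ∀ f {P : V → Set} (P? : Decidable P) xs k → xs ⊑ zs₀ f →
    (∀ i → i < I → count (λ x → P? x ×-dec (label f x ≟ i)) xs ≤ k) → count P? xs ≤ I * k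
  count-by-label f P? xs k xs⊑ bounded = begin
    count P? xs ≤⟨ count-cover P? (λ i x → P? x ×-dec (label f x ≟ i)) (upTo I) xs
                     (λ x∈ px → Any.map (λ { refl → px , refl }) (∈-upTo⁺ (label< f (⊑-lookup xs⊑ x∈)))) ⟩
    _           ≤⟨ ∑-≤-length (upTo I) (λ i∈ → bounded _ (∈-upTo⁻ i∈)) ⟩
    length (upTo I) * k ≡⟨ cong (_* k) (length-upTo I) ⟩
    I * k       ∎
    where open ≤-Reasoning

  record Sparse (zs : Points) : Set where
    field
      sub      : zs ⊑* zs₀
      confined : ∀ {ci} → ci ∈ cartesianProduct cs (upTo I) → Confined ci zs
      thinned  : ∀ {Ci} → Ci ∈ cartesianProduct Π (upTo I) → Thinned Ci zs

    piece-count : ∀ {C} → C ∈ Π → ∀ f xs → xs ⊑ zs f → count (_∈? C) xs ≤ I * (3 * 2 ^ rank C)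
    piece-count {C} C∈ f xs xs⊑ = count-by-label f (_∈? C) xs _ (⊆-trans xs⊑ (sub f))
      (λ i i< → ≤-trans (count-⊑ (InPiece? (C , i) f) xs⊑) (thinned (∈-cartesianProduct⁺ C∈ (∈-upTo⁺ i<)) f))

    -- For each label, confinement leaves one point and two pieces, and thinning leaves at most 3 ·
    -- 2^j points in each piece of rank j; with 1 ≤ 2^j this makes 7 · 2^j. Pieces of another rank
    -- contribute nothing, because pieces are disjoint. The result is the maximal weight when chains
    -- are sampled.
    rank-count : ∀ {c} → c ∈ cs → ∀ j f xs → xs ⊑ zs f →
                     count (λ x → (x ∈? points c) ×-dec inRank? j x) xs ≤ I * (7 * 2 ^ j)
    rank-count {c} c∈ j f xs xs⊑ = count-by-label f (λ x → (x ∈? points c) ×-dec inRank? j x) xs _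
      (⊆-trans xs⊑ (sub f)) bounded
      where
      module _ (i : ℕ) (i< : i < I) where
        P : V → Set
        P x = (x ∈ points c × InRank j x) × label f x ≡ i
        P? : Decidable P
        P? x = ((x ∈? points c) ×-dec inRank? j x) ×-dec (label f x ≟ i)
        in-piece : ∀ {C} → C ∈ pieces-of c → count (λ x → P? x ×-dec (x ∈? C)) xs ≤ 3 * 2 ^ j
        in-piece {C} C∈ with rank C ≟ j
        ... | yes refl = ≤-trans (count-mono (λ x → P? x ×-dec (x ∈? C)) (InPiece? (C , i) f) xs
                            (λ { _ ((_ , eq) , x∈C) → x∈C , eq }))
                          (≤-trans (count-⊑ (InPiece? (C , i) f) xs⊑)
                            (thinned (∈-cartesianProduct⁺ (piece-in c∈ C∈) (∈-upTo⁺ i<)) f))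
        ... | no rank≢ = ≤-trans (≤-reflexive (count-none (λ x → P? x ×-dec (x ∈? C)) xs absurd)) z≤n
          where
          absurd : ∀ {x} → x ∈ xs → ¬ (P x × x ∈ C)
          absurd _ (((_ , inR) , _) , x∈C) with find inR
          ... | C′ , C′∈ , x∈C′ with ∈Π[]⁻ {j} C′∈
          ...   | C′∈Π , rank≡ = rank≢ (subst (λ C → rank C ≡ j)
                    (Unique-concat Π Π-disjoint C′∈Π (piece-in c∈ C∈) x∈C′ x∈C) rank≡)
        bounded : count P? xs ≤ 7 * 2 ^ j
        bounded with confined (∈-cartesianProduct⁺ c∈ (∈-upTo⁺ i<)) f
        ... | inj₁ none = ≤-trans (≤-reflexive (count-none P? xs
                            (λ x∈ ((x∈c , _) , eq) → none (⊑-lookup xs⊑ x∈) (x∈c , eq)))) z≤n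
        ... | inj₂ (b , C₁ , C₂ , C₁∈ , C₂∈ , loc) = begin
          count P? xs
            ≤⟨ count-⊎ P? (b ≟V_) (λ x → P? x ×-dec any? (x ∈?_) (C₁ ∷ C₂ ∷ [])) xs at-b ⟩
          count (b ≟V_) xs + count (λ x → P? x ×-dec any? (x ∈?_) (C₁ ∷ C₂ ∷ [])) xs
            ≤⟨ +-mono-≤ (Unique-count _≟V_ b (AllPairs-resp-⊑ (⊆-trans xs⊑ (sub f)) (unique₀ f)))
                 (count-⊎ (λ x → P? x ×-dec any? (x ∈?_) (C₁ ∷ C₂ ∷ [])) (λ x → P? x ×-dec (x ∈? C₁))
                    (λ x → P? x ×-dec (x ∈? C₂)) xs
                    (λ { _ (p , here x∈) → inj₁ (p , x∈) ; _ (p , there (here x∈)) → inj₂ (p , x∈) })) ⟩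
          1 + (count (λ x → P? x ×-dec (x ∈? C₁)) xs + count (λ x → P? x ×-dec (x ∈? C₂)) xs)
            ≤⟨ +-mono-≤ (m^n>0 2 j) (+-mono-≤ (in-piece C₁∈) (in-piece C₂∈)) ⟩
          2 ^ j + (3 * 2 ^ j + 3 * 2 ^ j)
            ≡⟨ rearrange (2 ^ j) ⟩
          7 * 2 ^ j ∎
          where
          open ≤-Reasoning
          rearrange : ∀ g → g + (3 * g + 3 * g) ≡ 7 * g
          rearrange = solve-∀
          at-b : ∀ {x} → x ∈ xs → P x → b ≡ x ⊎ (P x × Any (x ∈_) (C₁ ∷ C₂ ∷ []))
          at-b x∈ p@((x∈c , _) , eq) with loc (⊑-lookup xs⊑ x∈) (x∈c , eq)
          ... | inj₁ x≡b        = inj₁ (sym x≡b)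
          ... | inj₂ (inj₁ x∈C) = inj₂ (p , here x∈C)
          ... | inj₂ (inj₂ x∈C) = inj₂ (p , there (here x∈C))

  -- Gates between pieces and chains, and detours through them.

  Near : V → V → Set
  Near x y = Free vt₀ x y (d x y) × d x y ≤ ƛ

  -- Entering the chain at its first point within iƛ of `r` serves every `z` with the same bound,
  -- since `z` lies further along, free and within ƛ. Leaving uses the last point in the same way.
  -- So two pairs suffice for each rounded distance, however long the chain is.
  Gate : List V × Chain × ℕ → List (V × V) → Set
  Gate (C , c , i) vt = ∀ {r} → head C ≡ just r → ∀ {z} → z ∈ points c →
    (d r z ≤ i * ƛ → ∃ λ y → (r , y) ∈ vt × d r y ≤ i * ƛ × (y ≡ z ⊎ Near y z)) ×
    (d z r ≤ i * ƛ → ∃ λ y → (y , r) ∈ vt × d y r ≤ i * ƛ × (y ≡ z ⊎ Near z y))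

  Gate-mono : ∀ e {vt vt′} → (∀ {v} → v ∈ vt → v ∈ vt′) → Gate e vt → Gate e vt′
  Gate-mono e i gate r z∈ = (λ le → let y , v , rest = proj₁ (gate r z∈) le in y , i v , rest) ,
                            (λ le → let y , v , rest = proj₂ (gate r z∈) le in y , i v , rest)

  gate : ∀ C {c} → c ∈ cs → ∀ i → ∃ λ vt → length vt ≤ 2 × Gate (C , c , i) vt
  gate []      c∈ i = [] , z≤n , λ ()
  gate (r ∷ _) {c@(q , fwd , _)} c∈ i
    with entry (λ y → d r y ≤? i * ƛ) q near | exit (λ y → d y r ≤? i * ƛ) q near
    where
    near : AllPairs Near q
    near = AllPairs.zip (linked c∈ , fwd)
  ... | l₁ , l₁≤ , P₁ , in₁ | l₂ , l₂≤ , P₂ , out₂ = map (r ,_) l₁ ++ map (_, r) l₂ ,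
    ≤-trans (≤-reflexive (trans (length-++ (map (r ,_) l₁)) (cong₂ _+_ (length-map _ l₁) (length-map _ l₂))))
      (+-mono-≤ l₁≤ l₂≤) ,
    λ { refl z∈ →
      (λ le → let y , y∈ , yz = in₁ z∈ le in y , ∈-++⁺ˡ (∈-map⁺ (r ,_) y∈) , P₁ y∈ , yz) ,
      (λ le → let y , y∈ , zy = out₂ z∈ le
              in y , ∈-++⁺ʳ (map (r ,_) l₁) (∈-map⁺ (_, r) y∈) , proj₁ (P₂ y∈) , zy) }

  -- Rounded distances go up to Mƛ: 4ƛ inside a piece, and (I + 20J)ƛ for a trail of length at most
  -- Iƛ that has been lengthened by 20ƛ for each of J ranks.
  M : ℕ
  M = 4 + I + 20 * J

  opaque
    D : ℕ
    D = suc M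

    M<D : M < D
    M<D = ≤-refl

    D≡ : D ≡ 5 + I + 20 * J
    D≡ = refl

    slack : ℕ
    slack = 20 * ƛ

    slack≡ : slack ≡ 20 * ƛ
    slack≡ = refl

    reach : ℕ
    reach = (I + 20 * J) * ƛ

    reach≡ : reach ≡ (I + 20 * J) * ƛ
    reach≡ = refl

    gate-budget : ℕ
    gate-budget = D * (336 * (I * L * s) * (I * L * s))

    gate-budget≡ : gate-budget ≡ D * (336 * (I * L * s) * (I * L * s))
    gate-budget≡ = refl

  E-max : ℕ
  E-max = J * slack

  LowRank : ℕ → Points → Set
  LowRank j zs = ∀ f → count (inRank? j) (zs f) ≤ 3 * m

  LowRank-mono : ∀ j {zs zs′} → zs′ ⊑* zs → LowRank j zs → LowRank j zs′
  LowRank-mono j zs′⊑ low f = ≤-trans (count-⊑ (inRank? j) (zs′⊑ f)) (low f)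

  diam : ∀ {C} → C ∈ Π → ∀ {x y} → x ∈ C → y ∈ C → d x y ≤ 4 * ƛ
  diam C∈ x∈ y∈ with piece-of C∈
  ... | c , _ , C∈c = diameter (cut-of c) (proj₁ (proj₂ c)) C∈c x∈ y∈

  head-of : ∀ {C} → C ∈ Π → ∃ λ r → head C ≡ just r × r ∈ C
  head-of {[]}    C∈ = contradiction (nonempty C∈) λ ()
  head-of {r ∷ _} _  = r , refl , here refl

  cross : ∀ {y z} → y ≡ z ⊎ Near y z → ∃ λ k → Free vt₀ y z k × k ≤ ƛ
  cross (inj₁ refl)          = 0 , [] , z≤n
  cross (inj₂ (free , le))   = _ , free , le

  -- The detour runs x, r, y, z, y′, r′, x′. The stars at both ends cost 4ƛ each, the gates at most
  -- d x z + 5ƛ and d z x′ + 5ƛ (a diameter and the rounding), and the two moves along the chain ƛ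
  -- each. The excess is 20ƛ.
  shortcut : ∀ {vt C C′ c x z x′ k} → (∀ {v} → v ∈ vt₀ → v ∈ vt) → C ∈ Π → C′ ∈ Π →
    (∀ i → i < D → Gate (C , c , i) vt) → (∀ i → i < D → Gate (C′ , c , i) vt) →
    x ∈ C → z ∈ points c → x′ ∈ C′ → d x z + d z x′ ≤ k → k ≤ reach →
    ∃ λ k′ → Free vt x x′ k′ × k′ ≤ k + slack
  shortcut {vt} {C} {C′} {c} {x} {z} {x′} {k} vt₀⊆ C∈ C′∈ gates gates′ x∈ z∈ x′∈ dxzx′≤ k≤
    with head-of C∈ | head-of C′∈
  ... | r , hr , r∈ | r′ , hr′ , r′∈ with round-up M (d r z) ƛ drz≤ | round-up M (d z r′) ƛ dzr′≤
    where
    M-bound : ∀ {a b} → a ≤ 4 * ƛ → b ≤ k → a + b ≤ M * ƛ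
    M-bound a≤ b≤ = ≤-trans (+-mono-≤ a≤ (≤-trans b≤ (≤-trans k≤ (≤-reflexive reach≡)))) (≤-reflexive
      (trans (sym (*-distribʳ-+ ƛ 4 (I + 20 * J))) (cong (_* ƛ) (sym (+-assoc 4 I (20 * J))))))
    drz≤ : d r z ≤ M * ƛ
    drz≤ = ≤-trans (triangle r x z) (M-bound (diam C∈ r∈ x∈) (m+n≤o⇒m≤o (d x z) dxzx′≤))
    dzr′≤ : d z r′ ≤ M * ƛ
    dzr′≤ = ≤-trans (triangle z x′ r′) (≤-trans (≤-reflexive (+-comm (d z x′) _))
      (M-bound (diam C′∈ x′∈ r′∈) (m+n≤o⇒n≤o (d x z) dxzx′≤)))
  ... | i , i≤ , drz≤iƛ , iƛ≤ | i′ , i′≤ , dzr′≤iƛ , i′ƛ≤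
    with proj₁ (gates i (≤-<-trans i≤ M<D) hr z∈) drz≤iƛ | proj₂ (gates′ i′ (≤-<-trans i′≤ M<D) hr′ z∈) dzr′≤iƛ
  ...   | y , ry∈ , dry≤ , yz | y′ , y′r′∈ , dy′r′≤ , zy′ with cross yz | cross (Sum.map₁ sym zy′)
  ...     | k₁ , free₁ , k₁≤ | k₂ , free₂ , k₂≤ =
    _ , pair (vt₀⊆ (proj₁ (starred C∈ hr x∈))) ▷ pair ry∈ ▷ weaken vt₀⊆ free₁ ▷ weaken vt₀⊆ free₂ ▷
        pair y′r′∈ ▷ pair (vt₀⊆ (proj₂ (starred C′∈ hr′ x′∈))) , (begin
      d x r + (d r y + (k₁ + (k₂ + (d y′ r′ + d r′ x′))))
        ≤⟨ +-mono-≤ (diam C∈ x∈ r∈) (+-mono-≤ (≤-trans dry≤ (≤-trans iƛ≤ (+-monoˡ-≤ ƛ (≤-trans (triangle r x z) (+-monoˡ-≤ _ (diam C∈ r∈ x∈))))))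
             (+-mono-≤ k₁≤ (+-mono-≤ k₂≤ (+-mono-≤ (≤-trans dy′r′≤ (≤-trans i′ƛ≤ (+-monoˡ-≤ ƛ (≤-trans (triangle z x′ r′) (+-monoʳ-≤ _ (diam C′∈ x′∈ r′∈))))))
               (diam C′∈ r′∈ x′∈))))) ⟩
      4 * ƛ + ((4 * ƛ + d x z + ƛ) + (ƛ + (ƛ + ((d z x′ + 4 * ƛ + ƛ) + 4 * ƛ))))
        ≡⟨ rearrange ƛ (d x z) (d z x′) ⟩
      d x z + d z x′ + 20 * ƛ
        ≤⟨ +-monoˡ-≤ (20 * ƛ) dxzx′≤ ⟩
      k + 20 * ƛ ≡⟨ cong (k +_) slack≡ ⟨
      k + slack ∎)
    where
    open ≤-Reasoning
    rearrange : ∀ l a b → 4 * l + ((4 * l + a + l) + (l + (l + ((b + 4 * l + l) + 4 * l)))) ≡ a + b + 20 * l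
    rearrange = solve-∀

  module _ {zs₂ : Points} (sparse : Sparse zs₂) where
    open Sparse sparse

    module LowerHits (j : ℕ) (vt : List (V × V)) (E : ℕ) (zs : Points) (vt₀⊆ : ∀ {v} → v ∈ vt₀ → v ∈ vt)
                      (E≤ : E + slack ≤ E-max) (zs⊑ : zs ⊑* zs₂) (live : Live vt E zs) where
      th : ∀ f → Thirds (inRank? j) m (zs f)
      th f = thirds (inRank? j) m (zs f)

      module Hit (part : ∀ f → List V) (part⊑ : ∀ f → part f ⊑ zs f) where
        hit : Σ (List (List V)) λ A → (∀ {C} → C ∈ A → C ∈ Π[ j ]) ×
              m * length A ≤ 2 * length Π[ j ] * (I * (3 * 2 ^ j)) * L ×
              (∀ f → m ≤ count (inRank? j) (part f) → ∃₂ λ C x → C ∈ A × x ∈ part f × x ∈ C)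
        hit = hit-lists fs complete L few Π[ j ] (λ C → _∈? C) part (λ _ → inRank? j) (I * (3 * 2 ^ j)) m 1≤m
          (λ f {C} C∈ → case ∈Π[]⁻ C∈ of λ { (C∈Π , refl) → piece-count C∈Π f (part f) (⊆-trans (part⊑ f) (zs⊑ f)) })
          (λ f x∈ inR → inR)

      module Front = Hit (λ f → Thirds.front (th f)) (λ f → front⊑ (th f))
      module Back = Hit (λ f → Thirds.back (th f)) (λ f → back⊑ (th f))

      middle-hit : Σ (List Chain) λ B → (∀ {c} → c ∈ B → c ∈ cs) ×
        m * length B ≤ 2 * length cs * (I * (7 * 2 ^ j)) * L ×
        (∀ f → m ≤ count (inRank? j) (Thirds.middle (th f)) →
           ∃₂ λ c x → c ∈ B × x ∈ Thirds.middle (th f) × (x ∈ points c × InRank j x))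
      middle-hit = hit-lists fs complete L few cs (λ c x → (x ∈? points c) ×-dec inRank? j x)
        (λ f → Thirds.middle (th f)) (λ _ → inRank? j) (I * (7 * 2 ^ j)) m 1≤m
        (λ f c∈ → rank-count c∈ j f _ (⊆-trans (middle⊑ (th f)) (zs⊑ f)))
        on-chain
        where
        on-chain : ∀ f {x} → x ∈ Thirds.middle (th f) → InRank j x → Any (λ c → x ∈ points c × InRank j x) cs
        on-chain f {x} _ inR with find inR
        ... | C , C∈ , x∈C with piece-of (proj₁ (∈Π[]⁻ {j} C∈))
        ...   | c , c∈ , C∈c = Any.map (λ { refl → subst (x ∈_) (concat-pieces (cut-of c)) (∈-concat⁺′ x∈C C∈c) , inR }) c∈

      A₁ A₂ : List (List V)
      A₁ = proj₁ Front.hit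
      A₂ = proj₁ Back.hit
      B : List Chain
      B = proj₁ middle-hit

      triples : List ((List V × Chain) × ℕ)
      triples = cartesianProduct (cartesianProduct (A₁ ++ A₂) B) (upTo D)

      opaque
        gates : Σ (List (V × V)) λ vt → length vt ≤ ∑ (λ _ → 2) triples ×
                (∀ {e} → e ∈ triples → Gate (proj₁ (proj₁ e) , proj₂ (proj₁ e) , proj₂ e) vt)
        gates = gather (λ e → Gate (proj₁ (proj₁ e) , proj₂ (proj₁ e) , proj₂ e))
          (λ e → Gate-mono (proj₁ (proj₁ e) , proj₂ (proj₁ e) , proj₂ e)) (λ _ → 2) triples
          (λ {e} e∈ → gate (proj₁ (proj₁ e)) (proj₁ (proj₂ middle-hit) (proj₂ (∈-cartesianProduct⁻ (A₁ ++ A₂) B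
             (proj₁ (∈-cartesianProduct⁻ (cartesianProduct (A₁ ++ A₂) B) (upTo D) e∈))))) (proj₂ e))

      new : List (V × V)
      new = proj₁ gates

      cost : m * m * m * length new ≤ gate-budget
      cost = begin
        m * m * m * length new                ≤⟨ *-monoʳ-≤ (m * m * m) (≤-trans (proj₁ (proj₂ gates)) (∑-≤-length triples (λ _ → ≤-refl))) ⟩
        m * m * m * (length triples * 2)      ≡⟨ cong (λ n → m * m * m * (n * 2)) size ⟩
        m * m * m * ((length A₁ + length A₂) * length B * D * 2)
          ≤⟨ gate-cost m (2 ^ j) (length A₁) (length A₂) (length B) (length Π[ j ]) (length cs) I L s D (m^n>0 2 j)
               (proj₁ (proj₂ (proj₂ Front.hit))) (proj₁ (proj₂ (proj₂ Back.hit))) (Π[]-few j)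
               (proj₁ (proj₂ (proj₂ middle-hit))) chains-few ⟩
        D * (336 * (I * L * s) * (I * L * s)) ≡⟨ gate-budget≡ ⟨
        gate-budget ∎
        where
        open ≤-Reasoning
        size : length triples ≡ (length A₁ + length A₂) * length B * D
        size = trans (length-cartesianProduct (cartesianProduct (A₁ ++ A₂) B) (upTo D))
          (cong₂ _*_ (trans (length-cartesianProduct (A₁ ++ A₂) B) (cong (_* length B) (length-++ A₁))) (length-upTo D))

      gated : ∀ {C c} → C ∈ A₁ ++ A₂ → c ∈ B → ∀ i → i < D → Gate (C , c , i) (new ++ vt)
      gated {C} {c} C∈ c∈ i i< = Gate-mono (C , c , i) ∈-++⁺ˡ (proj₂ (proj₂ gates)
        (∈-cartesianProduct⁺ (∈-cartesianProduct⁺ C∈ c∈) (∈-upTo⁺ i<)))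

      -- The cap `E-max` on the error enters here: trails stay within `reach`, so that all rounded
      -- distances are among the `D` values that have gates.
      length-bound : ∀ f {ℓ} → ℓ ≤ base f + E → ℓ ≤ reach
      length-bound f ℓ≤ = ≤-trans ℓ≤ (≤-trans (+-mono-≤ (base≤ f) (≤-trans (m≤m+n E _) E≤))
        (≤-reflexive (trans (cong (λ z → I * ƛ + J * z) slack≡) (trans (rearrange I J ƛ) (sym reach≡)))))
        where
        rearrange : ∀ I J l → I * l + J * (20 * l) ≡ (I + 20 * J) * l
        rearrange = solve-∀

      Result : F → Set
      Result f = ∃₂ λ zs′ ℓ′ → zs′ ⊑ zs f × Trail (new ++ vt) (src f) zs′ (tgt f) ℓ′ ×
        ℓ′ ≤ base f + (E + slack) × count (inRank? j) zs′ ≤ 3 * m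

      many : ∀ f {ℓ} → Trail vt (src f) (zs f) (tgt f) ℓ → ℓ ≤ base f + E →
        count (inRank? j) (Thirds.front (th f)) + count (inRank? j) (Thirds.back (th f)) ≤ 3 * m →
        (∃₂ λ C x → C ∈ A₁ × x ∈ Thirds.front (th f) × x ∈ C) →
        (∃₂ λ c z → c ∈ B × z ∈ Thirds.middle (th f) × (z ∈ points c × InRank j z)) →
        (∃₂ λ C′ x′ → C′ ∈ A₂ × x′ ∈ Thirds.back (th f) × x′ ∈ C′) → Result f
      many f {ℓ} p ℓ≤ both≤ (C , x , C∈A₁ , x∈front , x∈C) (c , z , c∈B , z∈middle , z∈c , _)
           (C′ , x′ , C′∈A₂ , x′∈back , x′∈C′) =
        let zs′ , ℓ′ , zs′⊑ , p′ , ℓ′≤ , count≤ = jump-thirds {e = slack} (th f) (∈-++⁺ʳ new) p x∈front x′∈back bypass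
        in zs′ , ℓ′ , zs′⊑ , p′ ,
           ≤-trans ℓ′≤ (≤-trans (+-monoˡ-≤ slack ℓ≤) (≤-reflexive (+-assoc (base f) E slack))) , ≤-trans count≤ both≤
        where
        bypass : ∀ {k} → k ≤ ℓ → d x x′ ≤ k → (∀ {z} → z ∈ Thirds.middle (th f) → d x z + d z x′ ≤ k) →
                 ∃ λ k′ → Free (new ++ vt) x x′ k′ × k′ ≤ k + slack
        bypass k≤ _ via-middle = shortcut {c = c} (∈-++⁺ʳ new ∘ vt₀⊆)
          (proj₁ (∈Π[]⁻ {j} (proj₁ (proj₂ Front.hit) C∈A₁))) (proj₁ (∈Π[]⁻ {j} (proj₁ (proj₂ Back.hit) C′∈A₂)))
          (gated {C} {c} (∈-++⁺ˡ C∈A₁) c∈B) (gated {C′} {c} (∈-++⁺ʳ A₁ C′∈A₂) c∈B)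
          x∈C z∈c x′∈C′ (via-middle z∈middle) (≤-trans k≤ (length-bound f ℓ≤))

      result : ∀ f → Result f
      result f with live f
      ... | ℓ , p , ℓ≤ = [ (λ few′ → zs f , ℓ , ⊆-refl , weaken (∈-++⁺ʳ new) p ,
                              ≤-trans ℓ≤ (+-monoʳ-≤ (base f) (m≤m+n E slack)) , few′)
                         , (λ (front≥ , middle≥ , back≥ , both≤) → many f p ℓ≤ both≤
                              (proj₂ (proj₂ (proj₂ Front.hit)) f front≥)
                              (proj₂ (proj₂ (proj₂ middle-hit)) f middle≥)
                              (proj₂ (proj₂ (proj₂ Back.hit)) f back≥)) ]′ (Thirds.few-or-many (th f))

    module Lower = Perform LowRank LowRank-mono (m * m * m) (λ _ → gate-budget) (slack) E-max vt₀ zs₂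

    lower : ∀ {j} → Lower.Task j
    lower {j} vt E zs vt₀⊆ E≤ zs⊑ live = new , (λ f → proj₁ (result f)) ,
      (λ f → proj₁ (proj₂ (proj₂ (result f)))) , cost ,
      (λ f → let _ , ℓ′ , _ , p , ℓ′≤ , _ = result f in ℓ′ , p , ℓ′≤) ,
      (λ f → proj₂ (proj₂ (proj₂ (proj₂ (proj₂ (result f))))))
      where open LowerHits j vt E zs vt₀⊆ E≤ zs⊑ live

  -- Saturation leaves fewer than m points off the chains for each of the I labels. A piece of rank
  -- j has at least 4^j points, so all ranks are below J because s < 4^J, and each rank contributes
  -- at most 3m points.
  few-points : ∀ {zs} → zs ⊑* zs₀ → (∀ {j} → j ∈ upTo J → LowRank j zs) →
               ∀ f → length (zs f) ≤ I * m + J * (3 * m)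
  few-points {zs} zs⊑ low f = begin
    length (zs f)
      ≡⟨ count-complement on-chain? (zs f) ⟨
    count on-chain? (zs f) + count (¬? ∘ on-chain?) (zs f)
      ≤⟨ +-mono-≤ on off ⟩
    J * (3 * m) + I * m
      ≡⟨ +-comm (J * (3 * m)) _ ⟩
    I * m + J * (3 * m) ∎
    where
    open ≤-Reasoning
    on-chain? : Decidable (_∈ concat (chains K))
    on-chain? = covered? (chains K)
    off : count (¬? ∘ on-chain?) (zs f) ≤ I * m
    off = count-by-label f (¬? ∘ on-chain?) (zs f) m (zs⊑ f) λ i i< →
      ≤-trans (count-⊑ (λ x → ¬? (on-chain? x) ×-dec (label f x ≟ i)) (zs⊑ f))
        (≤-trans (count-filter (¬? ∘ on-chain?) (λ x → label f x ≟ i) (zs₀ f))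
          (<⇒≤ (saturated (∈-cartesianProductWith⁺ class (complete f) (∈-upTo⁺ i<)))))
    ranked : ∀ {x} → x ∈ zs f → x ∈ concat (chains K) → Any (λ j → InRank j x) (upTo J)
    ranked {x} _ x∈ with ∈-concat⁻′ Π (subst (x ∈_) (sym concat-Π) x∈)
    ... | C , x∈C , C∈ = lose (∈-upTo⁺ rank<J) (lose (∈-filter⁺ (λ C′ → rank C′ ≟ rank C) C∈ refl) x∈C)
      where
      rank<J : rank C < J
      rank<J with rank C <? J
      ... | yes lt = lt
      ... | no ≮J = contradiction (≤-trans (≤-trans (^-monoʳ-≤ 4 (≮⇒≥ ≮J))
                      (4^log₄≤ (length C) (nonempty C∈))) (≤-trans (term≤∑ length C∈) Σ-pieces)) (<⇒≱ S<4^J)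
    on : count on-chain? (zs f) ≤ J * (3 * m)
    on = ≤-trans (count-cover on-chain? inRank? (upTo J) (zs f) ranked)
      (≤-trans (∑-≤-length (upTo J) (λ j∈ → low j∈ f)) (≤-reflexive (cong (_* (3 * m)) (length-upTo J))))


  pair-budget : ℕ
  pair-budget = m * m * m * ((3 + I * (16 * L * L)) * s) + J * gate-budget

  opaque
    stage₁ : Live [] 0 zs₀ → Σ (List (V × V)) λ vt → Σ Points λ zs →
      (∀ {v} → v ∈ vt₀ → v ∈ vt) × length vt ≤ 3 * s × zs ⊑* zs₀ × Live vt 0 zs ×
      (∀ {ci} → ci ∈ cartesianProduct cs (upTo I) → Confined ci zs)
    stage₁ live₀ =
      let tasks = cartesianProduct cs (upTo I)
          new , zs , zs⊑ , cost , live , confined =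
            Confine.perform tasks confine vt₀ 0 zs₀ id (≤-reflexive (*-zeroʳ (length tasks)))
              (λ _ → ⊆-refl) (λ f → let ℓ , p , ℓ≤ = live₀ f in ℓ , weaken (λ ()) p , ℓ≤)
      in new ++ vt₀ , zs , ∈-++⁺ʳ new ,
         ≤-trans (≤-reflexive (length-++ new)) (+-mono-≤ {length new} {0}
           (≤-trans (≤-reflexive (sym (*-identityˡ _))) (≤-trans cost (≤-reflexive (∑-zero tasks)))) vt₀-length) ,
         zs⊑ , subst (λ E → Live (new ++ vt₀) E zs) (*-zeroʳ (length tasks)) live , confined

    stage₂ : Live [] 0 zs₀ → Σ (List (V × V)) λ vt → Σ Points λ zs →
      (∀ {v} → v ∈ vt₀ → v ∈ vt) × length vt ≤ (3 + I * (16 * L * L)) * s × Live vt 0 zs × Sparse zs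
    stage₂ live₀ =
      let tasks = cartesianProduct Π (upTo I)
          vt₁ , zs₁ , vt₀⊆ , vt₁≤ , zs₁⊑ , live₁ , confined = stage₁ live₀
          new , zs , zs⊑ , cost , live , thinned =
            Thin.perform tasks thin vt₁ 0 zs₁ vt₀⊆ (≤-reflexive (*-zeroʳ (length tasks))) zs₁⊑ live₁
      in new ++ vt₁ , zs , ∈-++⁺ʳ new ∘ vt₀⊆ ,
         ≤-trans (≤-reflexive (length-++ new)) (≤-trans (+-mono-≤ (new≤ cost) vt₁≤)
           (≤-reflexive (trans (+-comm _ (3 * s)) (sym (*-distribʳ-+ s 3 (I * (16 * L * L))))))) ,
         subst (λ E → Live (new ++ vt₁) E zs) (*-zeroʳ (length tasks)) live ,
         record { sub = λ f → ⊆-trans (zs⊑ f) (zs₁⊑ f)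
                ; confined = λ {ci} ci∈ → Confined-mono ci zs⊑ (confined ci∈)
                ; thinned = thinned }
      where
      new≤ : ∀ {n} → 1 * n ≤ ∑ (λ Ci → length (proj₁ Ci) * (16 * L * L)) (cartesianProduct Π (upTo I)) →
             n ≤ I * (16 * L * L) * s
      new≤ {n} cost = begin
        n     ≡⟨ *-identityˡ n ⟨
        1 * n ≤⟨ cost ⟩
        ∑ (λ Ci → length (proj₁ Ci) * (16 * L * L)) (cartesianProduct Π (upTo I))
          ≡⟨ ∑-cartesianProduct (λ C → length C * (16 * L * L)) Π (upTo I) ⟩
        ∑ (λ C → length C * (16 * L * L)) Π * length (upTo I)
          ≤⟨ *-mono-≤ (≤-trans (∑-mono Π (λ {C} _ → ≤-reflexive (*-comm (length C) (16 * L * L))))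
               (≤-trans (≤-reflexive (∑-* (16 * L * L) length Π)) (*-monoʳ-≤ (16 * L * L) Σ-pieces)))
               (≤-reflexive (length-upTo I)) ⟩
        16 * L * L * s * I ≡⟨ rearrange (16 * L * L) s I ⟩
        I * (16 * L * L) * s ∎
        where
        open ≤-Reasoning
        rearrange : ∀ a s I → a * s * I ≡ I * a * s
        rearrange = solve-∀

    reduce-hops : Live [] 0 zs₀ → Σ (List (V × V)) λ vt → Σ Points λ zs →
      m * m * m * length vt ≤ pair-budget × Live vt E-max zs × zs ⊑* zs₀ ×
      (∀ f → length (zs f) ≤ I * m + J * (3 * m))
    reduce-hops live₀ =
      let vt₂ , zs₂ , vt₀⊆ , vt₂≤ , live₂ , sparse = stage₂ live₀
          new , zs , zs⊑ , cost , live , low =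
            Lower.perform sparse (upTo J) (λ _ → lower sparse) vt₂ 0 zs₂ vt₀⊆
              (≤-reflexive (cong (_* slack) (length-upTo J))) (λ _ → ⊆-refl) live₂
          zs⊑zs₀ = λ f → ⊆-trans (zs⊑ f) (Sparse.sub sparse f)
      in new ++ vt₂ , zs ,
         ≤-trans (≤-reflexive (trans (cong (m * m * m *_) (trans (length-++ new) (+-comm (length new) _)))
                    (*-distribˡ-+ (m * m * m) (length vt₂) (length new))))
           (+-mono-≤ (*-monoʳ-≤ (m * m * m) vt₂≤) (≤-trans cost (≤-trans (∑-≤-length (upTo J) (λ _ → ≤-refl))
             (≤-reflexive (cong (_* gate-budget) (length-upTo J)))))) ,
         subst (λ n → Live (new ++ vt₂) (n * slack) zs) (length-upTo J) live ,
         zs⊑zs₀ , few-points zs⊑zs₀ low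

    hop-reduction : Live [] 0 zs₀ → Σ (List (V × V)) λ vt → m * m * m * length vt ≤ budget m I J L s ×
      (∀ f → ∃₂ λ zs ℓ → Trail vt (src f) zs (tgt f) ℓ × ℓ ≤ base f + J * (20 * ƛ) × length zs ≤ I * m + J * (3 * m))
    hop-reduction live₀ =
      let vt , zs , vt≤ , live , _ , few = reduce-hops live₀
      in vt , ≤-trans vt≤ (≤-reflexive (trans (cong (λ b → m * m * m * ((3 + I * (16 * L * L)) * s) + J * b)
           (trans gate-budget≡ (cong (λ k → k * (336 * (I * L * s) * (I * L * s))) D≡))) (sym (budget≡ m I J L s)))) ,
         λ f → let ℓ , p , ℓ≤ = live f
               in zs f , ℓ , p , ≤-trans ℓ≤ (≤-reflexive (cong (λ e → base f + J * e) slack≡)) , few f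

-- Walks, shortest walks and distances.

minimum : {A : Set} (f : A → ℕ) (x : A) (xs : List A) →
          ∃ λ y → y ∈ x ∷ xs × (∀ {z} → z ∈ x ∷ xs → f y ≤ f z)
minimum f x [] = x , here refl , λ { (here refl) → ≤-refl }
minimum f x (x′ ∷ xs) with minimum f x′ xs
... | y , y∈ , min with f x ≤? f y
...   | yes x≤y = x , here refl , λ { (here refl) → ≤-refl ; (there z∈) → ≤-trans x≤y (min z∈) }
...   | no  x≰y = y , there y∈ , λ { (here refl) → <⇒≤ (≰⇒> x≰y) ; (there z∈) → min z∈ }

length-allFin : ∀ n → length (allFin n) ≡ n
length-allFin n = length-tabulate id

module Walks {n : ℕ} (G : WeightedDigraph n) where

  hops : ∀ {u v} → Walk G u v → ℕ
  hops []      = 0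
  hops (_ ∷ w) = suc (hops w)

  infixr 5 _⊕_
  _⊕_ : ∀ {u v x} → Walk G u v → Walk G v x → Walk G u x
  []      ⊕ q = q
  (e ∷ p) ⊕ q = e ∷ (p ⊕ q)

  walkLength-⊕ : ∀ {u v x} (p : Walk G u v) (q : Walk G v x) → walkLength (p ⊕ q) ≡ walkLength p + walkLength q
  walkLength-⊕ []      q = refl
  walkLength-⊕ (_∷_ {u} {v} e p) q = trans (cong (weight G u v +_) (walkLength-⊕ p q))
    (sym (+-assoc (weight G u v) _ _))

  later : ∀ {u v} → Walk G u v → List (Fin n)
  later []                  = []
  later (_∷_ {v = v} _ w)   = v ∷ later w

  vertices : ∀ {u v} → Walk G u v → List (Fin n)
  vertices {u} w = u ∷ later w

  length-later : ∀ {u v} (w : Walk G u v) → length (later w) ≡ hops w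
  length-later []      = refl
  length-later (_ ∷ w) = cong suc (length-later w)

  suffix : ∀ {u v x} (w : Walk G u v) → x ∈ vertices w →
           Σ (Walk G x v) λ w′ → vertices w′ ⊑ vertices w × walkLength w′ ≤ walkLength w
  suffix w       (here refl) = w , ⊆-refl , ≤-refl
  suffix (_∷_ {u} {v} _ w) (there x∈) with suffix w x∈
  ... | w′ , sub , le = w′ , (u ∷ʳ sub) , ≤-trans le (m≤n+m _ (weight G u v))
  suffix []      (there ())

  open import Data.List.Membership.DecPropositional (Finₚ._≟_ {n}) using (_∈?_)

  simplify : ∀ {u v} (w : Walk G u v) → Σ (Walk G u v) λ w′ → Unique (vertices w′) × walkLength w′ ≤ walkLength w
  simplify []      = [] , [] ∷ [] , ≤-refl
  simplify (_∷_ {u} {v} e w) with simplify w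
  ... | w′ , uniq , le with u ∈? vertices w′
  ...   | yes u∈ with suffix w′ u∈
  ...     | w″ , sub , le′ = w″ , AllPairs-resp-⊑ sub uniq ,
    ≤-trans le′ (≤-trans le (m≤n+m _ (weight G u v)))
  simplify (_∷_ {u} {v} e w) | w′ , uniq , le | no u∉ = e ∷ w′ ,
    All.tabulate (λ x∈ eq → u∉ (subst (_∈ vertices w′) (sym eq) x∈)) ∷ uniq , +-monoʳ-≤ (weight G u v) le

  Unique-≤n : {xs : List (Fin n)} → Unique xs → length xs ≤ n
  Unique-≤n uniq = ≤-trans (Unique-length uniq (λ {x} _ → ∈-allFin x)) (≤-reflexive (length-allFin n))

  simple-hops : ∀ {u v} (w : Walk G u v) → Unique (vertices w) → hops w ≤ n
  simple-hops w uniq = ≤-trans (n≤1+n _) (subst (λ k → suc k ≤ n) (length-later w) (Unique-≤n uniq))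

  Minimal : ∀ {u v} → Walk G u v → Set
  Minimal {u} {v} w = ∀ (q : Walk G u v) → walkLength w ≤ walkLength q

  -- The invariant of a Bellman-Ford recursion. Only the competitors `q` are limited to `k` hops; no
  -- such limit is recorded for the walk itself.
  Best : ℕ → Fin n → Fin n → Set
  Best k u v = (Σ (Walk G u v) λ w → ∀ (q : Walk G u v) → hops q ≤ k → walkLength w ≤ walkLength q) ⊎
               (∀ (q : Walk G u v) → ¬ hops q ≤ k)

  best : ∀ k u v → Best k u v
  best zero u v with u Finₚ.≟ v
  ... | yes refl = inj₁ ([] , λ { [] _ → z≤n ; (_ ∷ _) () })
  ... | no u≢v   = inj₂ λ { [] _ → u≢v refl ; (_ ∷ _) () }
  best (suc k) u v = choose candidates refl
    where
    trivial : List (Walk G u v)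
    trivial with u Finₚ.≟ v
    ... | yes refl = [] ∷ []
    ... | no _     = []
    via-vertex : Fin n → List (Walk G u v)
    via-vertex x with combine u x Subsetₚ.∈? edges G | best k x v
    ... | yes e | inj₁ (w , _) = (e ∷ w) ∷ []
    ... | _     | _            = []
    candidates : List (Walk G u v)
    candidates = trivial ++ concatMap via-vertex (allFin n)
    better : (q : Walk G u v) → hops q ≤ suc k → ∃ λ w → w ∈ candidates × walkLength w ≤ walkLength q
    better [] _ = [] , ∈-++⁺ˡ trivial∈ , z≤n
      where
      trivial∈ : [] ∈ trivial
      trivial∈ with u Finₚ.≟ u
      ... | yes refl = here refl
      ... | no u≢u   = contradiction refl u≢u
    better (_∷_ {v = x} e q) (s≤s le) with via∈
      where
      via∈ : ∃ λ w → w ∈ via-vertex x × walkLength w ≤ walkLength (e ∷ q)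
      via∈ with combine u x Subsetₚ.∈? edges G | best k x v
      ... | yes e′ | inj₁ (w , min) = e′ ∷ w , here refl , +-monoʳ-≤ (weight G u x) (min q le)
      ... | yes _  | inj₂ none      = contradiction le (none q)
      ... | no ¬e  | inj₁ _         = contradiction e ¬e
      ... | no ¬e  | inj₂ _         = contradiction e ¬e
    ... | w , w∈ , w≤ = w , ∈-++⁺ʳ trivial (∈-concat⁺′ w∈ (∈-map⁺ via-vertex (∈-allFin x))) , w≤
    choose : ∀ ws → ws ≡ candidates → Best (suc k) u v
    choose [] eq = inj₂ λ q le → case better q le of λ { (w , w∈ , _) → case subst (w ∈_) (sym eq) w∈ of λ () }
    choose (w ∷ ws) eq with minimum walkLength w ws
    ... | y , _ , min = inj₁ (y , λ q le → case better q le of λ { (w′ , w′∈ , w′≤) →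
      ≤-trans (min (subst (w′ ∈_) (sym eq) w′∈)) w′≤ })

  opaque
    -- Removing cycles does not lengthen a walk and leaves at most n hops, so the best walk against
    -- n hops is the best against all. Reachability is decided on the way.
    shortest : ∀ u v → (Σ (Walk G u v) Minimal) ⊎ ¬ Walk G u v
    shortest u v with best n u v
    ... | inj₁ (w , min) = inj₁ (w , λ q → let q′ , uniq , le = simplify q in
      ≤-trans (min q′ (simple-hops q′ uniq)) le)
    ... | inj₂ none = inj₂ λ q → let q′ , uniq , _ = simplify q in none q′ (simple-hops q′ uniq)

  length≤ : ∀ {b} → WeightsAtMost G b → ∀ {u v} (w : Walk G u v) → walkLength w ≤ hops w * b
  length≤ le []                  = z≤n
  length≤ le (_∷_ {u} {v} e w)   = +-mono-≤ (le u v e) (length≤ le w)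

  hops≤length : PositiveWeights G → ∀ {u v} (w : Walk G u v) → hops w ≤ walkLength w
  hops≤length pos []                = z≤n
  hops≤length pos (_∷_ {u} {v} e w) = +-mono-≤ (pos u v e) (hops≤length pos w)

-- The distance, truncated at a bound that exceeds every finite distance.
module Distance {n : ℕ} (G : WeightedDigraph n) (W : ℕ) (weights≤ : WeightsAtMost G W) where

  open Walks G

  -- Finite distances are at most nW. The factor 2 leaves room for stretched routes, whose length is
  -- at most (1 + 1/N)nW ≤ 2nW: a route shorter than `∞` contains only virtual pairs at finite
  -- distance.
  ∞ : ℕ
  ∞ = suc (2 * (n * W))

  opaque
    d : Fin n → Fin n → ℕ
    d u v with shortest u v
    ... | inj₁ (w , _) = walkLength w
    ... | inj₂ _       = ∞

    d≤walk : ∀ {u v} (w : Walk G u v) → d u v ≤ walkLength w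
    d≤walk {u} {v} w with shortest u v
    ... | inj₁ (_ , min) = min w
    ... | inj₂ none      = contradiction w none

    d-attained : ∀ u v → (Σ (Walk G u v) λ w → walkLength w ≡ d u v × d u v ≤ n * W) ⊎ (¬ Walk G u v × d u v ≡ ∞)
    d-attained u v with shortest u v
    ... | inj₂ none      = inj₂ (none , refl)
    ... | inj₁ (w , min) = inj₁ (w , refl , (let w′ , uniq , _ = simplify w in
      ≤-trans (min w′) (≤-trans (length≤ weights≤ w′) (*-monoˡ-≤ W (simple-hops w′ uniq)))))

  d≤∞ : ∀ u v → d u v ≤ ∞
  d≤∞ u v with d-attained u v
  ... | inj₁ (_ , _ , le) = ≤-trans le (≤-trans (m≤m+n (n * W) _) (n≤1+n _))
  ... | inj₂ (_ , eq)     = ≤-reflexive eq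

  d-refl : ∀ x → d x x ≡ 0
  d-refl x = n≤0⇒n≡0 (d≤walk {x} {x} [])

  triangle : ∀ x y z → d x z ≤ d x y + d y z
  triangle x y z with d-attained x y | d-attained y z
  ... | inj₂ (_ , eq) | _ = ≤-trans (d≤∞ x z) (≤-trans (≤-reflexive (sym eq)) (m≤m+n _ _))
  ... | inj₁ _ | inj₂ (_ , eq) = ≤-trans (d≤∞ x z) (≤-trans (≤-reflexive (sym eq)) (m≤n+m _ (d x y)))
  ... | inj₁ (p , p≡ , _) | inj₁ (q , q≡ , _) = ≤-trans (d≤walk (p ⊕ q))
    (≤-reflexive (trans (walkLength-⊕ p q) (cong₂ _+_ p≡ q≡)))

  walk-of : ∀ {u v} → d u v < ∞ → Σ (Walk G u v) λ w → walkLength w ≡ d u v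
  walk-of {u} {v} lt with d-attained u v
  ... | inj₁ (w , eq , _) = w , eq
  ... | inj₂ (_ , eq)     = contradiction lt (<-irrefl eq)

  walk-bounded : ∀ {u v} → Walk G u v → d u v ≤ n * W
  walk-bounded {u} {v} w with d-attained u v
  ... | inj₁ (_ , _ , le) = le
  ... | inj₂ (none , _)   = contradiction w none

-- Trails that realise distances.

module Straight {V : Set} (d : V → V → ℕ) (d-refl : ∀ x → d x x ≡ 0)
                (triangle : ∀ x y z → d x z ≤ d x y + d y z)
                (Step : V → V → ℕ → Set) (d≤step : ∀ {x y k} → Step x y k → d x y ≤ k) where

  open Trails d d-refl triangle Step d≤step
  open Jumps d d-refl triangle Step d≤step

  -- By k + ℓ ≤ d a v, the trail continues a shortest connection from `a`. Adding the remaining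
  -- distance d z v to both sides turns the claim into this optimality and a triangle inequality.
  straight : ∀ {vt x zs v ℓ} → Trail vt x zs v ℓ → ∀ a k → d a x ≤ k → k + ℓ ≤ d a v →
             AllPairs (λ y z → d a y + d y z ≤ d a z) zs
  straight []                         a k _    _  = []
  straight {v = v} p@(step {x} {y} {zs = zs} {k = k′} s q) a k dax≤ le =
    All.tabulate onward ∷ straight q a (k + k′) (≤-trans (triangle a x y) (+-mono-≤ dax≤ (d≤step s)))
                            (≤-trans (≤-reflexive (+-assoc k k′ _)) le)
    where
    onward : ∀ {z} → z ∈ zs → d a x + d x z ≤ d a z
    onward {z} z∈ = +-cancelʳ-≤ (d z v) _ _ (begin
      d a x + d x z + d z v   ≡⟨ +-assoc (d a x) _ _ ⟩
      d a x + (d x z + d z v) ≤⟨ +-mono-≤ dax≤ (via p (there z∈)) ⟩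
      k + _                   ≤⟨ le ⟩
      d a v                   ≤⟨ triangle a z v ⟩
      d a z + d z v           ∎)
      where open ≤-Reasoning
  straight (virt {x} {y} _ q)         a k dax≤ le =
    straight q a (k + d x y) (≤-trans (triangle a x y) (+-monoˡ-≤ (d x y) dax≤))
      (≤-trans (≤-reflexive (+-assoc k (d x y) _)) le)

  geodesic-trail : ∀ {vt x zs v ℓ} → Trail vt x zs v ℓ → ℓ ≤ d x v → Geodesic d zs
  geodesic-trail []                              _  = []
  geodesic-trail {v = v} p@(step {x} {y} {k = k} s q) le with straight p x 0 (≤-reflexive (d-refl x)) le
  ... | _ ∷ rest = rest ∷ geodesic-trail q (+-cancelˡ-≤ k _ _
    (≤-trans le (≤-trans (triangle x y v) (+-monoˡ-≤ (d y v) (d≤step s)))))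
  geodesic-trail {v = v} (virt {x} {y} _ q)      le =
    geodesic-trail q (+-cancelˡ-≤ (d x y) _ _ (≤-trans le (triangle x y v)))

-- Routes of real and virtual edges, and the points of a hitting set on a path.

module Scaling {n : ℕ} (G : WeightedDigraph n) (W : ℕ) (weights≤ : WeightsAtMost G W) where

  open Walks G
  open Distance G W weights≤
  open import Data.List.Membership.DecPropositional (Finₚ._≟_ {n}) using (_∈?_)

  data Route (E vt : List (Fin n × Fin n)) : Fin n → Fin n → ℕ → Set where
    []   : ∀ {u} → Route E vt u u 0
    edge : ∀ {u v x ℓ} → Edge G u v → (u , v) ∈ E → Route E vt v x ℓ → Route E vt u x (weight G u v + ℓ)
    virt : ∀ {u v x ℓ} → (u , v) ∈ vt → Route E vt v x ℓ → Route E vt u x (d u v + ℓ)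

  Route-mono : ∀ {E E′ vt vt′ u v ℓ} → (∀ {e} → e ∈ E → e ∈ E′) → (∀ {e} → e ∈ vt → e ∈ vt′) →
               Route E vt u v ℓ → Route E′ vt′ u v ℓ
  Route-mono i j []             = []
  Route-mono i j (edge g e r)   = edge g (i e) (Route-mono i j r)
  Route-mono i j (virt v r)     = virt (j v) (Route-mono i j r)

  edge-list : ∀ {u v} → Walk G u v → List (Fin n × Fin n)
  edge-list []                    = []
  edge-list (_∷_ {u} {v} _ w)     = (u , v) ∷ edge-list w

  length-edge-list : ∀ {u v} (w : Walk G u v) → length (edge-list w) ≡ hops w
  length-edge-list []      = refl
  length-edge-list (_ ∷ w) = cong suc (length-edge-list w)

  follow : ∀ {E vt u v x ℓ} (w : Walk G u v) → (∀ {e} → e ∈ edge-list w → e ∈ E) → Route E vt v x ℓ →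
           Route E vt u x (walkLength w + ℓ)
  follow []      _ r = r
  follow (_∷_ {u} {v} e w) i r = subst (Route _ _ _ _) (sym (+-assoc (weight G u v) _ _))
    (edge e (i (here refl)) (follow w (i ∘ there) r))

  simple-shortest : ∀ {u v} → d u v < ∞ → Σ (Walk G u v) λ w → Unique (vertices w) × walkLength w ≡ d u v
  simple-shortest lt with walk-of lt
  ... | w , eq with simplify w
  ...   | w′ , uniq , le = w′ , uniq , ≤-antisym (≤-trans le (≤-reflexive eq)) (d≤walk w′)

  module Stretched (h : ℕ) where

    -- A step stands for up to `h` real edges, so the number of points of a trail times `h` bounds
    -- the edges that it needs.
    Step : Fin n → Fin n → ℕ → Set
    Step x y k = Σ (Walk G x y) λ w → hops w ≤ h × walkLength w ≡ k

    d≤step : ∀ {x y k} → Step x y k → d x y ≤ k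
    d≤step (w , _ , refl) = d≤walk w

    open Trails d d-refl triangle Step d≤step public

    trail-route : ∀ {vt x zs y ℓ} → Trail vt x zs y ℓ →
                  ∃ λ E → length E ≤ length zs * h × Route E vt x y ℓ
    trail-route [] = [] , z≤n , []
    trail-route (virt v p) with trail-route p
    ... | E , le , r = E , le , virt v r
    trail-route (step (w , w≤h , refl) p) with trail-route p
    ... | E , le , r = edge-list w ++ E ,
      ≤-trans (≤-reflexive (length-++ (edge-list w))) (+-mono-≤ (≤-trans (≤-reflexive (length-edge-list w)) w≤h) le) ,
      follow w ∈-++⁺ˡ (Route-mono (∈-++⁺ʳ (edge-list w)) id r)

    stretches : ∀ {u v} → Walk G u v → List (List (Fin n))
    stretches []      = []
    stretches (_ ∷ w) with h ≤? length (vertices w)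
    ... | yes _ = take h (vertices w) ∷ stretches w
    ... | no  _ = stretches w

    length-stretches : ∀ {u v} (w : Walk G u v) → length (stretches w) ≤ hops w
    length-stretches []      = z≤n
    length-stretches (_ ∷ w) with h ≤? length (vertices w)
    ... | yes _ = s≤s (length-stretches w)
    ... | no  _ = m≤n⇒m≤1+n (length-stretches w)

    stretch-shape : ∀ {u v} (w : Walk G u v) → Unique (vertices w) → ∀ {xs} → xs ∈ stretches w →
                    Unique xs × length xs ≡ h
    stretch-shape []      _         ()
    stretch-shape (_ ∷ w) (_ ∷ uniq) xs∈ with h ≤? length (vertices w)
    stretch-shape (_ ∷ w) (_ ∷ uniq) (here refl) | yes le =
      Uniqueₚ.take⁺ h uniq , trans (length-take h (vertices w)) (m≤n⇒m⊓n≡m le)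
    stretch-shape (_ ∷ w) (_ ∷ uniq) (there xs∈) | yes le = stretch-shape w uniq xs∈
    stretch-shape (_ ∷ w) (_ ∷ uniq) xs∈         | no _   = stretch-shape w uniq xs∈

    -- The walk `first` leads to the first point of `S` after the start, or to `v` if there is none,
    -- and the trail begins there. The vertices in `avoided` are kept only to bound the hops of
    -- `first`.
    record Decomposition (S : List (Fin n)) {u v : Fin n} (w : Walk G u v) : Set where
      field
        {origin}    : Fin n
        first       : Walk G u origin
        {points}    : List (Fin n)
        {len}       : ℕ
        trail       : Trail [] origin points v len
        total       : walkLength first + len ≡ walkLength w
        points⊑     : points ⊑ later w
        points∈S    : ∀ {x} → x ∈ points → x ∈ S
        avoided rest : List (Fin n)
        avoid       : later w ≡ avoided ++ rest
        avoided∉S   : ∀ {x} → x ∈ avoided → x ∉ S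
        first-hops  : hops first ≤ suc (length avoided)

    module _ (S : List (Fin n)) (1≤h : 1 ≤ h) where

      Hits : ∀ {u v} → Walk G u v → Set
      Hits w = ∀ {xs} → xs ∈ stretches w → ∃ λ x → x ∈ xs × x ∈ S

      -- If `h` vertices were avoided, the first `h` vertices after the start would be a stretch
      -- that `S` misses.
      first≤h : ∀ {u v} (w : Walk G u v) → Hits w → (D : Decomposition S w) →
                hops (Decomposition.first D) ≤ h
      first≤h w hits D with h ≤? length (Decomposition.avoided D)
      ... | no  h≰ = ≤-trans (Decomposition.first-hops D) (≰⇒> h≰)
      ... | yes h≤ = ⊥-elim (impossible w hits (Decomposition.avoided D) (Decomposition.avoid D) h≤ (Decomposition.avoided∉S D))
        where
        take-++ : ∀ k (xs {ys} : List (Fin n)) → k ≤ length xs → ∀ {x} → x ∈ take k (xs ++ ys) → x ∈ xs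
        take-++ (suc k) (x ∷ xs) (s≤s le) (here refl) = here refl
        take-++ (suc k) (x ∷ xs) (s≤s le) (there x∈)  = there (take-++ k xs le x∈)
        impossible : ∀ {u v} (w : Walk G u v) → Hits w → ∀ as {bs} → later w ≡ as ++ bs → h ≤ length as →
                     (∀ {x} → x ∈ as → x ∉ S) → ⊥
        impossible [] _ [] _ h≤ _ = contradiction (≤-trans 1≤h h≤) λ ()
        impossible (_ ∷ w) hits as {bs} eq h≤ as∉S with h ≤? length (vertices w)
        ... | no h≰ = h≰ (≤-trans h≤ (≤-trans (m≤m+n _ (length bs))
                        (≤-reflexive (sym (trans (cong length eq) (length-++ as))))))
        ... | yes _ with hits (here refl)
        ...   | x , x∈ , x∈S = as∉S (take-++ h as h≤ (subst (λ zs → x ∈ take h zs) eq x∈)) x∈S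

      tail-hits : ∀ {u v x} {e : Edge G u v} {w : Walk G v x} → Hits (e ∷ w) → Hits w
      tail-hits {w = w} hits xs∈ with h ≤? length (vertices w)
      ... | yes _ = hits (there xs∈)
      ... | no  _ = hits xs∈

      decompose : ∀ {u v} (w : Walk G u v) → Hits w → Decomposition S w
      decompose [] _ = record
        { first = [] ; trail = [] ; total = refl ; points⊑ = [] ; points∈S = λ () ; avoided = [] ; rest = []
        ; avoid = refl ; avoided∉S = λ () ; first-hops = z≤n }
      decompose (_∷_ {u} {x} e w) hits with x ∈? S | decompose w (tail-hits {e = e} hits)
      ... | no x∉S | D = record
        { first = e ∷ first ; trail = trail ; total = trans (+-assoc (weight G u x) _ _) (cong (weight G u x +_) total)
        ; points⊑ = x ∷ʳ points⊑ ; points∈S = points∈S ; avoided = x ∷ avoided ; rest = rest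
        ; avoid = cong (x ∷_) avoid ; avoided∉S = λ { (here refl) → x∉S ; (there y∈) → avoided∉S y∈ }
        ; first-hops = s≤s first-hops }
        where open Decomposition D
      ... | yes x∈S | D = record
        { first = e ∷ [] ; trail = step (first , first≤h w (tail-hits {e = e} hits) D , refl) trail
        ; total = cong₂ _+_ (+-identityʳ (weight G u x)) total
        ; points⊑ = refl ∷ points⊑ ; points∈S = λ { (here refl) → x∈S ; (there y∈) → points∈S y∈ }
        ; avoided = [] ; rest = x ∷ later w ; avoid = refl ; avoided∉S = λ () ; first-hops = s≤s z≤n }
        where open Decomposition D

-- Hop reduction for demand pairs at distance below Iƛ.

module OneScale {n : ℕ} (G : WeightedDigraph n) (W : ℕ) (weights≤ : WeightsAtMost G W)
                (h : ℕ) (1≤h : 1 ≤ h) (ƛ : ℕ) .{{_ : NonZero ƛ}} (I J L m : ℕ) (1≤m : 1 ≤ m) (n<4^J : n < 4 ^ J)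
                (Ps : List (Fin n × Fin n)) (|Ps|n<2^L : length Ps * n < 2 ^ L) (|Ps|<2^L : length Ps < 2 ^ L)
                (reachable : ∀ {uv} → uv ∈ Ps → Distance.d G W weights≤ (proj₁ uv) (proj₂ uv) < Distance.∞ G W weights≤)
                (near : ∀ {uv} → uv ∈ Ps → Distance.d G W weights≤ (proj₁ uv) (proj₂ uv) < I * ƛ) where

  open Walks G
  open Distance G W weights≤
  open Scaling G W weights≤
  open Stretched h
  open import Data.List.Membership.DecPropositional (Finₚ._≟_ {n}) using (_∈?_)

  F : Set
  F = Fin (length Ps)

  from to : F → Fin n
  from f = proj₁ (lookup Ps f)
  to   f = proj₂ (lookup Ps f)

  opaque
    path : ∀ f → Σ (Walk G (from f) (to f)) λ w → Unique (vertices w) × walkLength w ≡ d (from f) (to f)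
    path f = simple-shortest (reachable (∈-lookup f))

  walk : ∀ f → Walk G (from f) (to f)
  walk f = proj₁ (path f)

  all-stretches : List (List (Fin n))
  all-stretches = concatMap (λ f → stretches (walk f)) (allFin (length Ps))

  stretch-of : ∀ {xs} → xs ∈ all-stretches → ∃ λ f → xs ∈ stretches (walk f)
  stretch-of xs∈ with ∈-concat⁻′ (map (λ f → stretches (walk f)) (allFin (length Ps))) xs∈
  ... | _ , xs∈ys , ys∈ with ∈-map⁻ (λ f → stretches (walk f)) ys∈
  ...   | f , _ , refl = f , xs∈ys

  all-stretches-few : length all-stretches < 2 ^ L
  all-stretches-few = ≤-<-trans (begin
    length all-stretches
      ≡⟨ length-concat (map (λ f → stretches (walk f)) (allFin (length Ps))) ⟩
    ∑ length (map (λ f → stretches (walk f)) (allFin (length Ps)))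
      ≤⟨ ∑-≤-length (map (λ f → stretches (walk f)) (allFin (length Ps))) each ⟩
    length (map (λ f → stretches (walk f)) (allFin (length Ps))) * n
      ≡⟨ cong (_* n) (trans (length-map (λ f → stretches (walk f)) (allFin (length Ps))) (length-allFin (length Ps))) ⟩
    length Ps * n ∎) |Ps|n<2^L
    where
    open ≤-Reasoning
    each : ∀ {xss} → xss ∈ map (λ f → stretches (walk f)) (allFin (length Ps)) → length xss ≤ n
    each xss∈ with ∈-map⁻ (λ f → stretches (walk f)) xss∈
    ... | f , _ , refl = ≤-trans (length-stretches (walk f)) (simple-hops (walk f) (proj₁ (proj₂ (path f))))

  opaque
    hitting : Σ (List (Fin n)) λ A → (∀ {x} → x ∈ A → x ∈ allFin n) × h * length A ≤ 2 * length (allFin n) * 1 * L ×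
              (∀ g → h ≤ count (_∈? lookup all-stretches g) (lookup all-stretches g) →
                ∃₂ λ e x → e ∈ A × x ∈ lookup all-stretches g × e ≡ x)
    hitting = hit-lists (allFin (length all-stretches)) ∈-allFin L
      (subst (_< 2 ^ L) (sym (length-allFin (length all-stretches))) all-stretches-few) (allFin n) Finₚ._≟_
      (lookup all-stretches) (λ g → _∈? lookup all-stretches g) 1 h 1≤h
      (λ g {e} _ → let f , xs∈ = stretch-of (∈-lookup g)
                   in Unique-count Finₚ._≟_ e (proj₁ (stretch-shape (walk f) (proj₁ (proj₂ (path f))) xs∈)))
      (λ g {x} _ _ → Any.map sym (∈-allFin x))

  A : List (Fin n)
  A = proj₁ hitting

  -- Filtering all vertices removes possible repetitions from `A`; the bound of |S| by n, and hence
  -- by 4^J, depends on this.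
  S : List (Fin n)
  S = filter (_∈? A) (allFin n)

  S-unique : Unique S
  S-unique = Uniqueₚ.filter⁺ (_∈? A) (Uniqueₚ.allFin⁺ n)

  h*S≤ : h * length S ≤ 2 * n * L
  h*S≤ = begin
    h * length S            ≤⟨ *-monoʳ-≤ h (Unique-length S-unique (λ x∈ → proj₂ (∈-filter⁻ (_∈? A) {xs = allFin n} x∈))) ⟩
    h * length A            ≤⟨ proj₁ (proj₂ (proj₂ hitting)) ⟩
    2 * length (allFin n) * 1 * L ≡⟨ cong (_* L) (trans (*-identityʳ _) (cong (2 *_) (length-allFin n))) ⟩
    2 * n * L               ∎
    where open ≤-Reasoning

  hits : ∀ f → Hits S 1≤h (walk f)
  hits f {xs} xs∈ with stretch-shape (walk f) (proj₁ (proj₂ (path f))) xs∈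
  ... | _ , |xs|≡h with Any.index xs∈all | lookup-index xs∈all
    where
    xs∈all : xs ∈ all-stretches
    xs∈all = ∈-concat⁺′ xs∈ (∈-map⁺ (λ f → stretches (walk f)) (∈-allFin f))
  ...   | g | refl with proj₂ (proj₂ (proj₂ hitting)) g (≤-reflexive (trans (sym |xs|≡h)
                          (cong length (sym (filter-all (_∈? lookup all-stretches g) (All.tabulate id))))))
  ...     | e , x , e∈A , x∈ , refl = x , x∈ , ∈-filter⁺ (_∈? A) (∈-allFin x) e∈A

  opaque
    parts : ∀ f → Decomposition S (walk f)
    parts f = decompose S 1≤h (walk f) (hits f)

  open module Part f = Decomposition (parts f) using (origin; first; points; len; trail; total; points⊑; points∈S)

  first≤ : ∀ f → hops (first f) ≤ h
  first≤ f = first≤h S 1≤h (walk f) (hits f) (parts f)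

  path-length : ∀ f → walkLength (first f) + len f ≡ d (from f) (to f)
  path-length f = trans (total f) (proj₂ (proj₂ (path f)))

  len≤ : ∀ f → len f ≤ d (origin f) (to f)
  len≤ f = +-cancelˡ-≤ (walkLength (first f)) _ _ (≤-trans (≤-reflexive (path-length f))
    (≤-trans (triangle (from f) (origin f) (to f)) (+-monoˡ-≤ _ (d≤walk (first f)))))

  len<Iƛ : ∀ f → len f < I * ƛ
  len<Iƛ f = ≤-<-trans (≤-trans (m≤n+m (len f) _) (≤-reflexive (path-length f))) (near (∈-lookup f))

  open Straight d d-refl triangle Step d≤step
  open Jumps d d-refl triangle Step d≤step using (via)

  label : F → Fin n → ℕ
  label f x = d (origin f) x / ƛ

  label< : ∀ f {x} → x ∈ points f → label f x < I
  label< f x∈ = m<n*o⇒m/o<n (≤-<-trans (≤-trans (m≤m+n _ _) (via (trail f) x∈)) (len<Iƛ f))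

  -- Along a shortest path the distances from the origin add up, so two points with the same
  -- quotient by ƛ differ by at most ƛ.
  close : ∀ f → AllPairs (λ x y → label f x ≡ label f y → d x y ≤ ƛ) (points f)
  close f = AllPairs.map same (straight (trail f) (origin f) 0 (≤-reflexive (d-refl (origin f))) (len≤ f))
    where
    same : ∀ {x y} → d (origin f) x + d x y ≤ d (origin f) y → label f x ≡ label f y → d x y ≤ ƛ
    same {x} {y} le eq = +-cancelˡ-≤ (label f x * ƛ) _ _ (begin
      label f x * ƛ + d x y     ≤⟨ +-monoˡ-≤ (d x y) (≤-trans (m≤n+m _ (a % ƛ)) (≤-reflexive (sym (m≡m%n+[m/n]*n a ƛ)))) ⟩
      a + d x y                 ≤⟨ le ⟩
      b                         ≡⟨ m≡m%n+[m/n]*n b ƛ ⟩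
      b % ƛ + label f y * ƛ     ≤⟨ +-monoˡ-≤ _ (<⇒≤ (m%n<n b ƛ)) ⟩
      ƛ + label f y * ƛ         ≡⟨ trans (+-comm ƛ _) (cong (λ l → l * ƛ + ƛ) (sym eq)) ⟩
      label f x * ƛ + ƛ         ∎)
      where
      open ≤-Reasoning
      a b : ℕ
      a = d (origin f) x
      b = d (origin f) y

  unique-points : ∀ f → Unique (points f)
  unique-points f = AllPairs-resp-⊑ (points⊑ f) (AllPairs.tail (proj₁ (proj₂ (path f))))

  |S|<4^J : length S < 4 ^ J
  |S|<4^J = ≤-<-trans (Unique-≤n S-unique) n<4^J

  opaque
    reduced : Σ (List (Fin n × Fin n)) λ vt → m * m * m * length vt ≤ budget m I J L (length S) ×
      (∀ f → ∃₂ λ zs ℓ → Trail vt (origin f) zs (to f) ℓ × ℓ ≤ len f + J * (20 * ƛ) × length zs ≤ I * m + J * (3 * m))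
    reduced = Scale.hop-reduction (Finₚ._≟_ {n}) d d-refl triangle Step d≤step (allFin (length Ps)) ∈-allFin
      origin to len points S points∈S unique-points ƛ I label label< close
      (λ f → geodesic-trail (trail f) (len≤ f)) (λ f → <⇒≤ (len<Iƛ f)) L
      (subst (_< 2 ^ L) (sym (length-allFin (length Ps))) |Ps|<2^L) J |S|<4^J m 1≤m
      (λ f → len f , trail f , m≤m+n _ 0)

  vt : List (Fin n × Fin n)
  vt = proj₁ reduced

  -- The extra 1 pays for the walk `first`, which precedes the trail.
  hop-bound : ℕ
  hop-bound = suc (I * m + J * (3 * m)) * h

  route : ∀ f → ∃ λ E → length E ≤ hop-bound ×
          (∃ λ ℓ → Route E vt (from f) (to f) ℓ × ℓ ≤ d (from f) (to f) + J * (20 * ƛ))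
  route f with proj₂ (proj₂ reduced) f
  ... | zs , ℓ , p , ℓ≤ , zs≤ with trail-route p
  ...   | E , E≤ , r = edge-list (first f) ++ E ,
    ≤-trans (≤-reflexive (trans (length-++ (edge-list (first f))) (cong (_+ length E) (length-edge-list (first f)))))
      (+-mono-≤ (first≤ f) (≤-trans E≤ (*-monoˡ-≤ h zs≤))) ,
    walkLength (first f) + ℓ , follow (first f) ∈-++⁺ˡ (Route-mono (∈-++⁺ʳ (edge-list (first f))) id r) ,
    ≤-trans (+-monoʳ-≤ _ ℓ≤) (≤-reflexive (trans (sym (+-assoc (walkLength (first f)) (len f) _))
      (cong (_+ J * (20 * ƛ)) (path-length f))))

  opaque
    scale : ∃₂ λ E vt → ∃ λ s → h * s ≤ 2 * n * L × m * m * m * length vt ≤ budget m I J L s ×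
            length E ≤ length Ps * hop-bound ×
            (∀ {uv} → uv ∈ Ps → ∃ λ ℓ → Route E vt (proj₁ uv) (proj₂ uv) ℓ × ℓ ≤ d (proj₁ uv) (proj₂ uv) + J * (20 * ƛ))
    scale =
      let E , E≤ , routes = gather Routed (λ f i (ℓ , r , le) → ℓ , Route-mono i id r , le) (λ _ → hop-bound)
                              (allFin (length Ps)) (λ {f} _ → route f)
      in E , vt , length S , h*S≤ , proj₁ (proj₂ reduced) ,
         ≤-trans E≤ (≤-trans (∑-≤-length (allFin (length Ps)) (λ _ → ≤-refl))
           (≤-reflexive (cong (_* hop-bound) (length-allFin (length Ps))))) ,
         λ {uv} uv∈ → subst (λ uv → ∃ λ ℓ → Route E vt (proj₁ uv) (proj₂ uv) ℓ × ℓ ≤ d (proj₁ uv) (proj₂ uv) + J * (20 * ƛ))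
           (sym (lookup-index uv∈)) (routes (∈-allFin (Any.index uv∈)))
      where
      Routed : F → List (Fin n × Fin n) → Set
      Routed f E = ∃ λ ℓ → Route E vt (from f) (to f) ℓ × ℓ ≤ d (from f) (to f) + J * (20 * ƛ)

-- One round: halving the number of demand pairs.

dyadic : ∀ N k v → N ≤ v → v < N * 2 ^ k → ∃ λ j → j < k × N * 2 ^ j ≤ v × v < 2 * N * 2 ^ j
dyadic N zero    v N≤v v< = contradiction N≤v (<⇒≱ (subst (v <_) (*-identityʳ N) v<))
dyadic N (suc k) v N≤v v< with v <? N * 2 ^ k
... | no v≮ = k , ≤-refl , ≮⇒≥ v≮ , subst (v <_) (rearrange N (2 ^ k)) v<
  where
  rearrange : ∀ N a → N * (2 * a) ≡ 2 * N * a
  rearrange = solve-∀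
... | yes lt with dyadic N k v N≤v lt
...   | j , j<k , below , above = j , m<n⇒m<1+n j<k , below , above

module Halving {n : ℕ} (G : WeightedDigraph n) (W : ℕ) (weights≤ : WeightsAtMost G W) (positive : PositiveWeights G)
               (N J L Λ : ℕ) (1≤N : 1 ≤ N) (1≤J : 1 ≤ J) (1≤Λ : 1 ≤ Λ) (n<4^J : n < 4 ^ J) (nW<2^Λ : n * W < 2 ^ Λ) where

  open Walks G
  open Distance G W weights≤
  open Scaling G W weights≤

  -- At ƛ = 2^j the additive error is 20J · 2^j, which is at most 1/N of any distance from D₁ · 2^j
  -- on. The dyadic range ends at twice that, hence I = 2D₁ in units of ƛ.
  D₁ I : ℕ
  D₁ = 20 * J * N
  I  = 2 * D₁

  1≤D₁ : 1 ≤ D₁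
  1≤D₁ = *-mono-≤ (*-mono-≤ {1} {20} (s≤s z≤n) 1≤J) 1≤N

  dist : Fin n × Fin n → ℕ
  dist (u , v) = d u v

  Stretched-route : List (Fin n × Fin n) → List (Fin n × Fin n) → Fin n × Fin n → Set
  Stretched-route E vt uv = ∃ λ ℓ → Route E vt (proj₁ uv) (proj₂ uv) ℓ × N * ℓ ≤ suc N * dist uv

  Stretched-mono : ∀ {E E′ vt vt′ uv} → (∀ {e} → e ∈ E → e ∈ E′) → (∀ {e} → e ∈ vt → e ∈ vt′) →
                   Stretched-route E vt uv → Stretched-route E′ vt′ uv
  Stretched-mono i j (ℓ , r , le) = ℓ , Route-mono i j r , le

  scale-cost : ℕ → ℕ → ℕ
  scale-cost h m = suc (I * m + J * (3 * m)) * h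

  module Step (h m p : ℕ) (1≤h : 1 ≤ h) (1≤m : 1 ≤ m) (p<2^L : p < 2 ^ L) (pn<2^L : p * n < 2 ^ L)
              (within-budget : ∀ s → h * s ≤ 2 * n * L → 2 * Λ * budget m I J L s ≤ p * (m * m * m))
              (Ps : List (Fin n × Fin n)) (|Ps|≤p : length Ps ≤ p) where

    AtScale : ℕ → Fin n × Fin n → Set
    AtScale j uv = (D₁ * 2 ^ j ≤ dist uv × dist uv < I * 2 ^ j) × dist uv < ∞

    atScale? : ∀ j → Decidable (AtScale j)
    atScale? j uv = (D₁ * 2 ^ j ≤? dist uv ×-dec dist uv <? I * 2 ^ j) ×-dec dist uv <? ∞

    Ps[_] : ℕ → List (Fin n × Fin n)
    Ps[ j ] = filter (atScale? j) Ps

    ∈Ps[]⁻ : ∀ {j uv} → uv ∈ Ps[ j ] → uv ∈ Ps × AtScale j uv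
    ∈Ps[]⁻ {j} = ∈-filter⁻ (atScale? j)

    Ps[]≤p : ∀ j → length Ps[ j ] ≤ p
    Ps[]≤p j = ≤-trans (length-filter (atScale? j) Ps) |Ps|≤p

    Scale-result : ℕ → Set
    Scale-result j = Σ (List (Fin n × Fin n)) λ E → Σ (List (Fin n × Fin n)) λ vt →
      length E ≤ p * scale-cost h m × 2 * Λ * length vt ≤ p ×
      (∀ {uv} → uv ∈ Ps[ j ] → Stretched-route E vt uv)

    opaque
      at-scale : ∀ j → Scale-result j
      at-scale j with OneScale.scale G W weights≤ h 1≤h (2 ^ j) {{m^n≢0 2 j}} I J L m 1≤m n<4^J Ps[ j ]
                       (≤-<-trans (*-monoˡ-≤ n (Ps[]≤p j)) pn<2^L) (≤-<-trans (Ps[]≤p j) p<2^L)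
                       (λ uv∈ → proj₂ (proj₂ (∈Ps[]⁻ {j} uv∈))) (λ uv∈ → proj₂ (proj₁ (proj₂ (∈Ps[]⁻ {j} uv∈))))
      ... | E , vt , s , hs≤ , vt≤ , E≤ , routes = E , vt ,
        ≤-trans E≤ (*-monoˡ-≤ (scale-cost h m) (Ps[]≤p j)) ,
        *-cancelʳ-≤ _ _ (m * m * m) {{>-nonZero (*-mono-≤ (*-mono-≤ 1≤m 1≤m) 1≤m)}} (begin
          2 * Λ * length vt * (m * m * m)     ≡⟨ rearrange (2 * Λ) (length vt) (m * m * m) ⟩
          2 * Λ * (m * m * m * length vt)     ≤⟨ *-monoʳ-≤ (2 * Λ) vt≤ ⟩
          2 * Λ * budget m I J L s            ≤⟨ within-budget s hs≤ ⟩
          p * (m * m * m)                     ∎) ,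
        stretched
        where
        open ≤-Reasoning
        rearrange : ∀ a v c → a * v * c ≡ a * (c * v)
        rearrange = solve-∀
        rearrange′ : ∀ N J x → N * (J * (20 * x)) ≡ 20 * J * N * x
        rearrange′ = solve-∀
        stretched : ∀ {uv} → uv ∈ Ps[ j ] → Stretched-route E vt uv
        stretched {uv} uv∈ with routes uv∈
        ... | ℓ , r , ℓ≤ = ℓ , r , (begin
          N * ℓ                                        ≤⟨ *-monoʳ-≤ N ℓ≤ ⟩
          N * (dist uv + J * (20 * 2 ^ j))             ≡⟨ *-distribˡ-+ N (dist uv) _ ⟩
          N * dist uv + N * (J * (20 * 2 ^ j))         ≡⟨ cong (N * dist uv +_) (rearrange′ N J (2 ^ j)) ⟩
          N * dist uv + D₁ * 2 ^ j                     ≤⟨ +-monoʳ-≤ _ (proj₁ (proj₁ (proj₂ (∈Ps[]⁻ {j} uv∈)))) ⟩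
          N * dist uv + dist uv                        ≡⟨ +-comm _ (dist uv) ⟩
          suc N * dist uv                              ∎)

    Es vts : ℕ → List (Fin n × Fin n)
    Es j  = proj₁ (at-scale j)
    vts j = proj₁ (proj₂ (at-scale j))

    Close-route : Fin n × Fin n → List (Fin n × Fin n) → Set
    Close-route uv E = dist uv < D₁ → dist uv < ∞ → Stretched-route E [] uv

    -- Weights are at least 1, so a shortest path of length below D₁ has fewer than D₁ edges and can
    -- be taken entirely.
    close-route : ∀ uv → ∃ λ E → length E ≤ D₁ × Close-route uv E
    close-route uv@(u , v) with d u v <? D₁ | d u v <? ∞
    ... | no ≮ | _     = [] , z≤n , λ lt → contradiction lt ≮
    ... | yes _ | no ≮ = [] , z≤n , λ _ lt → contradiction lt ≮
    ... | yes close | yes bounded with walk-of bounded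
    ...   | w , w≡ = edge-list w ,
      ≤-trans (≤-reflexive (length-edge-list w)) (≤-trans (hops≤length positive w) (≤-trans (≤-reflexive w≡) (<⇒≤ close))) ,
      λ _ _ → walkLength w + 0 , follow w id [] ,
        ≤-trans (*-monoʳ-≤ N (≤-reflexive (trans (+-identityʳ _) w≡))) (*-monoˡ-≤ (d u v) (n≤1+n N))

    opaque
      close-routes : Σ (List (Fin n × Fin n)) λ E → length E ≤ ∑ (λ _ → D₁) Ps × (∀ {uv} → uv ∈ Ps → Close-route uv E)
      close-routes = gather Close-route (λ uv i r lt₁ lt₂ → Stretched-mono i id (r lt₁ lt₂)) (λ _ → D₁) Ps (λ {uv} _ → close-route uv)

    E vt : List (Fin n × Fin n)
    E  = proj₁ close-routes ++ concat (map Es (upTo Λ))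
    vt = concat (map vts (upTo Λ))

    ∑-map : ∀ (g : ℕ → List (Fin n × Fin n)) js → ∑ length (map g js) ≡ ∑ (λ j → length (g j)) js
    ∑-map g []       = refl
    ∑-map g (j ∷ js) = cong (length (g j) +_) (∑-map g js)

    E≤ : length E ≤ p * (D₁ + Λ * scale-cost h m)
    E≤ = begin
      length E
        ≡⟨ length-++ (proj₁ close-routes) ⟩
      length (proj₁ close-routes) + length (concat (map Es (upTo Λ)))
        ≤⟨ +-mono-≤ (≤-trans (proj₁ (proj₂ close-routes)) (∑-≤-length Ps (λ _ → ≤-refl)))
             (≤-reflexive (trans (length-concat (map Es (upTo Λ))) (∑-map Es (upTo Λ)))) ⟩
      length Ps * D₁ + ∑ (λ j → length (Es j)) (upTo Λ)
        ≤⟨ +-mono-≤ (*-monoˡ-≤ D₁ |Ps|≤p) (∑-≤-length (upTo Λ) (λ {j} _ → proj₁ (proj₂ (proj₂ (at-scale j))))) ⟩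
      p * D₁ + length (upTo Λ) * (p * scale-cost h m)
        ≡⟨ cong (λ k → p * D₁ + k * (p * scale-cost h m)) (length-upTo Λ) ⟩
      p * D₁ + Λ * (p * scale-cost h m)
        ≡⟨ rearrange p D₁ Λ (scale-cost h m) ⟩
      p * (D₁ + Λ * scale-cost h m) ∎
      where
      open ≤-Reasoning
      rearrange : ∀ p a b c → p * a + b * (p * c) ≡ p * (a + b * c)
      rearrange = solve-∀

    vt≤ : 2 * length vt ≤ p
    vt≤ = *-cancelˡ-≤ Λ {{>-nonZero 1≤Λ}} (begin
      Λ * (2 * length vt)
        ≡⟨ rearrange Λ (length vt) ⟩
      2 * Λ * length vt
        ≡⟨ cong (2 * Λ *_) (trans (length-concat (map vts (upTo Λ))) (∑-map vts (upTo Λ))) ⟩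
      2 * Λ * ∑ (λ j → length (vts j)) (upTo Λ)
        ≡⟨ ∑-* (2 * Λ) (λ j → length (vts j)) (upTo Λ) ⟨
      ∑ (λ j → 2 * Λ * length (vts j)) (upTo Λ)
        ≤⟨ ∑-≤-length (upTo Λ) (λ {j} _ → proj₁ (proj₂ (proj₂ (proj₂ (at-scale j))))) ⟩
      length (upTo Λ) * p
        ≡⟨ cong (_* p) (length-upTo Λ) ⟩
      Λ * p ∎)
      where
      open ≤-Reasoning
      rearrange : ∀ a v → a * (2 * v) ≡ 2 * a * v
      rearrange = solve-∀

    routes : ∀ {uv} → uv ∈ Ps → dist uv < ∞ → Stretched-route E vt uv
    routes {uv} uv∈ bounded with dist uv <? D₁
    ... | yes close = Stretched-mono {E′ = E} {vt′ = vt} ∈-++⁺ˡ (λ ()) (proj₂ (proj₂ close-routes) uv∈ close bounded)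
    ... | no ≮D₁ with dyadic D₁ Λ (dist uv) (≮⇒≥ ≮D₁) dist<
      where
      dist< : dist uv < D₁ * 2 ^ Λ
      dist< = ≤-<-trans (walk-bounded (proj₁ (walk-of bounded)))
        (<-≤-trans nW<2^Λ (≤-trans (≤-reflexive (sym (*-identityˡ _))) (*-monoˡ-≤ (2 ^ Λ) 1≤D₁)))
    ...   | j , j<Λ , below , above =
      Stretched-mono {E′ = E} {vt′ = vt} (λ e∈ → ∈-++⁺ʳ (proj₁ close-routes) (∈-concat⁺′ e∈ (∈-map⁺ Es (∈-upTo⁺ j<Λ))))
        (λ e∈ → ∈-concat⁺′ e∈ (∈-map⁺ vts (∈-upTo⁺ j<Λ)))
        (proj₂ (proj₂ (proj₂ (proj₂ (at-scale j)))) (∈-filter⁺ (atScale? j) uv∈ ((below , above) , bounded)))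

  Halves : ℕ → ℕ → Set
  Halves C p = ∀ Ps → length Ps ≤ p → Σ (List (Fin n × Fin n)) λ E → Σ (List (Fin n × Fin n)) λ vt →
    length E ≤ C × 2 * length vt ≤ p × (∀ {uv} → uv ∈ Ps → dist uv < ∞ → Stretched-route E vt uv)

  opaque
    halve : ∀ h m p → 1 ≤ h → 1 ≤ m → p < 2 ^ L → p * n < 2 ^ L →
            (∀ s → h * s ≤ 2 * n * L → 2 * Λ * budget m I J L s ≤ p * (m * m * m)) →
            Halves (p * (D₁ + Λ * scale-cost h m)) p
    halve h m p 1≤h 1≤m p<2^L pn<2^L within-budget Ps |Ps|≤p = E , vt , E≤ , vt≤ , routes
      where open Step h m p 1≤h 1≤m p<2^L pn<2^L within-budget Ps |Ps|≤p

  -- The recursion over rounds.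

  Preserved : ℕ → List (Fin n × Fin n) → Fin n × Fin n → Set
  Preserved k E uv = ∃ λ ℓ → Route E [] (proj₁ uv) (proj₂ uv) ℓ × N ^ k * ℓ ≤ suc N ^ k * dist uv

  -- Virtual pairs are charged at their exact distance, so replacing each by a route of stretch (1 +
  -- 1/N)^k stretches the whole route by no more. Real edges stay as they are.
  expand : ∀ k {E E′ vt u v ℓ} → Route E vt u v ℓ → ℓ < ∞ →
           (∀ {uv} → uv ∈ vt → dist uv < ∞ → Preserved k E′ uv) →
           ∃ λ ℓ′ → Route (E ++ E′) [] u v ℓ′ × N ^ k * ℓ′ ≤ suc N ^ k * ℓ
  expand k [] _ _ = 0 , [] , ≤-trans (≤-reflexive (*-zeroʳ (N ^ k))) z≤n
  expand k (edge {u} {v} {ℓ = ℓ} e e∈ r) lt pres with expand k r (≤-<-trans (m≤n+m ℓ (weight G u v)) lt) pres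
  ... | ℓ′ , r′ , le = weight G u v + ℓ′ , edge e (∈-++⁺ˡ e∈) r′ , (begin
    N ^ k * (weight G u v + ℓ′)                    ≡⟨ *-distribˡ-+ (N ^ k) (weight G u v) ℓ′ ⟩
    N ^ k * weight G u v + N ^ k * ℓ′              ≤⟨ +-mono-≤ (*-monoˡ-≤ (weight G u v) (^-monoˡ-≤ k (n≤1+n N))) le ⟩
    suc N ^ k * weight G u v + suc N ^ k * ℓ       ≡⟨ *-distribˡ-+ (suc N ^ k) (weight G u v) ℓ ⟨
    suc N ^ k * (weight G u v + ℓ)                 ∎)
    where open ≤-Reasoning
  expand k {E} (virt {u} {v} {ℓ = ℓ} uv∈ r) lt pres
    with expand k r (≤-<-trans (m≤n+m ℓ (d u v)) lt) pres | pres uv∈ (≤-<-trans (m≤m+n (d u v) ℓ) lt)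
  ... | ℓ′ , r′ , le | ℓ″ , r″ , le″ = ℓ″ + ℓ′ , concatenate (Route-mono (∈-++⁺ʳ E) id r″) r′ , (begin
    N ^ k * (ℓ″ + ℓ′)                     ≡⟨ *-distribˡ-+ (N ^ k) ℓ″ ℓ′ ⟩
    N ^ k * ℓ″ + N ^ k * ℓ′               ≤⟨ +-mono-≤ le″ le ⟩
    suc N ^ k * d u v + suc N ^ k * ℓ     ≡⟨ *-distribˡ-+ (suc N ^ k) (d u v) ℓ ⟨
    suc N ^ k * (d u v + ℓ)               ∎)
    where
    open ≤-Reasoning
    concatenate : ∀ {E u v x k ℓ} → Route E [] u v k → Route E [] v x ℓ → Route E [] u x (k + ℓ)
    concatenate []             q = q
    concatenate (edge {u} {v} e e∈ p) q = subst (Route _ _ _ _) (sym (+-assoc (weight G u v) _ _)) (edge e e∈ (concatenate p q))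
    concatenate (virt () _)

  short : ∀ {uv ℓ} → dist uv < ∞ → N * ℓ ≤ suc N * dist uv → ℓ < ∞
  short {uv} {ℓ} bounded le = s≤s (*-cancelˡ-≤ N {{>-nonZero 1≤N}} (begin
    N * ℓ                    ≤⟨ le ⟩
    suc N * dist uv          ≤⟨ *-mono-≤ (+-mono-≤ 1≤N (≤-reflexive (sym (+-identityʳ N)))) (walk-bounded (proj₁ (walk-of bounded))) ⟩
    2 * N * (n * W)          ≡⟨ rearrange N (n * W) ⟩
    N * (2 * (n * W))        ∎))
    where
    open ≤-Reasoning
    rearrange : ∀ a b → 2 * a * b ≡ a * (2 * b)
    rearrange = solve-∀

  module Recursion (C p̂ : ℕ) (halves : ∀ p → 1 ≤ p → p ≤ p̂ → Halves C p) where

    -- The recursion is on the exponent `k`: halving the pairs turns p < 2^k into a bound by 2^(k -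
    -- 1). All rounds share the edge bound `C`, since p never exceeds p̂.
    solve : ∀ k p Ps → length Ps ≤ p → p < 2 ^ k → p ≤ p̂ →
            ∃ λ E → length E ≤ k * C × (∀ {uv} → uv ∈ Ps → dist uv < ∞ → Preserved k E uv)
    solve k       zero      []      _     _   _  = [] , z≤n , λ ()
    solve zero    (suc p)   Ps      _     lt  _  = contradiction lt λ { (s≤s ()) }
    solve (suc k) p@(suc _) Ps      |Ps|≤ lt p≤ with halves p (s≤s z≤n) p≤ Ps |Ps|≤
    ... | E , vt , E≤ , vt≤ , routes
      with solve k (length vt) vt ≤-refl (*-cancelˡ-< 2 _ _ (≤-<-trans vt≤ lt))
             (≤-trans (m≤m+n _ _) (≤-trans vt≤ p≤))
    ...   | E′ , E′≤ , pres = E ++ E′ , ≤-trans (≤-reflexive (length-++ E)) (+-mono-≤ E≤ E′≤) , preserved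
      where
      preserved : ∀ {uv} → uv ∈ Ps → dist uv < ∞ → Preserved (suc k) (E ++ E′) uv
      preserved {uv} uv∈ bounded with routes uv∈ bounded
      ... | ℓ , r , le with expand k r (short bounded le) pres
      ...   | ℓ′ , r′ , le′ = ℓ′ , r′ , (begin
        N * N ^ k * ℓ′                 ≡⟨ *-assoc N (N ^ k) ℓ′ ⟩
        N * (N ^ k * ℓ′)               ≤⟨ *-monoʳ-≤ N le′ ⟩
        N * (suc N ^ k * ℓ)            ≡⟨ rearrange N (suc N ^ k) ℓ ⟩
        suc N ^ k * (N * ℓ)            ≤⟨ *-monoʳ-≤ (suc N ^ k) le ⟩
        suc N ^ k * (suc N * dist uv)  ≡⟨ rearrange′ (suc N ^ k) (suc N) (dist uv) ⟩
        suc N * suc N ^ k * dist uv    ∎)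
        where
        open ≤-Reasoning
        rearrange : ∀ a b c → a * (b * c) ≡ b * (a * c)
        rearrange = solve-∀
        rearrange′ : ∀ a b c → a * (b * c) ≡ b * a * c
        rearrange′ = solve-∀

-- Logarithms, and polynomials in one variable.

n<2^[1+⌊log₂n⌋] : ∀ n → n < 2 ^ suc ⌊log₂ n ⌋
n<2^[1+⌊log₂n⌋] n with n <? 2 ^ suc ⌊log₂ n ⌋
... | yes lt = lt
... | no n≮ = contradiction (≤-trans (≤-reflexive (sym (⌊log₂[2^n]⌋≡n (suc ⌊log₂ n ⌋)))) (⌊log₂⌋-mono-≤ (≮⇒≥ n≮)))
  (<-irrefl refl)

-- With a syntax for polynomials in the logarithm, a bound of the form C · ℓ^k follows by recursion
-- on the expression, and the large concrete constants need never be expanded.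
data Poly : Set where
  con : ℕ → Poly
  var : Poly
  _⊞_ _⊠_ : Poly → Poly → Poly

infixl 6 _⊞_
infixl 7 _⊠_

eval : Poly → ℕ → ℕ
eval (con c) ℓ = c
eval var     ℓ = ℓ
eval (p ⊞ q) ℓ = eval p ℓ + eval q ℓ
eval (p ⊠ q) ℓ = eval p ℓ * eval q ℓ

opaque

  eval-bound : ∀ p → ∃₂ λ C k → ∀ ℓ → 1 ≤ ℓ → eval p ℓ ≤ C * ℓ ^ k
  eval-bound (con c) = c , 0 , λ ℓ _ → ≤-reflexive (sym (*-identityʳ c))
  eval-bound var     = 1 , 1 , λ ℓ _ → ≤-reflexive (sym (trans (*-identityˡ _) (*-identityʳ ℓ)))
  eval-bound (p ⊞ q) with eval-bound p | eval-bound q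
  ... | C , k , p≤ | C′ , k′ , q≤ = C + C′ , k + k′ , λ ℓ 1≤ℓ → begin
    eval p ℓ + eval q ℓ             ≤⟨ +-mono-≤ (p≤ ℓ 1≤ℓ) (q≤ ℓ 1≤ℓ) ⟩
    C * ℓ ^ k + C′ * ℓ ^ k′         ≤⟨ +-mono-≤ (*-monoʳ-≤ C (^-monoʳ-≤ ℓ {{>-nonZero 1≤ℓ}} (m≤m+n k k′)))
                                         (*-monoʳ-≤ C′ (^-monoʳ-≤ ℓ {{>-nonZero 1≤ℓ}} (m≤n+m k′ k))) ⟩
    C * ℓ ^ (k + k′) + C′ * ℓ ^ (k + k′) ≡⟨ *-distribʳ-+ (ℓ ^ (k + k′)) C C′ ⟨
    (C + C′) * ℓ ^ (k + k′)         ∎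
    where open ≤-Reasoning
  eval-bound (p ⊠ q) with eval-bound p | eval-bound q
  ... | C , k , p≤ | C′ , k′ , q≤ = C * C′ , k + k′ , λ ℓ 1≤ℓ → begin
    eval p ℓ * eval q ℓ             ≤⟨ *-mono-≤ (p≤ ℓ 1≤ℓ) (q≤ ℓ 1≤ℓ) ⟩
    C * ℓ ^ k * (C′ * ℓ ^ k′)       ≡⟨ rearrange C (ℓ ^ k) C′ (ℓ ^ k′) ⟩
    C * C′ * (ℓ ^ k * ℓ ^ k′)       ≡⟨ cong (C * C′ *_) (^-distribˡ-+-* ℓ k k′) ⟨
    C * C′ * ℓ ^ (k + k′)           ∎
    where
    open ≤-Reasoning
    rearrange : ∀ a b c d → a * b * (c * d) ≡ a * c * (b * d)
    rearrange = solve-∀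

-- Integer cube roots and the choice of parameters.

infix 8 _³
_³ : ℕ → ℕ
a ³ = a * a * a

³-mono-≤ : ∀ {a b} → a ≤ b → a ³ ≤ b ³
³-mono-≤ le = *-mono-≤ (*-mono-≤ le le) le

³-cancel-< : ∀ a b → a ³ < b ³ → a < b
³-cancel-< a b lt with a <? b
... | yes a<b = a<b
... | no a≮b = contradiction (³-mono-≤ (≮⇒≥ a≮b)) (<⇒≱ lt)

-- The cube root rounded up. Minimality is stated for a predecessor `c`, so that it is vacuous for
-- the root 0.
cbrt : ∀ p → ∃ λ a → p ≤ a ³ × (∀ c → a ≡ suc c → c ³ < p)
cbrt zero = 0 , z≤n , λ _ ()
cbrt (suc p) with cbrt p
... | a , p≤ , least with suc p ≤? a ³
...   | yes le = a , le , λ c eq → m<n⇒m<1+n (least c eq)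
...   | no ≰   = suc a , ≤-trans (s≤s p≤) (grow a) , λ { c refl → ≰⇒> ≰ }
  where
  grow : ∀ a → suc (a ³) ≤ suc a ³
  grow a = ≤-trans (s≤s (m≤m+n (a ³) (3 * (a * a) + 3 * a))) (≤-reflexive (rearrange a))
    where
    rearrange : ∀ a → suc (a * a * a + (3 * (a * a) + 3 * a)) ≡ suc a * suc a * suc a
    rearrange = solve-∀

-- From 2 on, a number is at most twice its predecessor, and the cube of the predecessor is below p.
cbrt-≤8 : ∀ {p a} → (∀ c → a ≡ suc c → c ³ < p) → a ³ ≤ 8 * p
cbrt-≤8 {p} {zero}        least = z≤n
cbrt-≤8 {p} {suc zero}    least = ≤-trans (least 0 refl) (m≤m+n p _)
cbrt-≤8 {p} {suc (suc c)} least = begin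
  (2 + c) ³        ≤⟨ ³-mono-≤ {2 + c} {2 * suc c} (≤-trans (+-monoˡ-≤ (1 + c) (s≤s (z≤n {c}))) (≤-reflexive (cong (suc c +_) (sym (+-identityʳ (suc c)))))) ⟩
  (2 * suc c) ³    ≡⟨ rearrange (suc c) ⟩
  8 * suc c ³      ≤⟨ *-monoʳ-≤ 8 (<⇒≤ (least (suc c) refl)) ⟩
  8 * p            ∎
  where
  open ≤-Reasoning
  rearrange : ∀ c → (2 * c) * (2 * c) * (2 * c) ≡ 8 * (c * c * c)
  rearrange = solve-∀

cbrt-≤ : ∀ {p a} → (∀ c → a ≡ suc c → c ³ < p) → ∀ b → p ≤ b ³ → a ≤ b
cbrt-≤ {a = zero}  least b p≤ = z≤n
cbrt-≤ {a = suc c} least b p≤ = ³-cancel-< c b (<-≤-trans (least c refl) p≤)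

first-factor second-factor : (I J L Λ : ℕ) → ℕ
first-factor I J L Λ = 2 * Λ * (3 + I * (16 * L * L))
second-factor I J L Λ = 2 * Λ * (J * ((5 + I + 20 * J) * (336 * (I * L) * (I * L))))

budget-split : ∀ m I J L Λ s → 2 * Λ * budget m I J L s ≡
               first-factor I J L Λ * s * (m * m * m) + second-factor I J L Λ * (s * s)
budget-split m I J L Λ s = trans (cong (2 * Λ *_) (budget≡ m I J L s))
  (rearrange 336 (m * m * m) (3 + I * (16 * L * L)) J (5 + I + 20 * J) I L Λ s)
  where
  rearrange : ∀ c m A J B I L Λ s → 2 * Λ * (m * (A * s) + J * (B * (c * (I * L * s) * (I * L * s)))) ≡
              2 * Λ * A * s * m + 2 * Λ * (J * (B * (c * (I * L) * (I * L)))) * (s * s)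
  rearrange = solve-∀

within-budget : ∀ m I J L Λ s p x K → 1 ≤ L → 1 ≤ K →
  4 * L * first-factor I J L Λ ≤ K → 64 * (L * L) * second-factor I J L Λ ≤ K →
  K * s ≤ 2 * L * p → K * s ≤ 2 * L * x → x * x ≤ 8 * (p * (m * m * m)) →
  2 * Λ * budget m I J L s ≤ p * (m * m * m)
within-budget m I J L Λ s p x K 1≤L 1≤K K≥₁ K≥₂ sp sx xx = *-cancelˡ-≤ 2 (begin
  2 * (2 * Λ * budget m I J L s)             ≡⟨ cong (2 *_) (budget-split m I J L Λ s) ⟩
  2 * (Q₁ * s * m³ + Q₂ * (s * s))           ≡⟨ rearrange₁ Q₁ s m³ Q₂ ⟩
  2 * Q₁ * s * m³ + 2 * Q₂ * (s * s)         ≤⟨ +-mono-≤ (*-monoˡ-≤ m³ first) second ⟩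
  p * m³ + p * m³                            ≡⟨ cong (p * m³ +_) (+-identityʳ (p * m³)) ⟨
  2 * (p * m³)                               ∎)
  where
  open ≤-Reasoning
  m³ Q₁ Q₂ : ℕ
  m³ = m * m * m
  Q₁ = first-factor I J L Λ
  Q₂ = second-factor I J L Λ
  rearrange₁ : ∀ a s m b → 2 * (a * s * m + b * (s * s)) ≡ 2 * a * s * m + 2 * b * (s * s)
  rearrange₁ = solve-∀
  rearrange₂ : ∀ L a s → 2 * L * (2 * a * s) ≡ 4 * L * a * s
  rearrange₂ = solve-∀
  rearrange₃ : ∀ L a s → 32 * (L * L) * (2 * a * (s * s)) ≡ 64 * (L * L) * a * (s * s)
  rearrange₃ = solve-∀
  rearrange₄ : ∀ K s → K * K * (s * s) ≡ K * s * (K * s)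
  rearrange₄ = solve-∀
  rearrange₅ : ∀ L x → 2 * L * x * (2 * L * x) ≡ 4 * (L * L) * (x * x)
  rearrange₅ = solve-∀
  rearrange₆ : ∀ L y → 4 * (L * L) * (8 * y) ≡ 32 * (L * L) * y
  rearrange₆ = solve-∀
  first : 2 * Q₁ * s ≤ p
  first = *-cancelˡ-≤ (2 * L) {{>-nonZero (*-mono-≤ {1} {2} (s≤s z≤n) 1≤L)}} (begin
    2 * L * (2 * Q₁ * s)   ≡⟨ rearrange₂ L Q₁ s ⟩
    4 * L * Q₁ * s         ≤⟨ *-monoˡ-≤ s K≥₁ ⟩
    K * s                  ≤⟨ sp ⟩
    2 * L * p              ∎)
  second : 2 * Q₂ * (s * s) ≤ p * m³
  second = *-cancelˡ-≤ (32 * (L * L)) {{>-nonZero (*-mono-≤ {1} {32} (s≤s z≤n) (*-mono-≤ 1≤L 1≤L))}} (begin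
    32 * (L * L) * (2 * Q₂ * (s * s))   ≡⟨ rearrange₃ L Q₂ s ⟩
    64 * (L * L) * Q₂ * (s * s)         ≤⟨ *-monoˡ-≤ (s * s) K≥₂ ⟩
    K * (s * s)                         ≤⟨ *-monoˡ-≤ (s * s) (≤-trans (≤-reflexive (sym (*-identityˡ K))) (*-monoˡ-≤ K 1≤K)) ⟩
    K * K * (s * s)                     ≡⟨ rearrange₄ K s ⟩
    K * s * (K * s)                     ≤⟨ *-mono-≤ sx sx ⟩
    2 * L * x * (2 * L * x)             ≡⟨ rearrange₅ L x ⟩
    4 * (L * L) * (x * x)               ≤⟨ *-monoʳ-≤ (4 * (L * L)) xx ⟩
    4 * (L * L) * (8 * (p * m³))        ≡⟨ rearrange₆ L (p * m³) ⟩
    32 * (L * L) * (p * m³)             ∎)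

-- h is the spacing of the hitting set and m the length of the chains.
parameters : ∀ n p a b K L → 1 ≤ n → 1 ≤ p → p ≤ n * n → 1 ≤ K → p ≤ a ³ → n ≤ b ³ →
  ∃₂ λ h m → 1 ≤ h × 1 ≤ m × p * m * h ≤ 4 * K * (n * a + b * b * (a * a)) ×
    (∀ s → h * s ≤ 2 * n * L → ∃ λ x → K * s ≤ 2 * L * p × K * s ≤ 2 * L * x × x * x ≤ 8 * (p * (m * m * m)))
parameters n p@(suc _) a b K L 1≤n 1≤p p≤nn 1≤K p≤a³ n≤b³ with cbrt p
... | aₚ@zero , p≤aₚ³ , _ = contradiction (≤-trans 1≤p p≤aₚ³) λ ()
... | aₚ@(suc _) , p≤aₚ³ , least = choose (p ≤? n)
  where
  -- The summand 1 keeps h ≥ K when p > n, so that Ks is bounded by both 2Lp and 2Ln, and it absorbs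
  -- the rounding of n/p.
  h : ℕ
  h = K * (1 + n / p)
  1≤h : 1 ≤ h
  1≤h = *-mono-≤ 1≤K (s≤s z≤n)
  K≤h : K ≤ h
  K≤h = ≤-trans (≤-reflexive (sym (*-identityʳ K))) (*-monoʳ-≤ K (s≤s z≤n))
  aₚ≤a : aₚ ≤ a
  aₚ≤a = cbrt-≤ least a p≤a³
  p*h≤ : p * h ≤ K * (p + n)
  p*h≤ = ≤-trans (≤-reflexive (rearrange p K (n / p))) (*-monoʳ-≤ K (+-monoʳ-≤ p (m/n*n≤m n p)))
    where
    rearrange : ∀ p K q → p * (K * (1 + q)) ≡ K * (p + q * p)
    rearrange = solve-∀
  Kn≤ph : K * n ≤ p * h
  Kn≤ph = begin
    K * n                        ≤⟨ *-monoʳ-≤ K (≤-trans (≤-reflexive (m≡m%n+[m/n]*n n p)) (+-monoˡ-≤ _ (<⇒≤ (m%n<n n p)))) ⟩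
    K * (p + n / p * p)          ≡⟨ rearrange K p (n / p) ⟩
    p * h                        ∎
    where
    open ≤-Reasoning
    rearrange : ∀ K p q → K * (p + q * p) ≡ p * (K * (1 + q))
    rearrange = solve-∀
  K*s≤p : ∀ s → h * s ≤ 2 * n * L → K * s ≤ 2 * L * p
  K*s≤p s hs = *-cancelˡ-≤ n {{>-nonZero 1≤n}} (begin
    n * (K * s)        ≡⟨ rearrange₁ n K s ⟩
    K * n * s          ≤⟨ *-monoˡ-≤ s Kn≤ph ⟩
    p * h * s          ≡⟨ *-assoc p h s ⟩
    p * (h * s)        ≤⟨ *-monoʳ-≤ p hs ⟩
    p * (2 * n * L)    ≡⟨ rearrange₂ p n L ⟩
    n * (2 * L * p)    ∎)
    where
    open ≤-Reasoning
    rearrange₁ : ∀ n K s → n * (K * s) ≡ K * n * s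
    rearrange₁ = solve-∀
    rearrange₂ : ∀ p n L → p * (2 * n * L) ≡ n * (2 * L * p)
    rearrange₂ = solve-∀
  K*s≤n : ∀ s → h * s ≤ 2 * n * L → K * s ≤ 2 * L * n
  K*s≤n s hs = ≤-trans (*-monoˡ-≤ s K≤h) (≤-trans hs (≤-reflexive (rearrange n L)))
    where
    rearrange : ∀ n L → 2 * n * L ≡ 2 * L * n
    rearrange = solve-∀
  Choice : ℕ → ℕ → Set
  Choice h m = 1 ≤ h × 1 ≤ m × p * m * h ≤ 4 * K * (n * a + b * b * (a * a)) ×
    (∀ s → h * s ≤ 2 * n * L → ∃ λ x → K * s ≤ 2 * L * p × K * s ≤ 2 * L * x × x * x ≤ 8 * (p * (m * m * m)))
  choose : Dec (p ≤ n) → ∃₂ Choice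
  choose (yes p≤n) = h , aₚ , 1≤h , s≤s z≤n , cost , λ s hs → p , K*s≤p s hs , K*s≤p s hs ,
    ≤-trans (*-monoʳ-≤ p p≤aₚ³) (m≤m+n (p * aₚ ³) _)
    where
    open ≤-Reasoning
    rearrange₀ : ∀ p m h → p * m * h ≡ p * h * m
    rearrange₀ = solve-∀
    rearrange : ∀ K n a → K * (n + n) * a + K * (n + n) * a ≡ 4 * K * (n * a)
    rearrange = solve-∀
    cost : p * aₚ * h ≤ 4 * K * (n * a + b * b * (a * a))
    cost = begin
      p * aₚ * h              ≡⟨ rearrange₀ p aₚ h ⟩
      p * h * aₚ              ≤⟨ *-mono-≤ (≤-trans p*h≤ (*-monoʳ-≤ K (+-monoˡ-≤ n p≤n))) aₚ≤a ⟩
      K * (n + n) * a         ≤⟨ m≤m+n _ _ ⟩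
      K * (n + n) * a + K * (n + n) * a ≡⟨ rearrange K n a ⟩
      4 * K * (n * a)         ≤⟨ *-monoʳ-≤ (4 * K) (m≤m+n (n * a) _) ⟩
      4 * K * (n * a + b * b * (a * a)) ∎
  choose (no p≰n) = h , m , 1≤h , s≤s z≤n , cost , λ s hs → n , K*s≤p s hs , K*s≤n s hs , n*n≤
    where
    open ≤-Reasoning
    m : ℕ
    m = suc (b * b / aₚ)
    -- Here p ≤ n² enters: as the quotient of b² by `aₚ` is at least 1 before rounding, replacing it
    -- by `m` at most doubles the bound on p m.
    aₚ≤bb : aₚ ≤ b * b
    aₚ≤bb = cbrt-≤ least (b * b) (≤-trans p≤nn (≤-trans (*-mono-≤ n≤b³ n≤b³) (≤-reflexive (rearrange b))))
      where
      rearrange : ∀ b → b * b * b * (b * b * b) ≡ b * b * (b * b) * (b * b)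
      rearrange = solve-∀
    bb≤am : b * b ≤ aₚ * m
    bb≤am = ≤-trans (≤-reflexive (m≡m%n+[m/n]*n (b * b) aₚ)) (≤-trans (+-monoˡ-≤ _ (<⇒≤ (m%n<n (b * b) aₚ)))
      (≤-reflexive (*-comm m aₚ)))
    n*n≤ : n * n ≤ 8 * (p * (m * m * m))
    n*n≤ = begin
      n * n                             ≤⟨ *-mono-≤ n≤b³ n≤b³ ⟩
      b ³ * b ³                         ≡⟨ rearrange₁ b ⟩
      (b * b) ³                         ≤⟨ ³-mono-≤ bb≤am ⟩
      (aₚ * m) ³                        ≡⟨ rearrange₂ aₚ m ⟩
      aₚ ³ * (m * m * m)                ≤⟨ *-monoˡ-≤ (m * m * m) (cbrt-≤8 {p} {aₚ} least) ⟩
      8 * p * (m * m * m)               ≡⟨ *-assoc 8 p (m * m * m) ⟩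
      8 * (p * (m * m * m))             ∎
      where
      rearrange₁ : ∀ b → b * b * b * (b * b * b) ≡ b * b * (b * b) * (b * b)
      rearrange₁ = solve-∀
      rearrange₂ : ∀ a m → a * m * (a * m) * (a * m) ≡ a * a * a * (m * m * m)
      rearrange₂ = solve-∀
    p*m≤ : p * m ≤ 2 * (b * b * (aₚ * aₚ))
    p*m≤ = begin
      p * m                                   ≤⟨ *-monoˡ-≤ m p≤aₚ³ ⟩
      aₚ ³ * m                                ≡⟨ rearrange₁ aₚ (b * b / aₚ) ⟩
      aₚ * aₚ * aₚ + aₚ * aₚ * (b * b / aₚ * aₚ) ≤⟨ +-mono-≤ (*-monoʳ-≤ (aₚ * aₚ) aₚ≤bb) (*-monoʳ-≤ (aₚ * aₚ) (m/n*n≤m (b * b) aₚ)) ⟩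
      aₚ * aₚ * (b * b) + aₚ * aₚ * (b * b)   ≡⟨ rearrange₂ (aₚ * aₚ) (b * b) ⟩
      2 * (b * b * (aₚ * aₚ))                 ∎
      where
      rearrange₁ : ∀ a q → a * a * a * suc q ≡ a * a * a + a * a * (q * a)
      rearrange₁ = solve-∀
      rearrange₂ : ∀ x y → x * y + x * y ≡ 2 * (y * x)
      rearrange₂ = solve-∀
    cost : p * m * h ≤ 4 * K * (n * a + b * b * (a * a))
    cost = begin
      p * m * h                          ≡⟨ rearrange₀ p m h ⟩
      p * h * m                          ≤⟨ *-monoˡ-≤ m (≤-trans p*h≤ (*-monoʳ-≤ K (+-monoʳ-≤ p (<⇒≤ (≰⇒> p≰n))))) ⟩
      K * (p + p) * m                    ≡⟨ rearrange K p m ⟩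
      2 * K * (p * m)                    ≤⟨ *-monoʳ-≤ (2 * K) p*m≤ ⟩
      2 * K * (2 * (b * b * (aₚ * aₚ)))  ≡⟨ rearrange′ K (b * b * (aₚ * aₚ)) ⟩
      4 * K * (b * b * (aₚ * aₚ))        ≤⟨ *-monoʳ-≤ (4 * K) (*-monoʳ-≤ (b * b) (*-mono-≤ aₚ≤a aₚ≤a)) ⟩
      4 * K * (b * b * (a * a))          ≤⟨ *-monoʳ-≤ (4 * K) (m≤n+m _ (n * a)) ⟩
      4 * K * (n * a + b * b * (a * a))  ∎
      where
      rearrange₀ : ∀ p m h → p * m * h ≡ p * h * m
      rearrange₀ = solve-∀
      rearrange : ∀ K p m → K * (p + p) * m ≡ 2 * K * (p * m)
      rearrange = solve-∀
      rearrange′ : ∀ K x → 2 * K * (2 * x) ≡ 4 * K * x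
      rearrange′ = solve-∀

-- (1 + 1/N)^i ≤ (N + 1) / (N + 1 − i), with r = N + 1 − i
compound : ∀ N i r → i + r ≡ suc N → suc N ^ i * r ≤ N ^ i * suc N
compound N zero    r refl = ≤-refl
compound N (suc i) r eq   = begin
  suc N * suc N ^ i * r         ≡⟨ rearrange₁ (suc N) (suc N ^ i) r ⟩
  suc N ^ i * (suc N * r)       ≤⟨ *-monoʳ-≤ (suc N ^ i) one ⟩
  suc N ^ i * (N * suc r)       ≡⟨ rearrange₂ (suc N ^ i) N (suc r) ⟩
  N * (suc N ^ i * suc r)       ≤⟨ *-monoʳ-≤ N (compound N i (suc r) (trans (+-suc i r) eq)) ⟩
  N * (N ^ i * suc N)           ≡⟨ *-assoc N (N ^ i) (suc N) ⟨
  N * N ^ i * suc N             ∎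
  where
  open ≤-Reasoning
  rearrange₁ : ∀ a b c → a * b * c ≡ b * (a * c)
  rearrange₁ = solve-∀
  rearrange₂ : ∀ a b c → a * (b * c) ≡ b * (a * c)
  rearrange₂ = solve-∀
  one : suc N * r ≤ N * suc r
  one = ≤-trans (+-monoˡ-≤ (N * r) (≤-trans (m≤n+m r i) (≤-reflexive (suc-injective eq)))) (≤-reflexive (sym (*-suc N r)))

-- For N = k(M + 1), `compound` gives (N + 1)^k (kM + 1) ≤ N^k (k(M + 1) + 1). Weakening one summand
-- (N + 1)^k on the left to N^k allows both the N^k and then k to be cancelled.
compound-≤ : ∀ M k → 1 ≤ k → suc (k * suc M) ^ k * M ≤ (k * suc M) ^ k * suc M
compound-≤ M k 1≤k = *-cancelˡ-≤ k {{>-nonZero 1≤k}} (+-cancelʳ-≤ (N ^ k) _ _ (begin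
  k * (suc N ^ k * M) + N ^ k            ≤⟨ +-monoʳ-≤ _ (^-monoˡ-≤ k (n≤1+n N)) ⟩
  k * (suc N ^ k * M) + suc N ^ k        ≡⟨ rearrange₁ k (suc N ^ k) M ⟩
  suc N ^ k * suc (k * M)                ≤⟨ compound N k (suc (k * M)) (rearrange₂ k M) ⟩
  N ^ k * suc N                          ≡⟨ rearrange₃ (N ^ k) k M ⟩
  k * (N ^ k * suc M) + N ^ k            ∎))
  where
  open ≤-Reasoning
  N : ℕ
  N = k * suc M
  rearrange₁ : ∀ k a M → k * (a * M) + a ≡ a * suc (k * M)
  rearrange₁ = solve-∀
  rearrange₂ : ∀ k M → k + suc (k * M) ≡ suc (k * suc M)
  rearrange₂ = solve-∀
  rearrange₃ : ∀ a k M → a * suc (k * suc M) ≡ k * (a * suc M) + a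
  rearrange₃ = solve-∀

-- Passing to rational bounds and to a real error.

toℚᵘ-fromℕ : ∀ m → ℚ.toℚᵘ (fromℕ m) ℚᵘ.≃ ℚᵘ.mkℚᵘ (ℤ.+ m) 0
toℚᵘ-fromℕ m = ℚₚ.toℚᵘ-fromℚᵘ (ℚᵘ.mkℚᵘ (ℤ.+ m) 0)

fromℕ-+ : ∀ m n → fromℕ (m + n) ≡ fromℕ m ℚ.+ fromℕ n
fromℕ-+ m n = ℚₚ.toℚᵘ-injective (begin
  ℚ.toℚᵘ (fromℕ (m + n))                        ≈⟨ toℚᵘ-fromℕ (m + n) ⟩
  ℚᵘ.mkℚᵘ (ℤ.+ (m + n)) 0                         ≈⟨ ℚᵘ.*≡* (cong (ℤ._* (ℤ.+ 1)) (trans (ℤₚ.pos-+ m n)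
                                                    (sym (cong₂ ℤ._+_ (ℤₚ.*-identityʳ (ℤ.+ m)) (ℤₚ.*-identityʳ (ℤ.+ n)))))) ⟩
  ℚᵘ.mkℚᵘ (ℤ.+ m) 0 ℚᵘ.+ ℚᵘ.mkℚᵘ (ℤ.+ n) 0          ≈⟨ ℚᵘₚ.+-cong (toℚᵘ-fromℕ m) (toℚᵘ-fromℕ n) ⟨
  ℚ.toℚᵘ (fromℕ m) ℚᵘ.+ ℚ.toℚᵘ (fromℕ n)        ≈⟨ ℚₚ.toℚᵘ-homo-+ (fromℕ m) (fromℕ n) ⟨
  ℚ.toℚᵘ (fromℕ m ℚ.+ fromℕ n)                  ∎)
  where open ℚᵘₚ.≃-Reasoning

fromℕ-* : ∀ m n → fromℕ (m * n) ≡ fromℕ m ℚ.* fromℕ n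
fromℕ-* m n = ℚₚ.toℚᵘ-injective (begin
  ℚ.toℚᵘ (fromℕ (m * n))                        ≈⟨ toℚᵘ-fromℕ (m * n) ⟩
  ℚᵘ.mkℚᵘ (ℤ.+ (m * n)) 0                         ≈⟨ ℚᵘ.*≡* (cong (ℤ._* (ℤ.+ 1)) (ℤₚ.pos-* m n)) ⟩
  ℚᵘ.mkℚᵘ (ℤ.+ m) 0 ℚᵘ.* ℚᵘ.mkℚᵘ (ℤ.+ n) 0          ≈⟨ ℚᵘₚ.*-cong (toℚᵘ-fromℕ m) (toℚᵘ-fromℕ n) ⟨
  ℚ.toℚᵘ (fromℕ m) ℚᵘ.* ℚ.toℚᵘ (fromℕ n)        ≈⟨ ℚₚ.toℚᵘ-homo-* (fromℕ m) (fromℕ n) ⟨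
  ℚ.toℚᵘ (fromℕ m ℚ.* fromℕ n)                  ∎)
  where open ℚᵘₚ.≃-Reasoning

fromℕ-mono-≤ : ∀ {m n} → m ≤ n → fromℕ m ℚ.≤ fromℕ n
fromℕ-mono-≤ {m} {n} m≤n = ℚₚ.toℚᵘ-cancel-≤ (ℚᵘₚ.≤-respˡ-≃ (ℚᵘₚ.≃-sym (toℚᵘ-fromℕ m))
  (ℚᵘₚ.≤-respʳ-≃ (ℚᵘₚ.≃-sym (toℚᵘ-fromℕ n)) (ℚᵘ.*≤* (ℤₚ.*-monoʳ-≤-nonNeg (ℤ.+ 1) (ℤ.+≤+ m≤n)))))

fromℕ-nonNeg : ∀ m → NonNegative (fromℕ m)
fromℕ-nonNeg m = ℚₚ.normalize-nonNeg m 1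

*-mono-≤-nonNeg : ∀ {p q r s} → 0ℚ ℚ.≤ p → 0ℚ ℚ.≤ r → p ℚ.≤ q → r ℚ.≤ s → p ℚ.* r ℚ.≤ q ℚ.* s
*-mono-≤-nonNeg {p} {q} {r} {s} 0≤p 0≤r p≤q r≤s = ℚₚ.≤-trans
  (ℚₚ.*-monoʳ-≤-nonNeg r {{ℚ.nonNegative 0≤r}} p≤q)
  (ℚₚ.*-monoˡ-≤-nonNeg q {{ℚ.nonNegative (ℚₚ.≤-trans 0≤p p≤q)}} r≤s)

-- `EdgeBound` ranges over all rationals r, so a negative r must be ruled out as well; its cube
-- would be negative.
cube-cancel-≤ : ∀ p r → 0ℚ ℚ.≤ p → p ℚ.* p ℚ.* p ℚ.≤ r ℚ.* r ℚ.* r → p ℚ.≤ r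
cube-cancel-≤ p r 0≤p p³≤r³ with p ℚₚ.≤? r
... | yes p≤r = p≤r
... | no p≰r with 0ℚ ℚₚ.≤? r
...   | yes 0≤r = ⊥-elim (ℚₚ.<-irrefl refl (ℚₚ.≤-<-trans p³≤r³ (ℚₚ.≤-<-trans
          (*-mono-≤-nonNeg (0≤* 0≤r 0≤r) 0≤r (*-mono-≤-nonNeg 0≤r 0≤r (ℚₚ.<⇒≤ r<p) (ℚₚ.<⇒≤ r<p)) ℚₚ.≤-refl)
          (ℚₚ.*-monoʳ-<-pos (p ℚ.* p) {{ℚ.positive p²>0}} r<p))))
  where
  r<p : r ℚ.< p
  r<p = ℚₚ.≰⇒> p≰r
  0≤* : ∀ {x y} → 0ℚ ℚ.≤ x → 0ℚ ℚ.≤ y → 0ℚ ℚ.≤ x ℚ.* y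
  0≤* {x} {y} 0≤x 0≤y = ℚₚ.≤-trans (ℚₚ.≤-reflexive (sym (ℚₚ.*-zeroʳ x)))
    (ℚₚ.*-monoˡ-≤-nonNeg x {{ℚ.nonNegative 0≤x}} 0≤y)
  p>0 : 0ℚ ℚ.< p
  p>0 = ℚₚ.≤-<-trans 0≤r r<p
  p²>0 : 0ℚ ℚ.< p ℚ.* p
  p²>0 = ℚₚ.≤-<-trans (ℚₚ.≤-reflexive (sym (ℚₚ.*-zeroʳ p))) (ℚₚ.*-monoʳ-<-pos p {{ℚ.positive p>0}} p>0)
...   | no 0≰r = ⊥-elim (ℚₚ.<-irrefl refl (ℚₚ.≤-<-trans (ℚₚ.≤-trans 0≤p³ p³≤r³) r³<0))
  where
  r<0 : r ℚ.< 0ℚ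
  r<0 = ℚₚ.≰⇒> 0≰r
  r²>0 : 0ℚ ℚ.< r ℚ.* r
  r²>0 = ℚₚ.≤-<-trans (ℚₚ.≤-reflexive (sym (ℚₚ.*-zeroʳ r))) (ℚₚ.*-monoʳ-<-neg r {{ℚ.negative r<0}} r<0)
  r³<0 : r ℚ.* r ℚ.* r ℚ.< 0ℚ
  r³<0 = ℚₚ.<-≤-trans (ℚₚ.*-monoʳ-<-pos (r ℚ.* r) {{ℚ.positive r²>0}} r<0) (ℚₚ.≤-reflexive (ℚₚ.*-zeroʳ (r ℚ.* r)))
  0≤p³ : 0ℚ ℚ.≤ p ℚ.* p ℚ.* p
  0≤p³ = ℚₚ.≤-trans (ℚₚ.≤-reflexive (sym (ℚₚ.*-zeroʳ (p ℚ.* p)))) (ℚₚ.*-monoˡ-≤-nonNeg (p ℚ.* p)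
    {{ℚₚ.nonNeg*nonNeg⇒nonNeg p {{ℚ.nonNegative 0≤p}} p {{ℚ.nonNegative 0≤p}}}} 0≤p)

-- For a positive root `a`, both 1 and a - 1 have cubes at most p and are therefore at most r; their
-- sum is `a`.
cbrt≤2root : ∀ {p a} r → (∀ c → a ≡ suc c → c ³ < p) → fromℕ p ℚ.≤ r ℚ.* r ℚ.* r → fromℕ a ℚ.≤ fromℕ 2 ℚ.* r
cbrt≤2root {p} {a} r least p≤r³ = bound a least
  where
  root : ∀ c → c ³ ≤ p → fromℕ c ℚ.≤ r
  root c le = cube-cancel-≤ (fromℕ c) r (ℚₚ.nonNegative⁻¹ (fromℕ c) {{fromℕ-nonNeg c}})
    (ℚₚ.≤-trans (ℚₚ.≤-reflexive (sym (trans (fromℕ-* (c * c) c) (cong (ℚ._* fromℕ c) (fromℕ-* c c)))))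
      (ℚₚ.≤-trans (fromℕ-mono-≤ le) p≤r³))
  double : fromℕ 2 ℚ.* r ≡ r ℚ.+ r
  double = trans (ℚₚ.*-distribʳ-+ r 1ℚ 1ℚ) (cong₂ ℚ._+_ (ℚₚ.*-identityˡ r) (ℚₚ.*-identityˡ r))
  bound : ∀ a → (∀ c → a ≡ suc c → c ³ < p) → fromℕ a ℚ.≤ fromℕ 2 ℚ.* r
  bound zero    _     = ℚₚ.≤-trans (ℚₚ.≤-reflexive (sym (ℚₚ.+-identityʳ 0ℚ)))
    (ℚₚ.≤-trans (ℚₚ.+-mono-≤ (root 0 z≤n) (root 0 z≤n)) (ℚₚ.≤-reflexive (sym double)))
  bound (suc c) least = ℚₚ.≤-trans (ℚₚ.≤-reflexive (fromℕ-+ 1 c))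
    (ℚₚ.≤-trans (ℚₚ.+-mono-≤ (root 1 (≤-trans (s≤s z≤n) (least c refl))) (root c (<⇒≤ (least c refl))))
      (ℚₚ.≤-reflexive (sym double)))

-- Doubling both roots multiplies n r by 2 and s² r² by 16; `grow` enlarges the first term to give
-- both the factor 16.
edge-bound : ∀ {m p n a b} M → m ≤ M * (n * a + b * b * (a * a)) →
  (∀ c → a ≡ suc c → c ³ < p) → (∀ c → b ≡ suc c → c ³ < n) → EdgeBound m (16 * M) n p
edge-bound {m} {p} {n} {a} {b} M m≤ least-a least-b r s p≤ n≤ = begin
  fromℕ m
    ≤⟨ fromℕ-mono-≤ m≤ ⟩
  fromℕ (M * (n * a + b * b * (a * a)))
    ≡⟨ push ⟩
  fromℕ M ℚ.* (fromℕ n ℚ.* fromℕ a ℚ.+ fromℕ b ℚ.* fromℕ b ℚ.* (fromℕ a ℚ.* fromℕ a))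
    ≤⟨ ℚₚ.*-monoˡ-≤-nonNeg (fromℕ M) {{fromℕ-nonNeg M}} (ℚₚ.+-mono-≤
         (ℚₚ.*-monoˡ-≤-nonNeg (fromℕ n) {{fromℕ-nonNeg n}} a≤)
         (*-mono-≤-nonNeg (0≤* b b) (0≤* a a) (*-mono-≤-nonNeg (0≤ b) (0≤ b) b≤ b≤) (*-mono-≤-nonNeg (0≤ a) (0≤ a) a≤ a≤))) ⟩
  fromℕ M ℚ.* (fromℕ n ℚ.* (two ℚ.* r) ℚ.+ two ℚ.* s ℚ.* (two ℚ.* s) ℚ.* (two ℚ.* r ℚ.* (two ℚ.* r)))
    ≤⟨ ℚₚ.*-monoˡ-≤-nonNeg (fromℕ M) {{fromℕ-nonNeg M}} (ℚₚ.+-monoˡ-≤ _ grow) ⟩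
  fromℕ M ℚ.* (fromℕ 8 ℚ.* (fromℕ n ℚ.* (two ℚ.* r)) ℚ.+ two ℚ.* s ℚ.* (two ℚ.* s) ℚ.* (two ℚ.* r ℚ.* (two ℚ.* r)))
    ≡⟨ collect (fromℕ M) (fromℕ n) r s ⟩
  fromℕ 16 ℚ.* fromℕ M ℚ.* (fromℕ n ℚ.* r ℚ.+ s ℚ.* s ℚ.* (r ℚ.* r))
    ≡⟨ cong (ℚ._* (fromℕ n ℚ.* r ℚ.+ s ℚ.* s ℚ.* (r ℚ.* r))) (fromℕ-* 16 M) ⟨
  fromℕ (16 * M) ℚ.* (fromℕ n ℚ.* r ℚ.+ s ℚ.* s ℚ.* (r ℚ.* r)) ∎
  where
  open ℚₚ.≤-Reasoning
  two : ℚ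
  two = fromℕ 2
  a≤ : fromℕ a ℚ.≤ two ℚ.* r
  a≤ = cbrt≤2root {p} {a} r least-a p≤
  b≤ : fromℕ b ℚ.≤ two ℚ.* s
  b≤ = cbrt≤2root {n} {b} s least-b n≤
  0≤ : ∀ k → 0ℚ ℚ.≤ fromℕ k
  0≤ k = ℚₚ.nonNegative⁻¹ (fromℕ k) {{fromℕ-nonNeg k}}
  0≤* : ∀ j k → 0ℚ ℚ.≤ fromℕ j ℚ.* fromℕ k
  0≤* j k = ℚₚ.≤-trans (0≤ (j * k)) (ℚₚ.≤-reflexive (fromℕ-* j k))
  push : fromℕ (M * (n * a + b * b * (a * a))) ≡
         fromℕ M ℚ.* (fromℕ n ℚ.* fromℕ a ℚ.+ fromℕ b ℚ.* fromℕ b ℚ.* (fromℕ a ℚ.* fromℕ a))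
  push = trans (fromℕ-* M _) (cong (fromℕ M ℚ.*_) (trans (fromℕ-+ (n * a) _) (cong₂ ℚ._+_ (fromℕ-* n a)
    (trans (fromℕ-* (b * b) (a * a)) (cong₂ ℚ._*_ (fromℕ-* b b) (fromℕ-* a a))))))
  x : ℚ
  x = fromℕ n ℚ.* (two ℚ.* r)
  0≤x : 0ℚ ℚ.≤ x
  0≤x = ℚₚ.≤-trans (0≤* n a) (ℚₚ.*-monoˡ-≤-nonNeg (fromℕ n) {{fromℕ-nonNeg n}} a≤)
  grow : x ℚ.≤ fromℕ 8 ℚ.* x
  grow = ℚₚ.≤-trans (ℚₚ.≤-reflexive (sym (ℚₚ.*-identityˡ x)))
    (ℚₚ.*-monoʳ-≤-nonNeg x {{ℚ.nonNegative 0≤x}} (fromℕ-mono-≤ {1} {8} (s≤s z≤n)))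
  collect : ∀ M n r s →
    M ℚ.* (fromℕ 8 ℚ.* (n ℚ.* (two ℚ.* r)) ℚ.+ two ℚ.* s ℚ.* (two ℚ.* s) ℚ.* (two ℚ.* r ℚ.* (two ℚ.* r))) ≡
    fromℕ 16 ℚ.* M ℚ.* (n ℚ.* r ℚ.+ s ℚ.* s ℚ.* (r ℚ.* r))
  collect = solve 4 (λ M n r s →
    M :* (con (fromℕ 8) :* (n :* (con two :* r)) :+ con two :* s :* (con two :* s) :* (con two :* r :* (con two :* r))) :=
    con (fromℕ 16) :* M :* (n :* r :+ s :* s :* (r :* r))) refl
    where open +-*-Solver

numerator≥1 : ∀ r → ℚ.Positive r → fromℕ 1 ℚ.≤ r ℚ.* fromℕ (suc (ℚ.denominator-1 r))
numerator≥1 r@(ℚ.mkℚ (ℤ.+ suc k) e _) _ = ℚₚ.toℚᵘ-cancel-≤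
  (ℚᵘₚ.≤-respˡ-≃ (ℚᵘₚ.≃-sym (toℚᵘ-fromℕ 1))
    (ℚᵘₚ.≤-respʳ-≃ (ℚᵘₚ.≃-trans (ℚᵘₚ.*-cong (ℚᵘₚ.≃-refl {ℚ.toℚᵘ r}) (ℚᵘₚ.≃-sym (toℚᵘ-fromℕ (suc e))))
                                 (ℚᵘₚ.≃-sym (ℚₚ.toℚᵘ-homo-* r (fromℕ (suc e)))))
      (ℚᵘ.*≤* (subst₂ ℤ._≤_ (ℤₚ.pos-* 1 (suc e * 1)) (cong (ℤ._* (ℤ.+ 1)) (ℤₚ.pos-* (suc k) (suc e))) (ℤ.+≤+ denominator≤)))))
  where
  denominator≤ : 1 * (suc e * 1) ≤ suc k * suc e * 1
  denominator≤ = ≤-trans (≤-reflexive (*-identityˡ (suc e * 1))) (*-monoˡ-≤ 1 (m≤m+n (suc e) (k * suc e)))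
numerator≥1 (ℚ.mkℚ (ℤ.+ zero) _ _) ()
numerator≥1 (ℚ.mkℚ (ℤ.-[1+ _ ]) _ _) ()

-- Roundedness of the lower cut yields a positive rational r below ε. With N its denominator, 1/N ≤
-- r, which is at most every upper bound q of ε.
positive-margin : ∀ ε → Positive ε → ∃ λ N → ∀ d d′ → N * d′ ≤ suc N * d →
                  ∀ q → ℝ.Upper ε q → fromℕ d′ ℚ.≤ (1ℚ ℚ.+ q) ℚ.* fromℕ d
positive-margin ε ε>0 with Equivalence.to (ℝ.lower-rounded ε 0ℚ) ε>0
... | r , 0<r , r∈L = N , bound
  where
  N : ℕ
  N = suc (ℚ.denominator-1 r)
  below : ∀ q → ℝ.Upper ε q → r ℚ.≤ q
  below q q∈U with r ℚₚ.≤? q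
  ... | yes r≤q = r≤q
  ... | no r≰q = contradiction (Equivalence.from (ℝ.lower-rounded ε q) (r , ℚₚ.≰⇒> r≰q , r∈L) , q∈U) (ℝ.disjoint ε q)
  bound : ∀ d d′ → N * d′ ≤ suc N * d → ∀ q → ℝ.Upper ε q → fromℕ d′ ℚ.≤ (1ℚ ℚ.+ q) ℚ.* fromℕ d
  bound d d′ le q q∈U = ℚₚ.*-cancelˡ-≤-pos (fromℕ N) {{ℚₚ.normalize-pos N 1}} (begin
    fromℕ N ℚ.* fromℕ d′                              ≡⟨ fromℕ-* N d′ ⟨
    fromℕ (N * d′)                                    ≤⟨ fromℕ-mono-≤ le ⟩
    fromℕ (suc N * d)                                 ≡⟨ trans (fromℕ-* (suc N) d) (cong (ℚ._* fromℕ d) (fromℕ-+ 1 N)) ⟩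
    (fromℕ 1 ℚ.+ fromℕ N) ℚ.* fromℕ d                 ≤⟨ ℚₚ.*-monoʳ-≤-nonNeg (fromℕ d) {{fromℕ-nonNeg d}}
                                                           (ℚₚ.+-monoˡ-≤ (fromℕ N) (ℚₚ.≤-trans (numerator≥1 r (ℚ.positive 0<r))
                                                             (ℚₚ.*-monoʳ-≤-nonNeg (fromℕ N) {{fromℕ-nonNeg N}} (below q q∈U)))) ⟩
    (q ℚ.* fromℕ N ℚ.+ fromℕ N) ℚ.* fromℕ d           ≡⟨ rearrange q (fromℕ N) (fromℕ d) ⟩
    fromℕ N ℚ.* ((1ℚ ℚ.+ q) ℚ.* fromℕ d)              ∎)
    where
    open ℚₚ.≤-Reasoning
    rearrange : ∀ q n d → (q ℚ.* n ℚ.+ n) ℚ.* d ≡ n ℚ.* ((1ℚ ℚ.+ q) ℚ.* d)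
    rearrange = solve 3 (λ q n d → (q :* n :+ n) :* d := n :* ((con 1ℚ :+ q) :* d)) refl
      where open +-*-Solver

-- Subsets as lists, and the subgraph of chosen edges.

elements : ∀ {m} → Subset m → List (Fin m)
elements []            = []
elements (inside ∷ p)  = Fin.zero ∷ map Fin.suc (elements p)
elements (outside ∷ p) = map Fin.suc (elements p)

length-elements : ∀ {m} (p : Subset m) → length (elements p) ≡ ∣ p ∣
length-elements []            = refl
length-elements (inside ∷ p)  = cong suc (trans (length-map Fin.suc (elements p)) (length-elements p))
length-elements (outside ∷ p) = trans (length-map Fin.suc (elements p)) (length-elements p)

∈-elements : ∀ {m} {x : Fin m} {p : Subset m} → x Subset.∈ p → x ∈ elements p
∈-elements {p = inside ∷ p}  here       = here refl
∈-elements {p = inside ∷ p}  (there x∈) = there (∈-map⁺ Fin.suc (∈-elements x∈))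
∈-elements {p = outside ∷ p} (there x∈) = ∈-map⁺ Fin.suc (∈-elements x∈)

insert : ∀ {m} → Fin m → Subset m → Subset m
insert Fin.zero    (_ ∷ p) = inside ∷ p
insert (Fin.suc x) (b ∷ p) = b ∷ insert x p

∣insert∣ : ∀ {m} (x : Fin m) (p : Subset m) → ∣ insert x p ∣ ≤ suc ∣ p ∣
∣insert∣ Fin.zero    (inside ∷ p)  = n≤1+n _
∣insert∣ Fin.zero    (outside ∷ p) = ≤-refl
∣insert∣ (Fin.suc x) (inside ∷ p)  = s≤s (∣insert∣ x p)
∣insert∣ (Fin.suc x) (outside ∷ p) = ∣insert∣ x p

insert-∋ : ∀ {m} (x : Fin m) (p : Subset m) → x Subset.∈ insert x p
insert-∋ Fin.zero    (_ ∷ p) = here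
insert-∋ (Fin.suc x) (_ ∷ p) = there (insert-∋ x p)

insert-⊇ : ∀ {m} (x : Fin m) {y} {p : Subset m} → y Subset.∈ p → y Subset.∈ insert x p
insert-⊇ Fin.zero    here       = here
insert-⊇ Fin.zero    (there y∈) = there y∈
insert-⊇ (Fin.suc x) here       = here
insert-⊇ (Fin.suc x) (there y∈) = there (insert-⊇ x y∈)

fromList : ∀ {m} → List (Fin m) → Subset m
fromList []       = Subset.⊥
fromList (x ∷ xs) = insert x (fromList xs)

∣fromList∣ : ∀ {m} (xs : List (Fin m)) → ∣ fromList xs ∣ ≤ length xs
∣fromList∣ {m} []   = ≤-reflexive (Subsetₚ.∣⊥∣≡0 m)
∣fromList∣ (x ∷ xs) = ≤-trans (∣insert∣ x (fromList xs)) (s≤s (∣fromList∣ xs))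

∈-fromList : ∀ {m} {x : Fin m} {xs : List (Fin m)} → x ∈ xs → x Subset.∈ fromList xs
∈-fromList {xs = x ∷ xs} (here refl) = insert-∋ x (fromList xs)
∈-fromList {xs = x ∷ xs} (there y∈)  = insert-⊇ x (∈-fromList y∈)

-- Intersecting with the edges of `G` makes the result a subgraph without any condition on the list.
restrict : ∀ {n} → WeightedDigraph n → List (Fin n × Fin n) → WeightedDigraph n
restrict G E = record { edges = edges G Subset.∩ fromList (map (λ (u , v) → combine u v) E) ; weight = weight G }

∣restrict∣ : ∀ {n} (G : WeightedDigraph n) E → ∣ edges (restrict G E) ∣ ≤ length E
∣restrict∣ G E = ≤-trans (Subsetₚ.∣p∩q∣≤∣q∣ (edges G) _) (≤-trans (∣fromList∣ (map (λ (u , v) → combine u v) E))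
  (≤-reflexive (length-map (λ (u , v) → combine u v) E)))

restrict-subgraph : ∀ {n} (G : WeightedDigraph n) E → IsSubgraph (restrict G E) G
restrict-subgraph G E = Subsetₚ.p∩q⊆p (edges G) _ , λ _ _ _ → refl

^-mono-< : ∀ {a b} k → 1 ≤ k → a < b → a ^ k < b ^ k
^-mono-< {a} {b} (suc zero)    _ lt = subst₂ _<_ (sym (*-identityʳ a)) (sym (*-identityʳ b)) lt
^-mono-< {a} {b} (suc (suc k)) _ lt = *-mono-< lt (^-mono-< (suc k) (s≤s z≤n) lt)

-- The preserver and its size.

module Preserver {n : ℕ} (G : WeightedDigraph n) (c : ℕ) (positive : PositiveWeights G)
                 (weights≤ : WeightsAtMost G (n ^ c)) (P : PairSet n)
                 (N₀ k N J L Λ K : ℕ) (N≡ : N ≡ k * suc N₀) (1≤k : 1 ≤ k) (1≤N : 1 ≤ N) (1≤J : 1 ≤ J) (1≤L : 1 ≤ L) (1≤Λ : 1 ≤ Λ)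
                 (1≤K : 1 ≤ K) (nn<2^k : n * n < 2 ^ k) (n<4^J : n < 4 ^ J) (nnn<2^L : n * n * n < 2 ^ L)
                 (nW<2^Λ : n * n ^ c < 2 ^ Λ)
                 (K≥first : 4 * L * first-factor (2 * (20 * J * N)) J L Λ ≤ K)
                 (K≥second : 64 * (L * L) * second-factor (2 * (20 * J * N)) J L Λ ≤ K) where

  module H = Halving G (n ^ c) weights≤ positive N J L Λ 1≤N 1≤J 1≤Λ n<4^J nW<2^Λ

  -- R m h bounds the edges bought per demand pair in one round. As `a` and `b` are the rounded
  -- roots of the initial p̂ and of n, the bound `C` holds in every round.
  p̂ a b X I R C : ℕ
  p̂ = ∣ P ∣
  a = proj₁ (cbrt p̂)
  b = proj₁ (cbrt n)
  X = n * a + b * b * (a * a)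
  I = 2 * (20 * J * N)
  R = 20 * J * N + Λ * (1 + I + J * 3)
  C = R * (4 * K * X)

  p̂≤nn : p̂ ≤ n * n
  p̂≤nn = Subsetₚ.∣p∣≤n P

  positive-order : ∀ {p} → p ≤ n * n → 1 ≤ p → 1 ≤ n
  positive-order p≤nn 1≤p = n≢0⇒n>0 λ { refl → contradiction (≤-trans 1≤p p≤nn) λ () }

  halves : ∀ p → 1 ≤ p → p ≤ p̂ → H.Halves C p
  halves p 1≤p p≤ with parameters n p a b K L 1≤n 1≤p p≤nn 1≤K (≤-trans p≤ (proj₁ (proj₂ (cbrt p̂)))) (proj₁ (proj₂ (cbrt n)))
    where
    p≤nn : p ≤ n * n
    p≤nn = ≤-trans p≤ p̂≤nn
    1≤n : 1 ≤ n
    1≤n = positive-order p≤nn 1≤p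
  ... | h , m , 1≤h , 1≤m , cost , good = λ Ps |Ps|≤p →
    let E , vt , E≤ , rest = H.halve h m p 1≤h 1≤m p<2^L pn<2^L
          (λ s hs≤ → let x , sp , sx , xx = good s hs≤ in within-budget m I J L Λ s p x K 1≤L 1≤K K≥first K≥second sp sx xx) Ps |Ps|≤p
    in E , vt , ≤-trans E≤ cost′ , rest
    where
    p≤nn : p ≤ n * n
    p≤nn = ≤-trans p≤ p̂≤nn
    1≤n : 1 ≤ n
    1≤n = positive-order p≤nn 1≤p
    pn<2^L : p * n < 2 ^ L
    pn<2^L = ≤-<-trans (*-monoˡ-≤ n p≤nn) nnn<2^L
    p<2^L : p < 2 ^ L
    p<2^L with p * n <? p
    ... | no p≤pn = ≤-<-trans (≮⇒≥ p≤pn) pn<2^L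
    ... | yes pn<p = contradiction (≤-trans (≤-reflexive (sym (*-identityʳ p))) (*-monoʳ-≤ p 1≤n)) (<⇒≱ pn<p)
    cost′ : p * (H.D₁ + Λ * H.scale-cost h m) ≤ C
    cost′ = begin
      p * (H.D₁ + Λ * (suc (I * m + J * (3 * m)) * h))
        ≤⟨ *-monoʳ-≤ p (+-mono-≤ (≤-trans (≤-reflexive (sym (*-identityʳ H.D₁))) (*-monoʳ-≤ H.D₁ (*-mono-≤ 1≤m 1≤h)))
             (*-monoʳ-≤ Λ (*-monoˡ-≤ h (+-monoˡ-≤ (I * m + J * (3 * m)) 1≤m)))) ⟩
      p * (H.D₁ * (m * h) + Λ * ((m + (I * m + J * (3 * m))) * h))
        ≡⟨ rearrange p H.D₁ m h Λ I J ⟩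
      R * (p * m * h)
        ≤⟨ *-monoʳ-≤ R cost ⟩
      C ∎
      where
      open ≤-Reasoning
      rearrange : ∀ p D m h Λ I J → p * (D * (m * h) + Λ * ((m + (I * m + J * (3 * m))) * h)) ≡
                  (D + Λ * (1 + I + J * 3)) * (p * m * h)
      rearrange = solve-∀

  open H.Recursion C p̂ halves

  pairs : List (Fin n × Fin n)
  pairs = map (remQuot {n} n) (elements P)

  opaque
    solution : Σ (List (Fin n × Fin n)) λ E → length E ≤ k * C ×
      (∀ {uv} → uv ∈ pairs → H.dist uv < Distance.∞ G (n ^ c) weights≤ → H.Preserved k E uv)
    solution = solve k p̂ pairs (≤-reflexive (trans (length-map (remQuot {n} n) (elements P)) (length-elements P)))
      (≤-<-trans p̂≤nn nn<2^k) ≤-refl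

  E : List (Fin n × Fin n)
  E = proj₁ solution

  preserver : WeightedDigraph n
  preserver = restrict G E

  size : ∣ edges preserver ∣ ≤ k * (R * (4 * K)) * X
  size = ≤-trans (∣restrict∣ G E) (≤-trans (proj₁ (proj₂ solution)) (≤-reflexive (rearrange k R (4 * K) X)))
    where
    rearrange : ∀ k r q x → k * (r * (q * x)) ≡ k * (r * q) * x
    rearrange = solve-∀

  open Distance G (n ^ c) weights≤ using (d; d≤walk; walk-bounded)
  open Scaling G (n ^ c) weights≤ using (Route; []; edge; virt)

  route-walk : ∀ {u v ℓ} → Route E [] u v ℓ → Σ (Walk preserver u v) λ w → walkLength w ≡ ℓ
  route-walk [] = [] , refl
  route-walk (edge {u} {v} e uv∈ r) with route-walk r
  ... | w , refl = Subsetₚ.x∈p∩q⁺ (e , ∈-fromList (∈-map⁺ (λ (u , v) → combine u v) uv∈)) ∷ w , refl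
  route-walk (virt () _)

  preserved : ∀ {u v} → combine u v Subset.∈ P → Walk G u v → H.Preserved k E (u , v)
  preserved {u} {v} uv∈ w = proj₂ (proj₂ solution)
    (subst (_∈ pairs) (Finₚ.remQuot-combine u v) (∈-map⁺ (remQuot {n} n) (∈-elements uv∈)))
    (s≤s (≤-trans (walk-bounded w) (m≤m+n _ _)))

  short-walk : ∀ {u v} → H.Preserved k E (u , v) →
               Σ (Walk preserver u v) λ w → N₀ * walkLength w ≤ suc N₀ * d u v
  short-walk {u} {v} (l , r , le) with route-walk r
  ... | w′ , refl = w′ , *-cancelˡ-≤ (N ^ k) {{m^n≢0 N k {{>-nonZero 1≤N}}}} (begin
    N ^ k * (N₀ * walkLength w′)       ≡⟨ rearrange (N ^ k) N₀ (walkLength w′) ⟩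
    N₀ * (N ^ k * walkLength w′)       ≤⟨ *-monoʳ-≤ N₀ le ⟩
    N₀ * (suc N ^ k * d u v)           ≡⟨ rearrange′ N₀ (suc N ^ k) (d u v) ⟩
    -- N = k(N₀ + 1) was chosen so that k rounds of stretch 1 + 1/N amount to at most 1 + 1/N₀.
    suc N ^ k * N₀ * d u v             ≤⟨ *-monoˡ-≤ (d u v) (subst (λ N → suc N ^ k * N₀ ≤ N ^ k * suc N₀) (sym N≡) (compound-≤ N₀ k 1≤k)) ⟩
    N ^ k * suc N₀ * d u v             ≡⟨ *-assoc (N ^ k) (suc N₀) (d u v) ⟩
    N ^ k * (suc N₀ * d u v)           ∎)
    where
    open ≤-Reasoning
    rearrange : ∀ a b c → a * (b * c) ≡ b * (a * c)
    rearrange = solve-∀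
    rearrange′ : ∀ a b c → a * (b * c) ≡ b * a * c
    rearrange′ = solve-∀

  is-preserver : ∀ ε → (∀ d d′ → N₀ * d′ ≤ suc N₀ * d → ∀ q → ℝ.Upper ε q → fromℕ d′ ℚ.≤ (1ℚ ℚ.+ q) ℚ.* fromℕ d) →
                 IsApproxPreserver ε G P preserver
  is-preserver ε margin = restrict-subgraph G E , approx
    where
    approx : ∀ u v → combine u v Subset.∈ P → ∀ δ → IsDist G u v δ →
             ∃ λ δ′ → IsDist preserver u v δ′ × δ′ ≤[1+ ε ]* δ
    approx u v uv∈ _ (finite w w-min) with Walks.shortest preserver u v | short-walk (preserved uv∈ w)
    ... | inj₂ none        | w′ , _  = contradiction w′ none
    ... | inj₁ (w″ , min) | w′ , le = [ walkLength w″ ] , finite w″ min ,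
      margin (walkLength w) (walkLength w″) (≤-trans (*-monoʳ-≤ N₀ (min w′))
        (≤-trans le (*-monoʳ-≤ (suc N₀) (d≤walk w))))
    -- Any value is below ∞, but a distance in the preserver must still be exhibited, which requires
    -- deciding reachability there.
    approx u v uv∈ _ (infinite _) with Walks.shortest preserver u v
    ... | inj₁ (w″ , min) = [ walkLength w″ ] , finite w″ min , tt
    ... | inj₂ none       = ⊤⁺ , infinite none , tt

-- The polylogarithmic factor.

firstₚ secondₚ : (I J L Λ : Poly) → Poly
firstₚ I J L Λ = con 2 ⊠ Λ ⊠ (con 3 ⊞ I ⊠ (con 16 ⊠ L ⊠ L))
secondₚ I J L Λ = con 2 ⊠ Λ ⊠ (J ⊠ ((con 5 ⊞ I ⊞ con 20 ⊠ J) ⊠ (con 336 ⊠ (I ⊠ L) ⊠ (I ⊠ L))))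

K-of R-of I-of : (N J L Λ : ℕ) → ℕ
I-of N J L Λ = 2 * (20 * J * N)
K-of N J L Λ = 4 * L * first-factor (I-of N J L Λ) J L Λ + 64 * (L * L) * second-factor (I-of N J L Λ) J L Λ
R-of N J L Λ = 20 * J * N + Λ * (1 + I-of N J L Λ + J * 3)

factor : (k N J L Λ : ℕ) → ℕ
factor k N J L Λ = k * (R-of N J L Λ * (4 * K-of N J L Λ))

I-ofₚ R-ofₚ K-ofₚ : (N J L Λ : Poly) → Poly
I-ofₚ N J L Λ = con 2 ⊠ (con 20 ⊠ J ⊠ N)
R-ofₚ N J L Λ = con 20 ⊠ J ⊠ N ⊞ Λ ⊠ (con 1 ⊞ I-ofₚ N J L Λ ⊞ J ⊠ con 3)
K-ofₚ N J L Λ = con 4 ⊠ L ⊠ firstₚ (I-ofₚ N J L Λ) J L Λ ⊞ con 64 ⊠ (L ⊠ L) ⊠ secondₚ (I-ofₚ N J L Λ) J L Λ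

factorₚ : (k N J L Λ : Poly) → Poly
factorₚ k N J L Λ = k ⊠ (R-ofₚ N J L Λ ⊠ (con 4 ⊠ K-ofₚ N J L Λ))

eval-first : ∀ I J L Λ ℓ → eval (firstₚ I J L Λ) ℓ ≡ first-factor (eval I ℓ) (eval J ℓ) (eval L ℓ) (eval Λ ℓ)
eval-first I J L Λ ℓ = refl

eval-second : ∀ I J L Λ ℓ → eval (secondₚ I J L Λ) ℓ ≡ second-factor (eval I ℓ) (eval J ℓ) (eval L ℓ) (eval Λ ℓ)
eval-second I J L Λ ℓ = refl

eval-K : ∀ N J L Λ ℓ → eval (K-ofₚ N J L Λ) ℓ ≡ K-of (eval N ℓ) (eval J ℓ) (eval L ℓ) (eval Λ ℓ)
eval-K N J L Λ ℓ = cong₂ _+_ (cong (4 * eval L ℓ *_) (eval-first (I-ofₚ N J L Λ) J L Λ ℓ))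
  (cong (64 * (eval L ℓ * eval L ℓ) *_) (eval-second (I-ofₚ N J L Λ) J L Λ ℓ))

eval-R : ∀ N J L Λ ℓ → eval (R-ofₚ N J L Λ) ℓ ≡ R-of (eval N ℓ) (eval J ℓ) (eval L ℓ) (eval Λ ℓ)
eval-R N J L Λ ℓ = refl

eval-factor : ∀ k N J L Λ ℓ → eval (factorₚ k N J L Λ) ℓ ≡ factor (eval k ℓ) (eval N ℓ) (eval J ℓ) (eval L ℓ) (eval Λ ℓ)
eval-factor k N J L Λ ℓ = cong (eval k ℓ *_) (cong₂ _*_ (eval-R N J L Λ ℓ) (cong (4 *_) (eval-K N J L Λ ℓ)))

roots : (n p : ℕ) → ℕ
roots n p = n * proj₁ (cbrt p) + proj₁ (cbrt n) * proj₁ (cbrt n) * (proj₁ (cbrt p) * proj₁ (cbrt p))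

Margin : ℕ → ℝ → Set
Margin N₀ ε = ∀ d d′ → N₀ * d′ ≤ suc N₀ * d → ∀ q → ℝ.Upper ε q → fromℕ d′ ℚ.≤ (1ℚ ℚ.+ q) ℚ.* fromℕ d

exists-preserver : ∀ {n} (G : WeightedDigraph n) c → PositiveWeights G → WeightsAtMost G (n ^ c) → (P : PairSet n) →
  ∀ N₀ k N J L Λ → N ≡ k * suc N₀ → 1 ≤ k → 1 ≤ N → 1 ≤ J → 1 ≤ L → 1 ≤ Λ →
  n * n < 2 ^ k → n < 4 ^ J → n * n * n < 2 ^ L → n * n ^ c < 2 ^ Λ →
  ∃ λ H → (∀ ε → Margin N₀ ε → IsApproxPreserver ε G P H) × ∣ edges H ∣ ≤ factor k N J L Λ * roots n (∣ P ∣)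
exists-preserver {n} G c positive weights≤ P N₀ k N J L Λ N≡ 1≤k 1≤N 1≤J 1≤L 1≤Λ nn< n< nnn< nW< =
  preserver , is-preserver , size
  where
  K≥first : 4 * L * first-factor (I-of N J L Λ) J L Λ ≤ K-of N J L Λ
  K≥first = m≤m+n _ _
  K≥second : 64 * (L * L) * second-factor (I-of N J L Λ) J L Λ ≤ K-of N J L Λ
  K≥second = m≤n+m _ (4 * L * first-factor (I-of N J L Λ) J L Λ)
  1≤K : 1 ≤ K-of N J L Λ
  1≤K = ≤-trans (*-mono-≤ (*-mono-≤ {1} {4} (s≤s z≤n) 1≤L) (*-mono-≤ (*-mono-≤ {1} {2} (s≤s z≤n) 1≤Λ)
          (s≤s (z≤n {2 + I-of N J L Λ * (16 * L * L)})))) K≥first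
  open Preserver G c positive weights≤ P N₀ k N J L Λ (K-of N J L Λ) N≡ 1≤k 1≤N 1≤J 1≤L 1≤Λ 1≤K nn< n< nnn< nW<
         K≥first K≥second using (preserver; is-preserver; size)

module Polylogarithmic (N₀ c : ℕ) where

  -- Given n < 2^ℓ, the exponent 2ℓ covers the n² possible pairs, 3ℓ the n³ stretches of their
  -- paths, and (c + 1)ℓ the distances up to n · n^c.
  kₚ Nₚ Jₚ Lₚ Λₚ : Poly
  kₚ = con 2 ⊠ var
  Nₚ = kₚ ⊠ con (suc N₀)
  Jₚ = var
  Lₚ = con 3 ⊠ var
  Λₚ = var ⊠ con (suc c)

  polylog-preserver : ∀ {n} (G : WeightedDigraph n) → PositiveWeights G → WeightsAtMost G (n ^ c) → (P : PairSet n) →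
    ∀ ℓ → 1 ≤ ℓ → n < 2 ^ ℓ →
    ∃ λ H → (∀ ε → Margin N₀ ε → IsApproxPreserver ε G P H) ×
            ∣ edges H ∣ ≤ eval (factorₚ kₚ Nₚ Jₚ Lₚ Λₚ) ℓ * roots n (∣ P ∣)
  polylog-preserver {n} G positive weights≤ P ℓ 1≤ℓ n<2^ℓ =
    let H , is-preserver , size = exists-preserver G c positive weights≤ P N₀
          (eval kₚ ℓ) (eval Nₚ ℓ) (eval Jₚ ℓ) (eval Lₚ ℓ) (eval Λₚ ℓ) refl 1≤k (*-mono-≤ 1≤k (s≤s (z≤n {N₀}))) 1≤ℓ
          (*-mono-≤ {1} {3} (s≤s z≤n) 1≤ℓ) (*-mono-≤ 1≤ℓ (s≤s (z≤n {c}))) nn<2^k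
          (<-≤-trans n<2^ℓ (^-monoˡ-≤ ℓ (s≤s (s≤s z≤n)))) nnn<2^L nW<2^Λ
    in H , is-preserver , ≤-trans size (≤-reflexive (cong (_* roots n (∣ P ∣)) (sym (eval-factor kₚ Nₚ Jₚ Lₚ Λₚ ℓ))))
    where
    1≤k : 1 ≤ eval kₚ ℓ
    1≤k = *-mono-≤ {1} {2} (s≤s z≤n) 1≤ℓ
    nn<2^k : n * n < 2 ^ eval kₚ ℓ
    nn<2^k = subst (n * n <_) (trans (sym (^-distribˡ-+-* 2 ℓ ℓ)) (cong (2 ^_) (cong (ℓ +_) (sym (+-identityʳ ℓ)))))
      (*-mono-< n<2^ℓ n<2^ℓ)
    nnn<2^L : n * n * n < 2 ^ eval Lₚ ℓ
    nnn<2^L = subst (n * n * n <_)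
      (trans (cong (_* 2 ^ ℓ) (sym (^-distribˡ-+-* 2 ℓ ℓ))) (trans (sym (^-distribˡ-+-* 2 (ℓ + ℓ) ℓ)) (cong (2 ^_) (rearrange ℓ))))
      (*-mono-< (*-mono-< n<2^ℓ n<2^ℓ) n<2^ℓ)
      where
      rearrange : ∀ l → l + l + l ≡ 3 * l
      rearrange = solve-∀
    nW<2^Λ : n * n ^ c < 2 ^ eval Λₚ ℓ
    nW<2^Λ = subst (n ^ suc c <_) (^-*-assoc 2 ℓ (suc c)) (^-mono-< (suc c) (s≤s z≤n) n<2^ℓ)

  polylog : Poly
  polylog = factorₚ kₚ Nₚ Jₚ Lₚ Λₚ

  Bounded : ℕ → ℕ → Set₁
  Bounded C k = ∀ n (G : WeightedDigraph n) → PositiveWeights G → WeightsAtMost G (n ^ c) →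
    (P : PairSet n) → ∀ ℓ → 1 ≤ ℓ → n < 2 ^ ℓ →
    ∃ λ H → (∀ ε → Margin N₀ ε → IsApproxPreserver ε G P H) × ∣ edges H ∣ ≤ C * ℓ ^ k * roots n (∣ P ∣)

  bounded : ∀ C k → (∀ ℓ → 1 ≤ ℓ → eval polylog ℓ ≤ C * ℓ ^ k) → Bounded C k
  bounded C k le n G positive weights≤ P ℓ 1≤ℓ n<2^ℓ =
    let H , is-preserver , size = polylog-preserver G positive weights≤ P ℓ 1≤ℓ n<2^ℓ
    in H , is-preserver , ≤-trans size (*-monoˡ-≤ (roots n (∣ P ∣)) (le ℓ 1≤ℓ))

  opaque
    bounded-preserver : ∃₂ Bounded
    bounded-preserver = let C , k , le = eval-bound polylog in C , k , bounded C k le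

theoremA1 : (ε : ℝ) → Positive ε → (c : ℕ) →
    ∃₂ λ (C k : ℕ) →
    (n : ℕ) (G : WeightedDigraph n) →
    PositiveWeights G → WeightsAtMost G (n ^ c) →
    (P : PairSet n) →
    ∃ λ (H : WeightedDigraph n) →
    IsApproxPreserver ε G P H ×
    EdgeBound (∣ edges H ∣) (C * suc ⌊log₂ n ⌋ ^ k) n (∣ P ∣)
theoremA1 ε ε>0 c =
  -- `N₀` depends only on ε, so `C` and `k` are fixed by ε and c before the graph is given.
  let N₀ , margin = positive-margin ε ε>0
      C , k , preserve = Polylogarithmic.bounded-preserver N₀ c
  in 16 * C , k , λ n G positive weights≤ P →
     let ℓ = suc ⌊log₂ n ⌋
         H , is-preserver , size = preserve n G positive weights≤ P ℓ (s≤s z≤n) (n<2^[1+⌊log₂n⌋] n)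
     in H , is-preserver ε margin ,
        subst (λ M → EdgeBound (∣ edges H ∣) M n (∣ P ∣)) (sym (*-assoc 16 C (ℓ ^ k)))
          (edge-bound (C * ℓ ^ k) size (proj₂ (proj₂ (cbrt (∣ P ∣)))) (proj₂ (proj₂ (cbrt n))))
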